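{- Let $v\in\tilde W^a$ and let $t$ be the type of a minimal gallery connecting $A_f$ and $A_v$. Then for every $A\in\tilde{\mathcal A}$, \[ X_AT_v=\sum_{B\in\tilde{\mathcal A}}L_t(A,B)\,X_B. \]
   Context: $\Phi=(X,\phi,X^\vee,\phi^\vee)$ is a reduced root datum with finite Weyl group $W$, positive roots $\phi^+$, $V^*=X^\vee\otimes\mathbb R$. Alcoves: closures of components of $V^*\setminus\bigcup_{\alpha\in\phi^+,m\in\mathbb Z}\{\langle\alpha,x\rangle=m\}$; $A_f=\{0\le\langle\alpha,x\rangle\le1\}$. $\tilde W^a=W\ltimes X^\vee$ ($\tau_\mu$ translations), $W^a=W\ltimes Q^\vee$ Coxeter group with generators $S^a$ = reflections in walls of $A_f$, $\Omega$ the stabilizer of $A_f$, $\tilde W^a=\Omega\ltimes W^a$, $l(wg)=l(w)$. Generalized alcoves $\tilde{\mathcal A}=\{(A,\mu):\mu\in A\cap X^\vee\}$, free transitive componentwise $\tilde W^a$-action, $A_v=v\cdot(A_f,0)$, right action $A_vu=A_{vu}$; each $A$ is uniquely $\mu+A_w$ ($w\in W$), $wt(A)=\mu$, $\delta(A)=w$. For $s\in S^a$: $A\prec As$ if the alcove of $A$ lies on the side $\langle\alpha,x\rangle\le m$ of the hyperplane $H_{\alpha,m}$ containing the common face of $A$ and $As$, otherwise $A\succ As$. Galleries: a type is $t=(t_1,\dots,t_k)$, $t_i\in S^a\cup\Omega$; a gallery of type $t$ connecting $A$ and $B$ is $(A=A_0,\dots,A_k=B)$ with $A_{i+1}=A_it_{i+1}$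 if $t_{i+1}\in\Omega$, $A_{i+1}\in\{A_i,A_it_{i+1}\}$ otherwise; minimal = of minimal length among galleries connecting the same generalized alcoves. Positive $s$-direction at $i$: $t_{i+1}=s$, $A_{i+1}=A_is$, $A_i\prec A_is$; $s$-fold at $i$: $A_{i+1}=A_i$, positive if $A_i\succ A_is$; positively folded = all folds positive. Parameters: $d:S^a\to\mathbb N$ invariant under $\tilde W^a$-conjugation, $\mathcal L=\mathbb Z[q^{\pm1/2}]$, $q_s=q^{d(s)}$, $q_v=\prod q_{t_j}$ for reduced $v=t_1\cdots t_kg$; $q_\lambda=q_{\tau_\lambda}^{1/2}$ for dominant $\lambda$, $q_{\lambda-\lambda'}=q_\lambda/q_{\lambda'}$. $L_\sigma=\prod_s q_s^{m_s(\sigma)}(q_s-1)^{n_s(\sigma)}$ ($m_s$ = number of positive $s$-directions, $n_s$ = number of $s$-folds); $L_t(A,B)=\sum L_\sigma$ over positively folded galleries $\sigma$ of type $t$ connecting $A$ and $B$. Hecke algebra $\tilde{\mathcal H}$: $\mathcal L$-basis $T_w$ ($w\in\tilde W^a$), $T_s^2=q_sT_{id}+(q_s-1)T_s$, $T_vT_w=T_{vw}$ if lengths add; $\overline T_w=T_{w^{ -1}}^{ -1}$; $X_{\lambda-\lambda'}=q_{\lambda-\lambda'}^{ -1}T_{\tau_\lambda}T_{\tau_{\lambda'}}^{ -1}$; $X_A=q_{ -wt(A)}q_{\delta(A)}X_{wt(A)}\overline T_{\delta(A)}$. -}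

module Defs where

open import Level using (Level; _⊔_) renaming (suc to lsuc)
open import Data.Nat as ℕ using (ℕ; zero; suc)
open import Data.Integer as ℤ using (ℤ; +_; -[1+_])
open import Data.Rational as ℚ using (ℚ)
open import Data.Fin using (Fin)
open import Data.Vec as V using (Vec; []; _∷_)
open import Data.Nat.ListAction using (sum)
open import Data.List as L using (List; []; _∷_; length; map; foldr; filter; deduplicate)
open import Data.List.Relation.Unary.All using (All)
open import Data.List.Relation.Unary.Unique.Propositional using (Unique)
open import Data.List.Membership.Propositional using (_∈_)
open import Data.Product using (Σ; ∃; ∃-syntax; _×_; _,_; proj₁; proj₂)
open import Relation.Nullary using (¬_)
open import Relation.Binary.PropositionalEquality using (_≡_; _≢_)
open import Relation.Binary.Definitions using (DecidableEquality)
import Data.Vec.Properties as VP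
import Data.Product.Properties as PP
open import Algebra.Bundles using (Ring)

-- Root data.  X and X^∨ are identified with ℤ^n via dual bases, so the
-- perfect pairing is the dot product.  V^* = X^∨ ⊗ ℝ; we use rational
-- points ℚ^n (all polyhedra below are rational).

dotℤ : ∀ {n} → Vec ℤ n → Vec ℤ n → ℤ
dotℤ xs ys = V.foldr _ ℤ._+_ (+ 0) (V.zipWith ℤ._*_ xs ys)

toℚ : ℤ → ℚ
toℚ z = z ℚ./ 1

dotℚ : ∀ {n} → Vec ℤ n → Vec ℚ n → ℚ
dotℚ xs ys = V.foldr _ ℚ._+_ ℚ.0ℚ (V.zipWith (λ a y → toℚ a ℚ.* y) xs ys)

scaleℤ : ∀ {n} → ℤ → Vec ℤ n → Vec ℤ n
scaleℤ k = V.map (k ℤ.*_)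

_-ᵛ_ : ∀ {n} → Vec ℤ n → Vec ℤ n → Vec ℤ n
xs -ᵛ ys = V.zipWith ℤ._-_ xs ys

_+ᵛ_ : ∀ {n} → Vec ℤ n → Vec ℤ n → Vec ℤ n
xs +ᵛ ys = V.zipWith ℤ._+_ xs ys

-ᵛ_ : ∀ {n} → Vec ℤ n → Vec ℤ n
-ᵛ xs = V.map ℤ.-_ xs

record RootDatum : Set where
  field
    n        : ℕ
    r        : ℕ
    root     : Fin r → Vec ℤ n
    coroot   : Fin r → Vec ℤ n
    root-inj   : ∀ i j → root i ≡ root j → i ≡ j
    coroot-inj : ∀ i j → coroot i ≡ coroot j → i ≡ j
    pairing-2  : ∀ i → dotℤ (root i) (coroot i) ≡ + 2
    refl-root   : ∀ i j → ∃[ k ] (root j -ᵛ scaleℤ (dotℤ (root j) (coroot i)) (root i) ≡ root k)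
    refl-coroot : ∀ i j → ∃[ k ] (coroot j -ᵛ scaleℤ (dotℤ (root i) (coroot j)) (coroot i) ≡ coroot k)
    reduced : ∀ i j → root j ≢ scaleℤ (+ 2) (root i)
    -- the chosen system of positive roots φ⁺ = {α : ⟨α, ρ⟩ > 0} for a regular ρ
    ρ       : Vec ℤ n
    regular : ∀ i → dotℤ (root i) ρ ≢ + 0

module Geometry (D : RootDatum) where
  open RootDatum D public

  Positive : Fin r → Set
  Positive i = + 0 ℤ.< dotℤ (root i) ρ

  Dominant : Vec ℤ n → Set
  Dominant λ′ = ∀ i → Positive i → + 0 ℤ.≤ dotℤ (root i) λ′

  Mat : Set
  Mat = Vec (Vec ℤ n) n

  matVec : Mat → Vec ℤ n → Vec ℤ n
  matVec M y = V.map (λ row → dotℤ row y) M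

  matVecℚ : Mat → Vec ℚ n → Vec ℚ n
  matVecℚ M x = V.map (λ row → dotℚ row x) M

  matMul : Mat → Mat → Mat
  matMul A B = V.map (λ row → V.map (λ col → dotℤ row col) (V.transpose B)) A

  idMat : Mat
  idMat = V.tabulate (λ a → V.tabulate (λ b → δ a b))
    where
    open import Data.Fin.Properties using (_≟_)
    open import Relation.Nullary using (yes; no)
    δ : Fin n → Fin n → ℤ
    δ a b with a ≟ b
    ... | yes _ = + 1
    ... | no  _ = + 0

  -- matrix of s_{α_i} on X^∨:  y ↦ y - ⟨α_i, y⟩ α_i^∨
  reflMat : Fin r → Mat
  reflMat i = V.zipWith (λ idrow ca → idrow -ᵛ scaleℤ ca (root i)) idMat (coroot i)

  InW : Mat → Set
  InW M = ∃[ word ] (M ≡ foldr (λ i A → matMul (reflMat i) A) idMat word)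

  -- elements of W̃^a = W ⋉ X^∨ are pairs (w, μ) standing for τ_μ w : x ↦ w x + μ;
  -- raw pairs are Elt, membership in W̃^a is InWa.
  Elt : Set
  Elt = Mat × Vec ℤ n

  InWa : Elt → Set
  InWa (M , μ) = InW M

  _≟E_ : DecidableEquality Elt
  _≟E_ = PP.≡-dec (VP.≡-dec (VP.≡-dec ℤ._≟_)) (VP.≡-dec ℤ._≟_)

  _·_ : Elt → Elt → Elt
  (M , μ) · (M′ , μ′) = matMul M M′ , (matVec M μ′ +ᵛ μ)

  idE : Elt
  idE = idMat , V.replicate n (+ 0)

  prodE : List Elt → Elt
  prodE = foldr _·_ idE

  act : Elt → Vec ℚ n → Vec ℚ n
  act (M , μ) x = V.zipWith ℚ._+_ (matVecℚ M x) (V.map toℚ μ)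

  τ : Vec ℤ n → Elt
  τ λ′ = idMat , λ′

  finPart : Elt → Elt
  finPart (M , μ) = M , V.replicate n (+ 0)

  wtOf : Elt → Vec ℤ n
  wtOf (M , μ) = μ

  InAf : Vec ℚ n → Set
  InAf x = ∀ i → Positive i → (ℚ.0ℚ ℚ.≤ dotℚ (root i) x) × (dotℚ (root i) x ℚ.≤ ℚ.1ℚ)

  -- the affine reflection s_{α_i,k} in H_{α_i,k} = {⟨α_i,x⟩ = k}:  x ↦ s_{α_i} x + k α_i^∨
  reflE : Fin r → ℤ → Elt
  reflE i k = reflMat i , scaleℤ k (coroot i)

  IsWall : Fin r → ℤ → Set
  IsWall i k = ∃[ x ] (InAf x × dotℚ (root i) x ≡ toℚ k ×
                 (∀ j m → Positive j → dotℚ (root j) x ≡ toℚ m → (j ≡ i × m ≡ k)))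

  IsS : Elt → Set
  IsS s = ∃[ i ] ∃[ k ] (Positive i × IsWall i k × s ≡ reflE i k)

  IsΩ : Elt → Set
  IsΩ g = InWa g × (∀ x → (InAf x → InAf (act g x)) × (InAf (act g x) → InAf x))

  Factorization : Elt → List Elt → Elt → Set
  Factorization v ss g = All IsS ss × IsΩ g × v ≡ prodE ss · g

  -- l(v) = k  (Coxeter length on W^a, extended by l(wg) = l(w))
  IsLength : Elt → ℕ → Set
  IsLength v k = (∃[ ss ] ∃[ g ] (Factorization v ss g × length ss ≡ k))
               × (∀ ss g → Factorization v ss g → k ℕ.≤ length ss)

  ConjInvariant : (Elt → ℕ) → Set
  ConjInvariant d = ∀ s s′ v → IsS s → IsS s′ → InWa v → v · s ≡ s′ · v → d s ≡ d s′

  -- A_u ≺ A_u s  (s ∈ S^a the reflection in the wall H_{α_i,k} of A_f): the common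
  -- face of A_u and A_{us} lies in u(H_{α_i,k}) = H_{α_j,m} (α_j ∈ φ⁺), and the
  -- alcove u A_f lies on the side ⟨α_j, x⟩ ≤ m.
  Prec : Elt → Elt → Set
  Prec u s = ∃[ i ] ∃[ k ] ∃[ j ] ∃[ m ] (Positive i × s ≡ reflE i k × Positive j ×
               (∀ x → (dotℚ (root i) x ≡ toℚ k → dotℚ (root j) (act u x) ≡ toℚ m)
                    × (dotℚ (root j) (act u x) ≡ toℚ m → dotℚ (root i) x ≡ toℚ k)) ×
               (∀ x → InAf x → dotℚ (root j) (act u x) ℚ.≤ toℚ m))

  data Letter : Set where
    S : Elt → Letter
    O : Elt → Letter

  eltOf : Letter → Elt
  eltOf (S s) = s
  eltOf (O g) = g

  ValidLetter : Letter → Set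
  ValidLetter (S s) = IsS s
  ValidLetter (O g) = IsΩ g

  ValidType : List Letter → Set
  ValidType = All ValidLetter

  -- galleries of type t, written on the parameters u of the generalized alcoves A_u
  -- (A_u t = A_{ut}):  Gallery u t B  = galleries of type t connecting A_u and A_B
  data Gallery : Elt → List Letter → Elt → Set where
    nil   : ∀ {u} → Gallery u [] u
    cross : ∀ {u ts B} (l : Letter) → Gallery (u · eltOf l) ts B → Gallery u (l ∷ ts) B
    fold  : ∀ {u ts B} (s : Elt) → Gallery u ts B → Gallery u (S s ∷ ts) B

  MinimalType : List Letter → Elt → Set
  MinimalType t v = ValidType t × Gallery idE t v ×
                    (∀ t′ → ValidType t′ → Gallery idE t′ v → length t ℕ.≤ length t′)

-- Hecke algebra, realised in a ring R containing Q = q^{1/2} (central,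
-- invertible) such that {Q^k T_w} is a ℤ-basis (⇔ T_w is an L-basis, L = ℤ[Q^{±1}]).
module HeckeOver (D : RootDatum) (d : Geometry.Elt D → ℕ)
                 {c ℓ : Level} (R : Ring c ℓ) where
  open Geometry D
  open Ring R public

  ιℕ : ℕ → Carrier
  ιℕ zero    = 0#
  ιℕ (suc k) = 1# + ιℕ k

  ιℤ : ℤ → Carrier
  ιℤ (+ k)     = ιℕ k
  ιℤ -[1+ k ]  = - ιℕ (suc k)

  powℕ : Carrier → ℕ → Carrier
  powℕ x zero    = 1#
  powℕ x (suc k) = x * powℕ x k

  sumR : List Carrier → Carrier
  sumR = foldr _+_ 0#

  module _ (Q Qi : Carrier) where
    Qpow : ℤ → Carrier
    Qpow (+ k)    = powℕ Q k
    Qpow -[1+ k ] = powℕ Qi (suc k)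

    -- q_s = q^{d(s)} = Q^{2 d(s)}
    qs : Elt → Carrier
    qs s = Qpow (+ (2 ℕ.* d s))

    combo : (Elt → Carrier) → List (ℤ × ℤ × Elt) → Carrier
    combo T cs = sumR (map (λ { (a , k , w) → ιℤ a * (Qpow k * T w) }) cs)

    record IsHecke (T : Elt → Carrier) : Set (c ⊔ ℓ) where
      field
        Q-Qi     : Q * Qi ≈ 1#
        Qi-Q     : Qi * Q ≈ 1#
        Q-central : ∀ h → Q * h ≈ h * Q
        T-id     : T idE ≈ 1#
        quadratic : ∀ s → IsS s → T s * T s ≈ qs s * T idE + (qs s - 1#) * T s
        length-add : ∀ v w a b → InWa v → InWa w → IsLength v a → IsLength w b →
                     IsLength (v · w) (a ℕ.+ b) → T v * T w ≈ T (v · w)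
        spanning : ∀ h → ∃[ cs ] (All (λ x → InWa (proj₂ (proj₂ x))) cs × h ≈ combo T cs)
        independent : ∀ cs → All (λ x → InWa (proj₂ (proj₂ x))) cs →
                      Unique (map proj₂ cs) → combo T cs ≈ 0# →
                      All (λ x → proj₁ x ≡ + 0) cs

    module _ (T : Elt → Carrier) where
      -- the numbers q_v, q_λ and the elements X_λ, T̄_w, X_A.  Each is specified by its
      -- defining property (they are well defined, so these pin the values down).
      record Bernstein : Set (c ⊔ ℓ) where
        field
          qv   : Elt → ℕ              -- q_v = q^{qv v}
          qw   : Vec ℤ n → ℤ          -- q_μ = Q^{qw μ}
          X    : Vec ℤ n → Carrier
          Tbar : Elt → Carrier
          qv-spec : ∀ v ss g → InWa v → Factorization v ss g → IsLength v (length ss) →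
                    qv v ≡ sum (map d ss)
          qw-spec : ∀ λ′ λ″ → Dominant λ′ → Dominant λ″ →
                    qw (λ′ -ᵛ λ″) ≡ (+ qv (τ λ′)) ℤ.- (+ qv (τ λ″))
          X-spec  : ∀ λ′ λ″ y → Dominant λ′ → Dominant λ″ →
                    T (τ λ″) * y ≈ 1# → y * T (τ λ″) ≈ 1# →
                    X (λ′ -ᵛ λ″) ≈ Qpow (ℤ.- qw (λ′ -ᵛ λ″)) * (T (τ λ′) * y)
          Tbar-spec : ∀ w w′ → InWa w → w′ · w ≡ idE →
                      (Tbar w * T w′ ≈ 1#) × (T w′ * Tbar w ≈ 1#)

        -- X_{A_u} = q_{-wt} q_δ X_{wt} T̄_δ  for A_u = wt + A_δ
        XA : Elt → Carrier
        XA u = Qpow (qw (-ᵛ wtOf u)) * (Qpow (+ (2 ℕ.* qv (finPart u)))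
               * (X (wtOf u) * Tbar (finPart u)))

    -- PosWeight σ L : σ is positively folded and L_σ = L
    data PosWeight : ∀ {u t B} → Gallery u t B → Carrier → Set (c ⊔ ℓ) where
      w-nil  : ∀ {u} → PosWeight (nil {u}) 1#
      w-Ω    : ∀ {u ts B g} {σ : Gallery (u · g) ts B} {L} →
               PosWeight σ L → PosWeight (cross (O g) σ) L
      w-up   : ∀ {u ts B s} {σ : Gallery (u · s) ts B} {L} →
               Prec u s → PosWeight σ L → PosWeight (cross (S s) σ) (qs s * L)
      w-down : ∀ {u ts B s} {σ : Gallery (u · s) ts B} {L} →
               ¬ Prec u s → PosWeight σ L → PosWeight (cross (S s) σ) L
      w-fold : ∀ {u ts B s} {σ : Gallery u ts B} {L} →
               ¬ Prec u s → PosWeight σ L → PosWeight (fold s σ) ((qs s - 1#) * L)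

    PFG : Elt → List Letter → Set (c ⊔ ℓ)
    PFG u t = Σ Elt λ B → Σ (Gallery u t B) λ σ → Σ Carrier λ L → PosWeight σ L

    key : ∀ {u t} → PFG u t → Σ Elt λ B → Gallery u t B
    key (B , σ , _) = B , σ

    Enumerates : ∀ {u t} → List (PFG u t) → Set (c ⊔ ℓ)
    Enumerates {u} {t} Gs = Unique (map key Gs) ×
      (∀ B (σ : Gallery u t B) L → PosWeight σ L → (B , σ) ∈ map key Gs)

    Lt : ∀ {u t} → List (PFG u t) → Elt → Carrier
    Lt Gs B = sumR (map (λ x → proj₁ (proj₂ (proj₂ x)))
                        (filter (λ x → proj₁ x ≟E B) Gs))

    -- the (finite) support: endpoints B with a positively folded gallery
    ends : ∀ {u t} → List (PFG u t) → List Elt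
    ends Gs = deduplicate _≟E_ (map proj₁ Gs)

{-# OPTIONS --safe #-}

-- Write f_j(u) for the integer with f_j(u) ≤ ⟨α_j, x⟩ ≤ f_j(u) + 1 on the alcove u A_f; then l(u) = Σ_{α_j > 0} |f_j(u)|,
-- because the first wall of A_f crossed by a generic segment from A_f to u⁻¹ A_f shortens u.
-- Translating by a sufficiently dominant λ makes all f_j nonnegative, so that A_u ≺ A_{us} becomes l(τ_λ u s) = l(τ_λ u) + 1,
-- while X_{A_u} = q^{l(τ_λ) − l(τ_λ u)} T_{τ_λ}⁻¹ T_{τ_λ u} (with l weighted by d).  Hence X_A T_s is q_s X_{As} if A ≺ As,
-- and X_{As} + (q_s − 1) X_A otherwise.  By the deletion property T_v is the product of the T_{t_i} along a minimal gallery,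
-- and multiplying these in one after the other generates the positively folded galleries with their weights.

module Submission where

open import Defs
open import Level using (Level; _⊔_)
open import Algebra.Bundles using (Ring; CommutativeRing; AbelianGroup; RawRing)
import Algebra.Properties.Group
import Algebra.Solver.Ring as RS
import Algebra.Solver.Ring.AlmostCommutativeRing as ACR
open import Algebra.Structures using (IsCommutativeRing)
open import Data.Bool using (Bool; true; false)
import Data.Bool.Properties as BoolP
open import Data.Empty using (⊥; ⊥-elim)
open import Data.Fin as Fin using (Fin; zero; suc)
import Data.Fin.Properties as FinP
open import Data.Integer as ℤ using (ℤ; -[1+_]; 0ℤ; 1ℤ)
import Data.Integer.Properties as ℤP
open import Data.Integer.Tactic.RingSolver using (solve-∀)
open import Data.List as L using (List; []; _∷_; _++_; length; map; foldr; filter)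
open import Data.List.Membership.Propositional using (_∈_; find)
open import Data.List.Membership.Propositional.Properties
  using (∈-map⁺; ∈-map⁻; ∈-++⁺ˡ; ∈-++⁺ʳ; ∈-filter⁺; ∈-filter⁻; ∈-cartesianProduct⁺; ∈-cartesianProduct⁻; ∈-allFin; ∈-deduplicate⁺)
open import Data.List.Membership.Propositional.Properties.WithK using (unique∧set⇒bag)
import Data.List.Properties as LP
open import Data.List.Relation.Binary.BagAndSetEquality using (∼bag⇒↭)
open import Data.List.Relation.Binary.Permutation.Propositional as Perm using (_↭_)
open import Data.List.Relation.Unary.All as All using (All; []; _∷_)
import Data.List.Relation.Unary.All.Properties as AllP
open import Data.List.Relation.Unary.AllPairs using ([]; _∷_)
open import Data.List.Relation.Unary.Any using (Any; here; there)
open import Data.List.Relation.Unary.Unique.DecPropositional.Properties using (deduplicate-!)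
open import Data.List.Relation.Unary.Unique.Propositional using (Unique)
import Data.List.Relation.Unary.Unique.Propositional.Properties as UniqueP
open import Data.Maybe as Maybe using (Maybe)
open import Data.Nat as ℕ using (ℕ; zero; suc)
open import Data.Nat.ListAction using (sum)
import Data.Nat.ListAction.Properties as SumP
import Data.Nat.Properties as ℕP
open import Data.Product using (Σ; ∃-syntax; _×_; _,_; proj₁; proj₂)
open import Data.Product.Properties using (≡-dec)
open import Data.Rational as ℚ using (ℚ)
import Data.Rational.Properties as ℚP
open import Data.Rational.Solver using () renaming (module +-*-Solver to ℚSolver)
import Data.Rational.Unnormalised as ℚᵘ
import Data.Rational.Unnormalised.Properties as ℚᵘP
open import Data.Sum using (_⊎_; inj₁; inj₂)
open import Data.Vec as V using (Vec; []; _∷_)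
import Data.Vec.Properties as VP
open import Function using (_∘_; case_of_; mk⇔)
open import Relation.Binary.Definitions using (tri<; tri≈; tri>)
open import Relation.Binary.PropositionalEquality
import Relation.Binary.Reasoning.Setoid as SetoidReasoning
open import Relation.Nullary using (¬_; Dec; yes; no)
open import Relation.Nullary.Decidable using (¬?; does; dec-true; dec-false; dec⇒maybe)

-- The Coxeter length governing `length-add` is a minimum over factorizations, so the hyperplane
-- count must be compared with it from both sides: a letter raises the count by at most one, and
-- every element outside Ω has a letter that lowers it. A wall of A_f is witnessed by a rational
-- point lying on it and on no other hyperplane. Given such a point, crossing the wall is seen to
-- alter a single floor. Conversely, such a point must be produced to exhibit a descent, which is
-- why the segment has to be generic: its exit point from A_f then lies on one hyperplane only.
-- Rational points are kept as integer vectors with a denominator, so that inequalities live in ℤ.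
-- The root datum describes reflections on roots and on coroots separately; that w carries α_i^∨ to
-- ±α_j^∨ whenever it carries α_i to ±α_j, so that conjugates of reflections are reflections, is
-- derived from the finiteness of the set of coroots. In the Hecke algebra, X_A and X_{As} are
-- compared through one λ serving both alcoves, and the given enumeration of galleries is matched
-- with a canonical one up to permutation.

-- Integer matrices acting on K^n, for K = ℤ (the lattice X^∨) and K = ℚ (points of V^*).

module Lin {K : Set} {_+_ _*_ : K → K → K} { -_ : K → K} {0# 1# : K}
           (isCR : IsCommutativeRing _≡_ _+_ _*_ -_ 0# 1#) (ι : ℤ → K)
           (ι-+ : ∀ a b → ι (a ℤ.+ b) ≡ ι a + ι b)
           (ι-* : ∀ a b → ι (a ℤ.* b) ≡ ι a * ι b)
           (ι-1 : ι 1ℤ ≡ 1#) where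
  open IsCommutativeRing isCR
    using (+-identityˡ; +-identityʳ; *-identityˡ; *-identityʳ; zeroˡ; zeroʳ; -‿inverseʳ; +-assoc)
  KR : CommutativeRing _ _
  KR = record { isCommutativeRing = isCR }

  ι-0 : ι 0ℤ ≡ 0#
  ι-0 = begin
    z                ≡⟨ +-identityʳ z ⟨
    z + 0#           ≡⟨ cong (z +_) (-‿inverseʳ z) ⟨
    z + (z + (- z))  ≡⟨ +-assoc z z (- z) ⟨
    (z + z) + (- z)  ≡⟨ cong (_+ (- z)) (ι-+ 0ℤ 0ℤ) ⟨
    z + (- z)        ≡⟨ -‿inverseʳ z ⟩
    0#               ∎
    where
    open ≡-Reasoning
    z = ι 0ℤ

  ι-neg : ∀ a → ι (ℤ.- a) ≡ - ι a
  ι-neg a = begin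
    x                    ≡⟨ +-identityʳ x ⟨
    x + 0#               ≡⟨ cong (x +_) (-‿inverseʳ (ι a)) ⟨
    x + (ι a + (- ι a))  ≡⟨ +-assoc x (ι a) (- ι a) ⟨
    (x + ι a) + (- ι a)  ≡⟨ cong (_+ (- ι a)) (ι-+ (ℤ.- a) a) ⟨
    ι (ℤ.- a ℤ.+ a) + (- ι a) ≡⟨ cong (λ b → ι b + (- ι a)) (ℤP.+-inverseˡ a) ⟩
    ι 0ℤ + (- ι a)  ≡⟨ cong (_+ (- ι a)) ι-0 ⟩
    0# + (- ι a)    ≡⟨ +-identityˡ (- ι a) ⟩
    - ι a           ∎
    where
    open ≡-Reasoning
    x = ι (ℤ.- a)

  ℤ-raw : RawRing _ _
  ℤ-raw = CommutativeRing.rawRing ℤP.+-*-commutativeRing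

  K-almost : ACR.AlmostCommutativeRing _ _
  K-almost = ACR.fromCommutativeRing KR

  ι-morphism : ℤ-raw ACR.-Raw-AlmostCommutative⟶ K-almost
  ι-morphism = record { ⟦_⟧ = ι ; +-homo = ι-+ ; *-homo = ι-* ; -‿homo = ι-neg ; 0-homo = ι-0 ; 1-homo = ι-1 }

  ι-≟ : ∀ a b → Maybe (ι a ≡ ι b)
  ι-≟ a b = Maybe.map (cong ι) (dec⇒maybe (a ℤ.≟ b))

  open RS ℤ-raw K-almost ι-morphism ι-≟
    renaming (_:+_ to _⊕_; _:*_ to _⊗_; :-_ to ⊝_; _:=_ to _⊜_) using (solve)

  dot : ∀ {n} → Vec ℤ n → Vec K n → K
  dot xs ys = V.foldr _ _+_ 0# (V.zipWith (λ a y → ι a * y) xs ys)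

  mv : ∀ {m n} → Vec (Vec ℤ n) m → Vec K n → Vec K m
  mv M x = V.map (λ row → dot row x) M

  dot-+ˡ : ∀ {n} (a b : Vec ℤ n) (y : Vec K n) → dot (a +ᵛ b) y ≡ dot a y + dot b y
  dot-+ˡ [] [] [] = sym (+-identityʳ 0#)
  dot-+ˡ (a ∷ as) (b ∷ bs) (y ∷ ys) = trans (cong₂ (λ u v → (u * y) + v) (ι-+ a b) (dot-+ˡ as bs ys))
    (solve 5 (λ a b y p q → (((a ⊕ b) ⊗ y) ⊕ (p ⊕ q)) ⊜ (((a ⊗ y) ⊕ p) ⊕ ((b ⊗ y) ⊕ q))) refl
      (ι a) (ι b) y (dot as ys) (dot bs ys))

  dot-scaleˡ : ∀ {n} k (a : Vec ℤ n) (y : Vec K n) → dot (scaleℤ k a) y ≡ ι k * dot a y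
  dot-scaleˡ k [] [] = sym (zeroʳ (ι k))
  dot-scaleˡ k (a ∷ as) (y ∷ ys) = trans (cong₂ (λ u v → (u * y) + v) (ι-* k a) (dot-scaleˡ k as ys))
    (solve 4 (λ k a y p → (((k ⊗ a) ⊗ y) ⊕ (k ⊗ p)) ⊜ (k ⊗ ((a ⊗ y) ⊕ p))) refl (ι k) (ι a) y (dot as ys))

  dot-−ˡ : ∀ {n} (a b : Vec ℤ n) (y : Vec K n) → dot (a -ᵛ b) y ≡ dot a y + (- dot b y)
  dot-−ˡ [] [] [] = sym (-‿inverseʳ 0#)
  dot-−ˡ (a ∷ as) (b ∷ bs) (y ∷ ys) =
    trans (cong₂ (λ u v → (u * y) + v) (trans (ι-+ a (ℤ.- b)) (cong (ι a +_) (ι-neg b))) (dot-−ˡ as bs ys))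
    (solve 5 (λ a b y p q → (((a ⊕ (⊝ b)) ⊗ y) ⊕ (p ⊕ (⊝ q))) ⊜ (((a ⊗ y) ⊕ p) ⊕ (⊝ ((b ⊗ y) ⊕ q)))) refl
      (ι a) (ι b) y (dot as ys) (dot bs ys))

  dot-0ˡ : ∀ {n} (y : Vec K n) → dot (V.replicate n 0ℤ) y ≡ 0#
  dot-0ˡ [] = refl
  dot-0ˡ (y ∷ ys) = trans (cong₂ (λ u v → (u * y) + v) ι-0 (dot-0ˡ ys)) (trans (+-identityʳ _) (zeroˡ y))

  dot-+ʳ : ∀ {n} (a : Vec ℤ n) (x y : Vec K n) → dot a (V.zipWith _+_ x y) ≡ dot a x + dot a y
  dot-+ʳ [] [] [] = sym (+-identityʳ 0#)
  dot-+ʳ (a ∷ as) (x ∷ xs) (y ∷ ys) = trans (cong ((ι a * (x + y)) +_) (dot-+ʳ as xs ys))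
    (solve 5 (λ a x y p q → ((a ⊗ (x ⊕ y)) ⊕ (p ⊕ q)) ⊜ (((a ⊗ x) ⊕ p) ⊕ ((a ⊗ y) ⊕ q))) refl
      (ι a) x y (dot as xs) (dot as ys))

  dot-scaleʳ : ∀ {n} k (a : Vec ℤ n) (x : Vec K n) → dot a (V.map (k *_) x) ≡ k * dot a x
  dot-scaleʳ k [] [] = sym (zeroʳ k)
  dot-scaleʳ k (a ∷ as) (x ∷ xs) = trans (cong ((ι a * (k * x)) +_) (dot-scaleʳ k as xs))
    (solve 4 (λ k a x p → ((a ⊗ (k ⊗ x)) ⊕ (k ⊗ p)) ⊜ (k ⊗ ((a ⊗ x) ⊕ p))) refl k (ι a) x (dot as xs))

  dot-ι : ∀ {n} (a : Vec ℤ n) (y : Vec ℤ n) → dot a (V.map ι y) ≡ ι (dotℤ a y)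
  dot-ι [] [] = sym ι-0
  dot-ι (a ∷ as) (y ∷ ys) = trans (cong₂ _+_ (sym (ι-* a y)) (dot-ι as ys)) (sym (ι-+ (a ℤ.* y) (dotℤ as ys)))

  -- The left-hand side contains `V.transpose (b ∷ B)` as it unfolds: the entries of b are prepended
  -- to the columns of B.
  row-cons : ∀ {m n} (c : ℤ) (r : Vec ℤ m) (b : Vec ℤ n) (cols : Vec (Vec ℤ m) n) →
    V.map (dotℤ (c ∷ r)) (V._⊛_ (V._⊛_ (V.replicate n _∷_) b) cols)
      ≡ scaleℤ c b +ᵛ V.map (dotℤ r) cols
  row-cons c r [] [] = refl
  row-cons c r (b ∷ bs) (col ∷ cols) = cong (_ ∷_) (row-cons c r bs cols)

  -- This is (rB)x = r(Bx). It yields both the action law for matrix products and the adjointness of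
  -- `transposed`; the induction follows the recursion of `V.transpose` on the rows of B.
  dot-matMul-row : ∀ {m n} (r : Vec ℤ m) (B : Vec (Vec ℤ n) m) (x : Vec K n) →
    dot (V.map (dotℤ r) (V.transpose B)) x ≡ dot r (mv B x)
  dot-matMul-row {n = n} r [] x with r
  ... | [] = trans (cong (λ z → dot z x) (VP.map-replicate (dotℤ []) [] n)) (dot-0ˡ x)
  dot-matMul-row {n = n} (c ∷ r) (b ∷ B) x = begin
    dot (V.map (dotℤ (c ∷ r)) (V.transpose (b ∷ B))) x  ≡⟨ cong (λ z → dot z x) (row-cons c r b (V.transpose B)) ⟩
    dot (scaleℤ c b +ᵛ V.map (dotℤ r) (V.transpose B)) x ≡⟨ dot-+ˡ (scaleℤ c b) _ x ⟩
    dot (scaleℤ c b) x + dot (V.map (dotℤ r) (V.transpose B)) x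
      ≡⟨ cong₂ _+_ (dot-scaleˡ c b x) (dot-matMul-row r B x) ⟩
    (ι c * dot b x) + dot r (mv B x) ∎
    where open ≡-Reasoning

  mv-* : ∀ {l m n} (A : Vec (Vec ℤ m) l) (B : Vec (Vec ℤ n) m) (x : Vec K n) →
    mv (V.map (λ row → V.map (λ col → dotℤ row col) (V.transpose B)) A) x ≡ mv A (mv B x)
  mv-* [] B x = refl
  mv-* (a ∷ A) B x = cong₂ _∷_ (dot-matMul-row a B x) (mv-* A B x)

  mv-+ : ∀ {m n} (A : Vec (Vec ℤ n) m) (x y : Vec K n) →
    mv A (V.zipWith _+_ x y) ≡ V.zipWith _+_ (mv A x) (mv A y)
  mv-+ [] x y = refl
  mv-+ (a ∷ A) x y = cong₂ _∷_ (dot-+ʳ a x y) (mv-+ A x y)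

  mv-ι : ∀ {m n} (A : Vec (Vec ℤ n) m) (y : Vec ℤ n) →
    mv A (V.map ι y) ≡ V.map ι (V.map (λ row → dotℤ row y) A)
  mv-ι [] y = refl
  mv-ι (a ∷ A) y = cong₂ _∷_ (dot-ι a y) (mv-ι A y)

  -- For A the identity matrix this is x ↦ x - ⟨α,x⟩c, the reflection as `reflMat` builds it; a
  -- general A makes the induction on rows possible.
  mv-refl : ∀ {m n} (A : Vec (Vec ℤ n) m) (c : Vec ℤ m) (α : Vec ℤ n) (x : Vec K n) →
    mv (V.zipWith (λ row k → row -ᵛ scaleℤ k α) A c) x
      ≡ V.zipWith (λ y k → y + (- (ι k * dot α x))) (mv A x) c
  mv-refl [] [] α x = refl
  mv-refl (a ∷ A) (c ∷ cs) α x = cong₂ _∷_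
    (trans (dot-−ˡ a (scaleℤ c α) x) (cong (λ z → dot a x + (- z)) (dot-scaleˡ c α x)))
    (mv-refl A cs α x)

  dot-refl : ∀ {n} (β : Vec ℤ n) (x : Vec K n) (c : Vec ℤ n) (t : K) →
    dot β (V.zipWith (λ y k → y + (- (ι k * t))) x c) ≡ dot β x + (- (ι (dotℤ β c) * t))
  dot-refl [] [] [] t = sym (trans (cong (λ z → 0# + (- (z * t))) ι-0)
    (trans (cong (λ z → 0# + (- z)) (zeroˡ t)) (-‿inverseʳ 0#)))
  dot-refl (b ∷ β) (x ∷ xs) (c ∷ cs) t =
    trans (cong ((ι b * (x + (- (ι c * t)))) +_) (dot-refl β xs cs t))
    (trans
      (solve 6 (λ b x c t p q → ((b ⊗ (x ⊕ (⊝ (c ⊗ t)))) ⊕ (p ⊕ (⊝ (q ⊗ t))))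
                      ⊜ (((b ⊗ x) ⊕ p) ⊕ (⊝ (((b ⊗ c) ⊕ q) ⊗ t)))) refl (ι b) x (ι c) t (dot β xs) (ι (dotℤ β cs)))
      (cong (λ z → ((ι b * x) + dot β xs) + (- (z * t)))
        (sym (trans (ι-+ (b ℤ.* c) (dotℤ β cs)) (cong (_+ ι (dotℤ β cs)) (ι-* b c))))))

  dot-unit : ∀ {n} (a : Fin n) (g : Vec ℤ n) (x : Vec K n) →
    V.lookup g a ≡ 1ℤ → (∀ b → b ≢ a → V.lookup g b ≡ 0ℤ) → dot g x ≡ V.lookup x a
  dot-unit zero (g ∷ gs) (x ∷ xs) p q = trans
    (cong₂ (λ u v → (ι u * x) + v) p (trans (cong (λ z → dot z xs) gs≡0) (dot-0ˡ xs)))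
    (trans (+-identityʳ _) (trans (cong (_* x) ι-1) (*-identityˡ x)))
    where
    gs≡0 : gs ≡ V.replicate _ 0ℤ
    gs≡0 = trans (sym (VP.tabulate∘lookup gs))
      (trans (VP.tabulate-cong (λ i → trans (q (suc i) (λ ())) (sym (VP.lookup-replicate i 0ℤ))))
        (VP.tabulate∘lookup (V.replicate _ 0ℤ)))
  dot-unit (suc a) (g ∷ gs) (x ∷ xs) p q = trans
    (cong₂ (λ u v → (u * x) + v) (trans (cong ι (q zero (λ ()))) ι-0)
       (dot-unit a gs xs p (λ b b≢a → q (suc b) (λ { refl → b≢a refl }))))
    (trans (cong (_+ V.lookup xs a) (zeroˡ x)) (+-identityˡ _))

  mv-id : ∀ {n} (A : Vec (Vec ℤ n) n) (x : Vec K n) →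
    (∀ a → V.lookup (V.lookup A a) a ≡ 1ℤ) → (∀ a b → b ≢ a → V.lookup (V.lookup A a) b ≡ 0ℤ) → mv A x ≡ x
  mv-id A x p q = begin
    mv A x                          ≡⟨ VP.tabulate∘lookup (mv A x) ⟨
    V.tabulate (V.lookup (mv A x))  ≡⟨ VP.tabulate-cong (λ a → trans (VP.lookup-map a (λ row → dot row x) A)
                                                 (dot-unit a (V.lookup A a) x (p a) (q a))) ⟩
    V.tabulate (V.lookup x)  ≡⟨ VP.tabulate∘lookup x ⟩
    x                                       ∎
    where open ≡-Reasoning

open import Data.Integer using (+_)

module Lℤ = Lin ℤP.+-*-isCommutativeRing (λ z → z) (λ _ _ → refl) (λ _ _ → refl) refl

toℚ≃ : ∀ z → ℚ.toℚᵘ (toℚ z) ℚᵘ.≃ ℚᵘ.mkℚᵘ z 0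
toℚ≃ z = ℚP.toℚᵘ-fromℚᵘ (ℚᵘ.mkℚᵘ z 0)

toℚ-+ : ∀ a b → toℚ (a ℤ.+ b) ≡ toℚ a ℚ.+ toℚ b
toℚ-+ a b = ℚP.toℚᵘ-injective (ℚᵘP.≃-trans (toℚ≃ (a ℤ.+ b)) (ℚᵘP.≃-trans (ℚᵘ.*≡* (solve a b))
  (ℚᵘP.≃-sym (ℚᵘP.≃-trans (ℚP.toℚᵘ-homo-+ (toℚ a) (toℚ b)) (ℚᵘP.+-cong (toℚ≃ a) (toℚ≃ b))))))
  where
  solve : ∀ a b → (a ℤ.+ b) ℤ.* (+ 1) ≡ (a ℤ.* (+ 1) ℤ.+ b ℤ.* (+ 1)) ℤ.* (+ 1)
  solve = solve-∀

toℚ-* : ∀ a b → toℚ (a ℤ.* b) ≡ toℚ a ℚ.* toℚ b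
toℚ-* a b = ℚP.toℚᵘ-injective (ℚᵘP.≃-trans (toℚ≃ (a ℤ.* b)) (ℚᵘP.≃-trans (ℚᵘ.*≡* refl)
  (ℚᵘP.≃-sym (ℚᵘP.≃-trans (ℚP.toℚᵘ-homo-* (toℚ a) (toℚ b)) (ℚᵘP.*-cong (toℚ≃ a) (toℚ≃ b))))))

toℚ-neg : ∀ a → toℚ (ℤ.- a) ≡ ℚ.- toℚ a
toℚ-neg a = ℚP.toℚᵘ-injective (ℚᵘP.≃-trans (toℚ≃ (ℤ.- a))
  (ℚᵘP.≃-sym (ℚᵘP.≃-trans (ℚP.toℚᵘ-homo‿- (toℚ a)) (ℚᵘP.-‿cong (toℚ≃ a)))))

toℚ-injective : ∀ {a b} → toℚ a ≡ toℚ b → a ≡ b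
toℚ-injective {a} {b} eq with ℚᵘP.≃-trans (ℚᵘP.≃-sym (toℚ≃ a)) (ℚᵘP.≃-trans (ℚᵘP.≃-reflexive (cong ℚ.toℚᵘ eq)) (toℚ≃ b))
... | ℚᵘ.*≡* e = trans (sym (ℤP.*-identityʳ a)) (trans e (ℤP.*-identityʳ b))

toℚ-mono-≤ : ∀ {a b} → a ℤ.≤ b → toℚ a ℚ.≤ toℚ b
toℚ-mono-≤ {a} {b} a≤b = ℚP.toℚᵘ-cancel-≤ (ℚᵘP.≤-respˡ-≃ (ℚᵘP.≃-sym (toℚ≃ a)) (ℚᵘP.≤-respʳ-≃ (ℚᵘP.≃-sym (toℚ≃ b))
  (ℚᵘ.*≤* (subst₂ ℤ._≤_ (sym (ℤP.*-identityʳ a)) (sym (ℤP.*-identityʳ b)) a≤b))))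

toℚ-cancel-≤ : ∀ {a b} → toℚ a ℚ.≤ toℚ b → a ℤ.≤ b
toℚ-cancel-≤ {a} {b} le with ℚᵘP.≤-respˡ-≃ (toℚ≃ a) (ℚᵘP.≤-respʳ-≃ (toℚ≃ b) (ℚP.toℚᵘ-mono-≤ le))
... | ℚᵘ.*≤* e = subst₂ ℤ._≤_ (ℤP.*-identityʳ a) (ℤP.*-identityʳ b) e

module Lℚ = Lin ℚP.+-*-isCommutativeRing toℚ toℚ-+ toℚ-* refl

dot-comm : ∀ {n} (x y : Vec ℤ n) → dotℤ x y ≡ dotℤ y x
dot-comm [] [] = refl
dot-comm (x ∷ xs) (y ∷ ys) = cong₂ ℤ._+_ (ℤP.*-comm x y) (dot-comm xs ys)

dot-0ʳ : ∀ {n} (x : Vec ℤ n) → dotℤ x (V.replicate n (+ 0)) ≡ + 0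
dot-0ʳ x = trans (dot-comm x _) (Lℤ.dot-0ˡ x)

-- Unit vectors detect the entries. Testing equality by pairings turns later vector identities into
-- scalar ones within reach of the ring solver.
dot-ext : ∀ {n} {a b : Vec ℤ n} → (∀ y → dotℤ a y ≡ dotℤ b y) → a ≡ b
dot-ext {a = []} {[]} _ = refl
dot-ext {a = a ∷ as} {b ∷ bs} h = cong₂ _∷_ h0 (dot-ext h1)
  where
  h0 : a ≡ b
  h0 with h (+ 1 ∷ V.replicate _ (+ 0))
  ... | e rewrite dot-0ʳ as | dot-0ʳ bs | ℤP.*-identityʳ a | ℤP.*-identityʳ b | ℤP.+-identityʳ a | ℤP.+-identityʳ b = e
  h1 : ∀ y → dotℤ as y ≡ dotℤ bs y
  h1 y with h (+ 0 ∷ y)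
  ... | e rewrite ℤP.*-zeroʳ a | ℤP.*-zeroʳ b | ℤP.+-identityˡ (dotℤ as y) | ℤP.+-identityˡ (dotℤ bs y) = e

dot-extʳ : ∀ {n} {a b : Vec ℤ n} → (∀ β → dotℤ β a ≡ dotℤ β b) → a ≡ b
dot-extʳ {a = a} {b} h = dot-ext (λ y → trans (dot-comm a y) (trans (h y) (dot-comm y b)))

mv-ext : ∀ {m n} {A B : Vec (Vec ℤ n) m} → (∀ y → Lℤ.mv A y ≡ Lℤ.mv B y) → A ≡ B
mv-ext {A = []} {[]} _ = refl
mv-ext {A = a ∷ A} {b ∷ B} h =
  cong₂ _∷_ (dot-ext (λ y → VP.∷-injectiveˡ (h y))) (mv-ext (λ y → VP.∷-injectiveʳ (h y)))

open Algebra.Properties.Group (AbelianGroup.group ℤP.+-0-abelianGroup) using () renaming (∙-cancelʳ to +-cancelʳ)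

-- The extended affine Weyl group as a group of affine maps

module Group (D : RootDatum) where
  open Geometry D public

  -- The entry function of `idMat` is local to its definition; unification through `refl` makes it
  -- accessible.
  idEntry : Σ (Fin n → Fin n → ℤ) λ f → idMat ≡ V.tabulate (λ a → V.tabulate (f a))
  idEntry = _ , refl

  idEntry-diag : ∀ a → proj₁ idEntry a a ≡ 1ℤ
  idEntry-diag a with a FinP.≟ a
  ... | yes _ = refl
  ... | no a≢a = ⊥-elim (a≢a refl)

  idEntry-off : ∀ a b → b ≢ a → proj₁ idEntry a b ≡ 0ℤ
  idEntry-off a b b≢a with a FinP.≟ b
  ... | yes refl = ⊥-elim (b≢a refl)
  ... | no _ = refl

  idMat-lookup : ∀ a b → V.lookup (V.lookup idMat a) b ≡ proj₁ idEntry a b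
  idMat-lookup a b = trans (cong (λ v → V.lookup v b) (VP.lookup∘tabulate _ a)) (VP.lookup∘tabulate _ b)

  idMat-diag : ∀ a → V.lookup (V.lookup idMat a) a ≡ 1ℤ
  idMat-diag a = trans (idMat-lookup a a) (idEntry-diag a)

  idMat-off : ∀ a b → b ≢ a → V.lookup (V.lookup idMat a) b ≡ 0ℤ
  idMat-off a b b≢a = trans (idMat-lookup a b) (idEntry-off a b b≢a)

  matVec-id : ∀ y → matVec idMat y ≡ y
  matVec-id y = Lℤ.mv-id idMat y idMat-diag idMat-off

  matVecℚ-id : ∀ x → matVecℚ idMat x ≡ x
  matVecℚ-id x = Lℚ.mv-id idMat x idMat-diag idMat-off

  matVec-* : ∀ A B y → matVec (matMul A B) y ≡ matVec A (matVec B y)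
  matVec-* A B y = Lℤ.mv-* A B y

  matVecℚ-* : ∀ A B x → matVecℚ (matMul A B) x ≡ matVecℚ A (matVecℚ B x)
  matVecℚ-* A B x = Lℚ.mv-* A B x

  matMul-assoc : ∀ A B C → matMul (matMul A B) C ≡ matMul A (matMul B C)
  matMul-assoc A B C = mv-ext λ y → trans (matVec-* (matMul A B) C y) (trans (matVec-* A B (matVec C y))
    (sym (trans (matVec-* A (matMul B C) y) (cong (matVec A) (matVec-* B C y)))))

  matMul-idˡ : ∀ A → matMul idMat A ≡ A
  matMul-idˡ A = mv-ext λ y → trans (matVec-* idMat A y) (matVec-id (matVec A y))

  matMul-idʳ : ∀ A → matMul A idMat ≡ A
  matMul-idʳ A = mv-ext λ y → trans (matVec-* A idMat y) (cong (matVec A) (matVec-id y))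

  -- The functional y ↦ β(My) as a vector, so that a formula valid for all functionals can be
  -- applied underneath M.
  transposed : Mat → Vec ℤ n → Vec ℤ n
  transposed M β = V.map (dotℤ β) (V.transpose M)

  dot-transposed : ∀ M β y → dotℤ (transposed M β) y ≡ dotℤ β (matVec M y)
  dot-transposed M β y = Lℤ.dot-matMul-row β M y

  matVec-0 : ∀ M → matVec M (V.replicate n 0ℤ) ≡ V.replicate n 0ℤ
  matVec-0 M = dot-extʳ λ β → trans (sym (dot-transposed M β _)) (trans (dot-0ʳ (transposed M β)) (sym (dot-0ʳ β)))

  dot-reflMat : ∀ i β y → dotℤ β (matVec (reflMat i) y) ≡ dotℤ β y ℤ.- dotℤ β (coroot i) ℤ.* dotℤ (root i) y
  dot-reflMat i β y = trans (cong (dotℤ β) (trans (Lℤ.mv-refl idMat (coroot i) (root i) y)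
    (cong (λ z → V.zipWith (λ a k → a ℤ.- (k ℤ.* dotℤ (root i) y)) z (coroot i)) (matVec-id y))))
    (Lℤ.dot-refl β y (coroot i) (dotℤ (root i) y))

  dotℚ-reflMat : ∀ i β x → dotℚ β (matVecℚ (reflMat i) x) ≡ dotℚ β x ℚ.- toℚ (dotℤ β (coroot i)) ℚ.* dotℚ (root i) x
  dotℚ-reflMat i β x = trans (cong (dotℚ β) (trans (Lℚ.mv-refl idMat (coroot i) (root i) x)
    (cong (λ z → V.zipWith (λ y k → y ℚ.- (toℚ k ℚ.* dotℚ (root i) x)) z (coroot i)) (matVecℚ-id x))))
    (Lℚ.dot-refl β x (coroot i) (dotℚ (root i) x))

  actℤ : Elt → Vec ℤ n → Vec ℤ n
  actℤ (M , μ) y = matVec M y +ᵛ μ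

  dot-actℤ : ∀ β M μ y → dotℤ β (actℤ (M , μ) y) ≡ dotℤ β (matVec M y) ℤ.+ dotℤ β μ
  dot-actℤ β M μ y = Lℤ.dot-+ʳ β (matVec M y) μ

  dotℚ-act : ∀ β M μ x → dotℚ β (act (M , μ) x) ≡ dotℚ β (matVecℚ M x) ℚ.+ toℚ (dotℤ β μ)
  dotℚ-act β M μ x = trans (Lℚ.dot-+ʳ β (matVecℚ M x) (V.map toℚ μ)) (cong (dotℚ β (matVecℚ M x) ℚ.+_) (Lℚ.dot-ι β μ))

  +ᵛ-identityˡ : ∀ (y : Vec ℤ n) → V.replicate n 0ℤ +ᵛ y ≡ y
  +ᵛ-identityˡ = VP.zipWith-identityˡ ℤP.+-identityˡ
  +ᵛ-identityʳ : ∀ (y : Vec ℤ n) → y +ᵛ V.replicate n 0ℤ ≡ y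
  +ᵛ-identityʳ = VP.zipWith-identityʳ ℤP.+-identityʳ

  -- The value at 0 is the translation part, and cancelling it leaves the linear part. Group
  -- identities thereby reduce to identities between maps.
  Elt-ext : ∀ {u v} → (∀ y → actℤ u y ≡ actℤ v y) → u ≡ v
  Elt-ext {M , μ} {M′ , μ′} h = cong₂ _,_ (mv-ext (λ y → dot-extʳ (λ β →
      +-cancelʳ (dotℤ β μ) _ _ (trans (sym (dot-actℤ β M μ y)) (trans (cong (dotℤ β) (h y))
        (trans (dot-actℤ β M′ μ′ y) (cong (λ z → dotℤ β (matVec M′ y) ℤ.+ dotℤ β z) (sym μ≡))))))) ) μ≡
    where
    μ≡ : μ ≡ μ′
    μ≡ = trans (sym (trans (cong (_+ᵛ μ) (matVec-0 M)) (+ᵛ-identityˡ μ)))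
      (trans (h (V.replicate n 0ℤ)) (trans (cong (_+ᵛ μ′) (matVec-0 M′)) (+ᵛ-identityˡ μ′)))

  actℤ-· : ∀ u v y → actℤ (u · v) y ≡ actℤ u (actℤ v y)
  actℤ-· (M , μ) (M′ , μ′) y = begin
    matVec (matMul M M′) y +ᵛ (matVec M μ′ +ᵛ μ)  ≡⟨ cong (_+ᵛ (matVec M μ′ +ᵛ μ)) (matVec-* M M′ y) ⟩
    matVec M (matVec M′ y) +ᵛ (matVec M μ′ +ᵛ μ)  ≡⟨ VP.zipWith-assoc ℤP.+-assoc (matVec M (matVec M′ y)) _ _ ⟨
    (matVec M (matVec M′ y) +ᵛ matVec M μ′) +ᵛ μ  ≡⟨ cong (_+ᵛ μ) (Lℤ.mv-+ M (matVec M′ y) μ′) ⟨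
    matVec M (matVec M′ y +ᵛ μ′) +ᵛ μ             ∎
    where open ≡-Reasoning

  act-· : ∀ u v x → act (u · v) x ≡ act u (act v x)
  act-· (M , μ) (M′ , μ′) x = begin
    matVecℚ (matMul M M′) x ⊞ V.map toℚ (matVec M μ′ +ᵛ μ)
      ≡⟨ cong₂ _⊞_ (matVecℚ-* M M′ x) (map-toℚ-+ (matVec M μ′) μ) ⟩
    matVecℚ M (matVecℚ M′ x) ⊞ (V.map toℚ (matVec M μ′) ⊞ V.map toℚ μ)
      ≡⟨ VP.zipWith-assoc ℚP.+-assoc (matVecℚ M (matVecℚ M′ x)) _ _ ⟨
    (matVecℚ M (matVecℚ M′ x) ⊞ V.map toℚ (matVec M μ′)) ⊞ V.map toℚ μ
      ≡⟨ cong (λ z → (matVecℚ M (matVecℚ M′ x) ⊞ z) ⊞ V.map toℚ μ) (Lℚ.mv-ι M μ′) ⟨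
    (matVecℚ M (matVecℚ M′ x) ⊞ matVecℚ M (V.map toℚ μ′)) ⊞ V.map toℚ μ
      ≡⟨ cong (_⊞ V.map toℚ μ) (Lℚ.mv-+ M (matVecℚ M′ x) (V.map toℚ μ′)) ⟨
    matVecℚ M (matVecℚ M′ x ⊞ V.map toℚ μ′) ⊞ V.map toℚ μ ∎
    where
    open ≡-Reasoning
    _⊞_ : ∀ {m} → Vec ℚ m → Vec ℚ m → Vec ℚ m
    _⊞_ = V.zipWith ℚ._+_
    map-toℚ-+ : ∀ {m} (a b : Vec ℤ m) → V.map toℚ (a +ᵛ b) ≡ V.map toℚ a ⊞ V.map toℚ b
    map-toℚ-+ [] [] = refl
    map-toℚ-+ (a ∷ as) (b ∷ bs) = cong₂ _∷_ (toℚ-+ a b) (map-toℚ-+ as bs)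

  actℤ-id : ∀ y → actℤ idE y ≡ y
  actℤ-id y = trans (cong (_+ᵛ V.replicate n 0ℤ) (matVec-id y)) (+ᵛ-identityʳ y)

  act-id : ∀ x → act idE x ≡ x
  act-id x = trans (cong₂ (V.zipWith ℚ._+_) (matVecℚ-id x) (VP.map-replicate toℚ 0ℤ n))
    (VP.zipWith-identityʳ ℚP.+-identityʳ x)

  ·-assoc : ∀ u v w → (u · v) · w ≡ u · (v · w)
  ·-assoc u v w = Elt-ext λ y → trans (actℤ-· (u · v) w y) (trans (actℤ-· u v (actℤ w y))
    (sym (trans (actℤ-· u (v · w) y) (cong (actℤ u) (actℤ-· v w y)))))

  ·-idˡ : ∀ u → idE · u ≡ u
  ·-idˡ u = Elt-ext λ y → trans (actℤ-· idE u y) (actℤ-id (actℤ u y))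

  ·-idʳ : ∀ u → u · idE ≡ u
  ·-idʳ u = Elt-ext λ y → trans (actℤ-· u idE y) (cong (actℤ u) (actℤ-id y))

  dot-reflE : ∀ i k β y → dotℤ β (actℤ (reflE i k) y)
    ≡ dotℤ β y ℤ.- dotℤ β (coroot i) ℤ.* (dotℤ (root i) y ℤ.- k)
  dot-reflE i k β y = trans (dot-actℤ β (reflMat i) (scaleℤ k (coroot i)) y)
    (trans (cong₂ ℤ._+_ (dot-reflMat i β y) (Lℤ.dot-scaleʳ k β (coroot i)))
      (ring (dotℤ β y) (dotℤ β (coroot i)) (dotℤ (root i) y) k))
    where
    ring : ∀ b c a k → (b ℤ.- c ℤ.* a) ℤ.+ k ℤ.* c ≡ b ℤ.- c ℤ.* (a ℤ.- k)
    ring = solve-∀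

  reflE-involutive : ∀ i k → reflE i k · reflE i k ≡ idE
  reflE-involutive i k = Elt-ext λ y → trans (actℤ-· (reflE i k) (reflE i k) y) (trans (dot-extʳ λ β →
    trans (dot-reflE i k β _) (trans (cong₂ (λ p q → p ℤ.- dotℤ β (coroot i) ℤ.* (q ℤ.- k)) (dot-reflE i k β y) (dot-reflE i k (root i) y))
      (trans (cong (λ two → dotℤ β y ℤ.- dotℤ β (coroot i) ℤ.* (dotℤ (root i) y ℤ.- k)
           ℤ.- dotℤ β (coroot i) ℤ.* (dotℤ (root i) y ℤ.- two ℤ.* (dotℤ (root i) y ℤ.- k) ℤ.- k)) (pairing-2 i))
        (ring (dotℤ β y) (dotℤ β (coroot i)) (dotℤ (root i) y) k)))) (sym (actℤ-id y)))
    where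
    ring : ∀ b c a k → b ℤ.- c ℤ.* (a ℤ.- k) ℤ.- c ℤ.* (a ℤ.- (+ 2) ℤ.* (a ℤ.- k) ℤ.- k) ≡ b
    ring = solve-∀

  InW-id : InW idMat
  InW-id = [] , refl

  InW-reflMat : ∀ i → InW (reflMat i)
  InW-reflMat i = (i ∷ []) , sym (matMul-idʳ (reflMat i))

  wordMat : List (Fin r) → Mat
  wordMat = foldr (λ i A → matMul (reflMat i) A) idMat

  wordMat-++ : ∀ w w′ → matMul (wordMat w) (wordMat w′) ≡ wordMat (w L.++ w′)
  wordMat-++ [] w′ = matMul-idˡ (wordMat w′)
  wordMat-++ (i ∷ w) w′ = trans (matMul-assoc (reflMat i) (wordMat w) (wordMat w′)) (cong (matMul (reflMat i)) (wordMat-++ w w′))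

  InW-* : ∀ {A B} → InW A → InW B → InW (matMul A B)
  InW-* (w , refl) (w′ , refl) = w L.++ w′ , wordMat-++ w w′

  reflMat-involutive : ∀ i → matMul (reflMat i) (reflMat i) ≡ idMat
  reflMat-involutive i = cong proj₁ (reflE-involutive i 0ℤ)

  matMul-inverse : ∀ A A′ B B′ → matMul A A′ ≡ idMat → matMul B B′ ≡ idMat → matMul (matMul A B) (matMul B′ A′) ≡ idMat
  matMul-inverse A A′ B B′ AA′ BB′ = begin
    matMul (matMul A B) (matMul B′ A′)  ≡⟨ matMul-assoc A B (matMul B′ A′) ⟩
    matMul A (matMul B (matMul B′ A′))  ≡⟨ cong (matMul A) (matMul-assoc B B′ A′) ⟨
    matMul A (matMul (matMul B B′) A′)  ≡⟨ cong (λ C → matMul A (matMul C A′)) BB′ ⟩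
    matMul A (matMul idMat A′)  ≡⟨ cong (matMul A) (matMul-idˡ A′) ⟩
    matMul A A′  ≡⟨ AA′ ⟩
    idMat  ∎
    where open ≡-Reasoning

  InW-inverse : ∀ {M} → InW M → ∃[ M′ ] (InW M′ × matMul M M′ ≡ idMat × matMul M′ M ≡ idMat)
  InW-inverse (w , refl) = go w
    where
    go : ∀ w → ∃[ M′ ] (InW M′ × matMul (wordMat w) M′ ≡ idMat × matMul M′ (wordMat w) ≡ idMat)
    go [] = idMat , InW-id , matMul-idˡ idMat , matMul-idˡ idMat
    go (i ∷ w) with go w
    ... | A′ , inW , AA′ , A′A = matMul A′ (reflMat i) , InW-* inW (InW-reflMat i)
        , matMul-inverse (reflMat i) (reflMat i) (wordMat w) A′ (reflMat-involutive i) AA′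
        , matMul-inverse A′ (wordMat w) (reflMat i) (reflMat i) A′A (reflMat-involutive i)

  InWa-· : ∀ {u v} → InWa u → InWa v → InWa (u · v)
  InWa-· = InW-*

  inverse : ∀ {v} → InWa v → ∃[ v′ ] (InWa v′ × v · v′ ≡ idE × v′ · v ≡ idE)
  inverse {M , μ} inW with InW-inverse inW
  ... | M′ , inW′ , MM′ , M′M = (M′ , -ᵛ matVec M′ μ) , inW′
      , cong₂ _,_ MM′ (dot-extʳ (λ β → trans (Lℤ.dot-+ʳ β (matVec M (-ᵛ matVec M′ μ)) μ) (trans (cong (ℤ._+ dotℤ β μ)
            (trans (sym (dot-transposed M β _)) (trans (dot-neg (transposed M β) (matVec M′ μ)) (cong ℤ.-_ (trans (dot-transposed M β _)
              (cong (dotℤ β) (trans (sym (matVec-* M M′ μ)) (trans (cong (λ B → matVec B μ) MM′) (matVec-id μ)))))))))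
            (trans (ℤP.+-inverseˡ (dotℤ β μ)) (sym (dot-0ʳ β))))))
      , cong₂ _,_ M′M (VP.zipWith-inverseʳ ℤP.+-inverseʳ (matVec M′ μ))
      where
      dot-neg : ∀ {m} (β y : Vec ℤ m) → dotℤ β (-ᵛ y) ≡ ℤ.- dotℤ β y
      dot-neg [] [] = refl
      dot-neg (b ∷ β) (y ∷ ys) = trans (cong (λ z → b ℤ.* ℤ.- y ℤ.+ z) (dot-neg β ys)) (ring b y (dotℤ β ys))
        where
        ring : ∀ b y p → b ℤ.* ℤ.- y ℤ.+ ℤ.- p ≡ ℤ.- (b ℤ.* y ℤ.+ p)
        ring = solve-∀

-- Signs, and the action of W on roots and coroots

open Algebra.Properties.Group (AbelianGroup.group ℤP.+-0-abelianGroup) using () renaming (∙-cancelˡ to +-cancelˡ)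

data Sgn : Set where
  pos neg : Sgn

sg : Sgn → ℤ → ℤ
sg pos z = z
sg neg z = ℤ.- z

sgℚ : Sgn → ℚ → ℚ
sgℚ pos z = z
sgℚ neg z = ℚ.- z

_⊙_ : Sgn → Sgn → Sgn
pos ⊙ ε = ε
neg ⊙ pos = neg
neg ⊙ neg = pos

sg-⊙ : ∀ ε δ z → sg (ε ⊙ δ) z ≡ sg ε (sg δ z)
sg-⊙ pos δ z = refl
sg-⊙ neg pos z = refl
sg-⊙ neg neg z = sym (ℤP.neg-involutive z)

sgℚ-⊙ : ∀ ε δ z → sgℚ (ε ⊙ δ) z ≡ sgℚ ε (sgℚ δ z)
sgℚ-⊙ pos δ z = refl
sgℚ-⊙ neg pos z = refl
sgℚ-⊙ neg neg z = sym (neg-involutiveℚ z)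
  where
  open import Algebra.Properties.Group (AbelianGroup.group ℚP.+-0-abelianGroup) renaming (⁻¹-involutive to neg-involutiveℚ)

sg-sg : ∀ ε z → sg ε (sg ε z) ≡ z
sg-sg pos z = refl
sg-sg neg z = ℤP.neg-involutive z

sgℚ-sgℚ : ∀ ε z → sgℚ ε (sgℚ ε z) ≡ z
sgℚ-sgℚ pos z = refl
sgℚ-sgℚ neg z = sym (sgℚ-⊙ neg neg z)

sg-swap : ∀ ε a b → a ℤ.* sg ε b ≡ b ℤ.* sg ε a
sg-swap pos = ℤP.*-comm
sg-swap neg = ring
  where
  ring : ∀ a b → a ℤ.* ℤ.- b ≡ b ℤ.* ℤ.- a
  ring = solve-∀

toℚ-sg : ∀ ε z → toℚ (sg ε z) ≡ sgℚ ε (toℚ z)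
toℚ-sg pos z = refl
toℚ-sg neg z = toℚ-neg z

module Roots (D : RootDatum) where
  open Group D public

  -- The equation α_j ∘ M = ε α_i of functionals. Since M acts on X^∨, roots are pulled back along
  -- it; both the lattice version and the rational version are kept.
  record Img (M : Mat) (j : Fin r) (ε : Sgn) (i : Fin r) : Set where
    constructor img
    field
      onℤ : ∀ y → dotℤ (root j) (matVec M y) ≡ sg ε (dotℤ (root i) y)
      onℚ : ∀ x → dotℚ (root j) (matVecℚ M x) ≡ sgℚ ε (dotℚ (root i) x)
  open Img public

  root-refl : ∀ i j → ∃[ k ] Img (reflMat i) j pos k
  root-refl i j with refl-root i j
  ... | k , eq = k , img
      (λ y → trans (dot-reflMat i (root j) y) (trans (sym (trans (Lℤ.dot-−ˡ (root j) (scaleℤ (dotℤ (root j) (coroot i)) (root i)) y)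
          (cong (λ z → dotℤ (root j) y ℤ.- z) (Lℤ.dot-scaleˡ (dotℤ (root j) (coroot i)) (root i) y)))) (cong (λ β → dotℤ β y) eq)))
      (λ x → trans (dotℚ-reflMat i (root j) x) (trans (sym (trans (Lℚ.dot-−ˡ (root j) (scaleℤ (dotℤ (root j) (coroot i)) (root i)) x)
          (cong (λ z → dotℚ (root j) x ℚ.- z) (Lℚ.dot-scaleˡ (dotℤ (root j) (coroot i)) (root i) x)))) (cong (λ β → dotℚ β x) eq)))

  img-id : ∀ j → Img idMat j pos j
  img-id j = img (λ y → cong (dotℤ (root j)) (matVec-id y)) (λ x → cong (dotℚ (root j)) (matVecℚ-id x))

  img-* : ∀ {A B j ε i δ k} → Img A j ε i → Img B i δ k → Img (matMul A B) j (ε ⊙ δ) k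
  img-* {A} {B} {j} {ε} {i} {δ} {k} (img p p′) (img q q′) = img
    (λ y → trans (cong (dotℤ (root j)) (matVec-* A B y)) (trans (p (matVec B y)) (trans (cong (sg ε) (q y)) (sym (sg-⊙ ε δ _)))))
    (λ x → trans (cong (dotℚ (root j)) (matVecℚ-* A B x)) (trans (p′ (matVecℚ B x)) (trans (cong (sgℚ ε) (q′ x)) (sym (sgℚ-⊙ ε δ _)))))

  root-image : ∀ {M} → InW M → ∀ j → ∃[ k ] Img M j pos k
  root-image (w , refl) = go w
    where
    go : ∀ w j → ∃[ k ] Img (wordMat w) j pos k
    go [] j = j , img-id j
    go (i ∷ w) j with root-refl i j
    ... | k , p with go w k
    ... | l , q = l , img-* p q

  -- A root is sent to its negative by its own reflection: α - ⟨α,α^∨⟩α = -α.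
  root-neg : ∀ i → ∃[ k ] Img idMat i neg k
  root-neg i with refl-root i i
  ... | k , eq = k , img
      (λ y → trans (cong (dotℤ (root i)) (matVec-id y)) (trans (ring (dotℤ (root i) y)) (cong ℤ.-_ (trans (sym (trans (Lℤ.dot-−ˡ (root i) (scaleℤ (dotℤ (root i) (coroot i)) (root i)) y)
          (cong (λ z → dotℤ (root i) y ℤ.- z) (trans (Lℤ.dot-scaleˡ (dotℤ (root i) (coroot i)) (root i) y) (cong (ℤ._* dotℤ (root i) y) (pairing-2 i))))))
          (cong (λ β → dotℤ β y) eq)))))
      (λ x → trans (cong (dotℚ (root i)) (matVecℚ-id x)) (trans (ringℚ (dotℚ (root i) x)) (cong ℚ.-_ (trans (sym (trans (Lℚ.dot-−ˡ (root i) (scaleℤ (dotℤ (root i) (coroot i)) (root i)) x)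
          (cong (λ z → dotℚ (root i) x ℚ.- z) (trans (Lℚ.dot-scaleˡ (dotℤ (root i) (coroot i)) (root i) x) (cong (λ t → toℚ t ℚ.* dotℚ (root i) x) (pairing-2 i))))))
          (cong (λ β → dotℚ β x) eq)))))
      where
      ring : ∀ a → a ≡ ℤ.- (a ℤ.- (+ 2) ℤ.* a)
      ring = solve-∀
      open ℚSolver
      ringℚ : ∀ a → a ≡ ℚ.- (a ℚ.- toℚ (+ 2) ℚ.* a)
      ringℚ = solve 1 (λ a → a := :- (a :- con (toℚ (+ 2)) :* a)) refl

  positive? : ∀ i → Dec (Positive i)
  positive? i = 0ℤ ℤP.<? dotℤ (root i) ρ

  not-positive : ∀ {i} → ¬ Positive i → dotℤ (root i) ρ ℤ.< 0ℤ
  not-positive {i} ¬p with ℤP.<-cmp (dotℤ (root i) ρ) 0ℤ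
  ... | tri< a _ _ = a
  ... | tri≈ _ b _ = ⊥-elim (regular i b)
  ... | tri> _ _ c = ⊥-elim (¬p c)

  root-neg-positive : ∀ {k l} → ¬ Positive k → Img idMat k neg l → Positive l
  root-neg-positive {k} {l} ¬k q = subst (0ℤ ℤ.<_)
    (trans (cong ℤ.-_ (trans (cong (dotℤ (root k)) (sym (matVec-id ρ))) (onℤ q ρ))) (ℤP.neg-involutive (dotℤ (root l) ρ)))
    (ℤP.neg-mono-< (not-positive ¬k))

  img-neg : ∀ {M j k l} → Img M j pos k → Img idMat k neg l → Img M j neg l
  img-neg {M} {j} {k} {l} p q = subst (λ A → Img A j neg l) (matMul-idʳ M) (img-* {M} {idMat} {j} {pos} {k} {neg} {l} p q)

  -- Of the root α_j ∘ M and its negative one is positive; the sign remembers which was taken.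
  -- Hyperplanes are indexed by positive roots, so this is the action on their directions.
  signed-image : ∀ {M} → InW M → ∀ j → ∃[ ε ] ∃[ i ] (Positive i × Img M j ε i)
  signed-image {M} inW j with root-image inW j
  ... | k , p with positive? k
  ... | yes k>0 = pos , k , k>0 , p
  ... | no ¬k = neg , proj₁ (root-neg k) , root-neg-positive ¬k (proj₂ (root-neg k)) , img-neg {M} p (proj₂ (root-neg k))

  img-inverse : ∀ {M M′ j ε i} → matMul M M′ ≡ idMat → Img M j ε i → Img M′ i ε j
  img-inverse {M} {M′} {j} {ε} {i} MM′ (img p p′) = img
    (λ y → trans (sym (sg-sg ε _)) (cong (sg ε) (trans (sym (p (matVec M′ y))) (cong (dotℤ (root j))
       (trans (sym (matVec-* M M′ y)) (trans (cong (λ B → matVec B y) MM′) (matVec-id y)))))))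
    (λ y → trans (sym (sgℚ-sgℚ ε _)) (cong (sgℚ ε) (trans (sym (p′ (matVecℚ M′ y))) (cong (dotℚ (root j))
       (trans (sym (matVecℚ-* M M′ y)) (trans (cong (λ B → matVecℚ B y) MM′) (matVecℚ-id y)))))))

  -- Opposite roots cannot both be positive on ρ, which rules out ε = `neg`.
  positive-unique : ∀ {i j ε} → Positive i → Positive j → (∀ y → dotℤ (root i) y ≡ sg ε (dotℤ (root j) y)) → i ≡ j
  positive-unique {i} {j} {pos} pi pj h = root-inj i j (dot-ext h)
  positive-unique {i} {j} {neg} pi pj h = ⊥-elim (ℤP.<-asym pi (subst (ℤ._< 0ℤ) (sym (h ρ)) (ℤP.neg-mono-< pj)))

  coroot-image : ∀ {M} → InW M → ∀ i → ∃[ k ] (matVec M (coroot i) ≡ coroot k)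
  coroot-image (w , refl) = go w
    where
    go : ∀ w i → ∃[ k ] (matVec (wordMat w) (coroot i) ≡ coroot k)
    go [] i = i , matVec-id (coroot i)
    go (j ∷ w) i with go w i
    ... | k , p with refl-coroot j k
    ... | l , q = l , trans (matVec-* (reflMat j) (wordMat w) (coroot i)) (trans (cong (matVec (reflMat j)) p) (trans (dot-extʳ λ β →
          trans (dot-reflMat j β (coroot k)) (sym (trans (dot-−ʳ β (coroot k) _) (cong (λ z → dotℤ β (coroot k) ℤ.- z)
             (trans (Lℤ.dot-scaleʳ (dotℤ (root j) (coroot k)) β (coroot j)) (ℤP.*-comm (dotℤ (root j) (coroot k)) _)))))) q))
      where
      dot-−ʳ : ∀ {m} (β x y : Vec ℤ m) → dotℤ β (x -ᵛ y) ≡ dotℤ β x ℤ.- dotℤ β y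
      dot-−ʳ β x y = trans (dot-comm β (x -ᵛ y)) (trans (Lℤ.dot-−ˡ x y β) (cong₂ ℤ._-_ (dot-comm x β) (dot-comm y β)))

  -- If M α_i^∨ ≠ ±α_j^∨, then s_j · M s_i M⁻¹ is a transvection of infinite order permuting the finitely many coroots.
  coroot-compat : ∀ {M} → InW M → ∀ {j ε i} → Img M j ε i → ∀ β → dotℤ β (matVec M (coroot i)) ≡ sg ε (dotℤ β (coroot j))
  coroot-compat {M} inW {j} {ε} {i} im β with InW-inverse inW
  ... | M′ , inW′ , MM′ , M′M = conclude
    where
    -- e is pairing with δ = α_j^∨ - ε M α_i^∨. It vanishes on α_j, and the goal is δ = 0.
    e : Vec ℤ n → ℤ
    e β = dotℤ β (coroot j) ℤ.- sg ε (dotℤ β (matVec M (coroot i)))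

    N : Mat
    N = matMul (reflMat j) (matMul M (matMul (reflMat i) M′))

    inN : InW N
    inN = InW-* (InW-reflMat j) (InW-* inW (InW-* (InW-reflMat i) inW′))

    e-root : e (root j) ≡ 0ℤ
    e-root = cong₂ ℤ._-_ (pairing-2 j) (trans (cong (sg ε) (onℤ im (coroot i))) (trans (sg-sg ε _) (pairing-2 i)))

    dot-M-refl : ∀ β z → dotℤ β (matVec (matMul M (matMul (reflMat i) M′)) z)
      ≡ dotℤ β z ℤ.- dotℤ (root j) z ℤ.* sg ε (dotℤ β (matVec M (coroot i)))
    dot-M-refl β z = begin
      dotℤ β (matVec (matMul M (matMul (reflMat i) M′)) z)
        ≡⟨ cong (dotℤ β) (trans (matVec-* M _ z) (cong (matVec M) (matVec-* (reflMat i) M′ z))) ⟩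
      dotℤ β (matVec M (matVec (reflMat i) (matVec M′ z)))
        ≡⟨ dot-transposed M β _ ⟨
      dotℤ γ (matVec (reflMat i) (matVec M′ z))
        ≡⟨ dot-reflMat i γ (matVec M′ z) ⟩
      dotℤ γ (matVec M′ z) ℤ.- dotℤ γ (coroot i) ℤ.* dotℤ (root i) (matVec M′ z)
        ≡⟨ cong₂ ℤ._-_ (trans (dot-transposed M β _) (cong (dotℤ β) (trans (sym (matVec-* M M′ z)) (trans (cong (λ B → matVec B z) MM′) (matVec-id z)))))
             (cong₂ ℤ._*_ (dot-transposed M β (coroot i)) (onℤ (img-inverse MM′ im) z)) ⟩
      dotℤ β z ℤ.- c ℤ.* sg ε (dotℤ (root j) z)
        ≡⟨ cong (λ w → dotℤ β z ℤ.- w) (sg-swap ε c (dotℤ (root j) z)) ⟩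
      dotℤ β z ℤ.- dotℤ (root j) z ℤ.* sg ε c ∎
      where
      open ≡-Reasoning
      γ = transposed M β
      c = dotℤ β (matVec M (coroot i))

    dot-N : ∀ β z → dotℤ β (matVec N z) ≡ dotℤ β z ℤ.+ dotℤ (root j) z ℤ.* e β
    dot-N β z = begin
      dotℤ β (matVec N z)
        ≡⟨ cong (dotℤ β) (matVec-* (reflMat j) K z) ⟩
      dotℤ β (matVec (reflMat j) (matVec K z))
        ≡⟨ dot-reflMat j β (matVec K z) ⟩
      dotℤ β (matVec K z) ℤ.- dotℤ β (coroot j) ℤ.* dotℤ (root j) (matVec K z)
        ≡⟨ cong₂ (λ p q → p ℤ.- dotℤ β (coroot j) ℤ.* q) (dot-M-refl β z) (trans (dot-M-refl (root j) z)
             (cong (λ q → dotℤ (root j) z ℤ.- dotℤ (root j) z ℤ.* q) (trans (cong (sg ε) (onℤ im (coroot i))) (trans (sg-sg ε _) (pairing-2 i))))) ⟩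
      (dotℤ β z ℤ.- dotℤ (root j) z ℤ.* c) ℤ.- dotℤ β (coroot j) ℤ.* (dotℤ (root j) z ℤ.- dotℤ (root j) z ℤ.* (+ 2))
        ≡⟨ ring (dotℤ β z) (dotℤ (root j) z) c (dotℤ β (coroot j)) ⟩
      dotℤ β z ℤ.+ dotℤ (root j) z ℤ.* (dotℤ β (coroot j) ℤ.- c) ∎
      where
      open ≡-Reasoning
      K = matMul M (matMul (reflMat i) M′)
      c = sg ε (dotℤ β (matVec M (coroot i)))
      ring : ∀ b a c d → (b ℤ.- a ℤ.* c) ℤ.- d ℤ.* (a ℤ.- a ℤ.* (+ 2)) ≡ b ℤ.+ a ℤ.* (d ℤ.- c)
      ring = solve-∀

    -- N is z ↦ z + ⟨α_j,z⟩δ, and ⟨α_j,δ⟩ = 0 keeps the pairing with α_j equal to 2, so each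
    -- application of N adds 2δ.
    orbit : ∀ k → ∃[ l ] (∀ β → dotℤ β (coroot l) ≡ dotℤ β (coroot j) ℤ.+ (+ (k ℕ.* 2)) ℤ.* e β)
    orbit zero = j , λ β → sym (ℤP.+-identityʳ _)
    orbit (suc k) with orbit k
    ... | l , h with coroot-image inN l
    ... | l′ , q = l′ , λ β → begin
      dotℤ β (coroot l′)            ≡⟨ cong (dotℤ β) q ⟨
      dotℤ β (matVec N (coroot l))  ≡⟨ dot-N β (coroot l) ⟩
      dotℤ β (coroot l) ℤ.+ dotℤ (root j) (coroot l) ℤ.* e β
        ≡⟨ cong₂ (λ p q → p ℤ.+ q ℤ.* e β) (h β) (trans (h (root j)) (cong₂ (λ p q → p ℤ.+ (+ (k ℕ.* 2)) ℤ.* q) (pairing-2 j) e-root)) ⟩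
      (dotℤ β (coroot j) ℤ.+ (+ (k ℕ.* 2)) ℤ.* e β) ℤ.+ ((+ 2) ℤ.+ (+ (k ℕ.* 2)) ℤ.* 0ℤ) ℤ.* e β
        ≡⟨ ring (dotℤ β (coroot j)) (+ (k ℕ.* 2)) (e β) ⟩
      dotℤ β (coroot j) ℤ.+ ((+ 2) ℤ.+ (+ (k ℕ.* 2))) ℤ.* e β ∎
      where
      open ≡-Reasoning
      ring : ∀ b k e → (b ℤ.+ k ℤ.* e) ℤ.+ ((+ 2) ℤ.+ k ℤ.* 0ℤ) ℤ.* e ≡ b ℤ.+ ((+ 2) ℤ.+ k) ℤ.* e
      ring = solve-∀

    -- Among the r + 1 coroots α_j^∨ + 2kδ with 0 ≤ k ≤ r two coincide, and their difference is a
    -- nonzero multiple of δ.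
    e-zero : e β ≡ 0ℤ
    e-zero with FinP.pigeonhole {r} {suc r} ℕP.≤-refl (λ k → proj₁ (orbit (Fin.toℕ k)))
    ... | a , b , a<b , eq = case ℤP.i*j≡0⇒i≡0∨j≡0 d prod of λ where
        (inj₁ d≡0) → ⊥-elim (ℕP.<⇒≢ a<b (ℕP.*-cancelʳ-≡ _ _ 2 (ℤP.+-injective (ℤP.i-j≡0⇒i≡j _ _ d≡0))))
        (inj₂ e≡0) → e≡0
      where
      pa = + (Fin.toℕ a ℕ.* 2)
      pb = + (Fin.toℕ b ℕ.* 2)
      d = pa ℤ.- pb
      same : pa ℤ.* e β ≡ pb ℤ.* e β
      same = +-cancelˡ (dotℤ β (coroot j)) _ _ (trans (sym (proj₂ (orbit (Fin.toℕ a)) β)) (trans (cong (λ l → dotℤ β (coroot l)) eq) (proj₂ (orbit (Fin.toℕ b)) β)))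
      ring : ∀ a b e → (a ℤ.- b) ℤ.* e ≡ a ℤ.* e ℤ.- b ℤ.* e
      ring = solve-∀
      prod : d ℤ.* e β ≡ 0ℤ
      prod = trans (ring pa pb (e β)) (trans (cong (ℤ._- pb ℤ.* e β) same) (ℤP.+-inverseʳ (pb ℤ.* e β)))

    conclude : dotℤ β (matVec M (coroot i)) ≡ sg ε (dotℤ β (coroot j))
    conclude = trans (sym (sg-sg ε _)) (cong (sg ε) (sym (ℤP.i-j≡0⇒i≡j _ _ e-zero)))

  -- From α_j(ux) = ε α_i(x) + ⟨α_j,μ⟩ the map u carries H_{α_i,k} to H_{α_j,m} with m = ⟨α_j,μ⟩ +
  -- εk. That the conjugate reflection also moves points along α_j^∨ is `coroot-compat`.
  reflE-conj : ∀ {u} → InWa u → ∀ {j ε i} → Img (proj₁ u) j ε i → ∀ k →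
    u · reflE i k ≡ reflE j (dotℤ (root j) (proj₂ u) ℤ.+ sg ε k) · u
  reflE-conj {M , μ} inW {j} {ε} {i} im k = Elt-ext λ y → dot-extʳ λ β → begin
    dotℤ β (actℤ (u · s) y)                    ≡⟨ cong (dotℤ β) (actℤ-· u s y) ⟩
    dotℤ β (actℤ u (actℤ s y))                 ≡⟨ dot-actℤ β M μ (actℤ s y) ⟩
    dotℤ β (matVec M (actℤ s y)) ℤ.+ dotℤ β μ  ≡⟨ cong (ℤ._+ dotℤ β μ) (trans (sym (dot-transposed M β _)) (dot-reflE i k (transposed M β) y)) ⟩
    (dotℤ (transposed M β) y ℤ.- dotℤ (transposed M β) (coroot i) ℤ.* (dotℤ (root i) y ℤ.- k)) ℤ.+ dotℤ β μ
      ≡⟨ cong₂ (λ p q → (p ℤ.- q ℤ.* (dotℤ (root i) y ℤ.- k)) ℤ.+ dotℤ β μ) (dot-transposed M β y)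
           (trans (dot-transposed M β (coroot i)) (coroot-compat inW im β)) ⟩
    (dotℤ β (matVec M y) ℤ.- sg ε (dotℤ β (coroot j)) ℤ.* (dotℤ (root i) y ℤ.- k)) ℤ.+ dotℤ β μ
      ≡⟨ ring ε (dotℤ β (matVec M y)) (dotℤ β (coroot j)) (dotℤ (root i) y) k (dotℤ β μ) (dotℤ (root j) μ) ⟩
    (dotℤ β (matVec M y) ℤ.+ dotℤ β μ) ℤ.- dotℤ β (coroot j) ℤ.* ((sg ε (dotℤ (root i) y) ℤ.+ dotℤ (root j) μ) ℤ.- m)
      ≡⟨ cong₂ (λ p q → p ℤ.- dotℤ β (coroot j) ℤ.* (q ℤ.- m)) (dot-actℤ β M μ y)
            (trans (dot-actℤ (root j) M μ y) (cong (ℤ._+ dotℤ (root j) μ) (onℤ im y))) ⟨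
    dotℤ β (actℤ u y) ℤ.- dotℤ β (coroot j) ℤ.* (dotℤ (root j) (actℤ u y) ℤ.- m)
      ≡⟨ dot-reflE j m β (actℤ u y) ⟨
    dotℤ β (actℤ (reflE j m) (actℤ u y))  ≡⟨ cong (dotℤ β) (actℤ-· (reflE j m) u y) ⟨
    dotℤ β (actℤ (reflE j m · u) y)       ∎
    where
    open ≡-Reasoning
    u = M , μ
    s = reflE i k
    m = dotℤ (root j) μ ℤ.+ sg ε k
    ring : ∀ ε b c a k d t → (b ℤ.- sg ε c ℤ.* (a ℤ.- k)) ℤ.+ d ≡ (b ℤ.+ d) ℤ.- c ℤ.* ((sg ε a ℤ.+ t) ℤ.- (t ℤ.+ sg ε k))
    ring pos = ring-pos
      where
      ring-pos : ∀ b c a k d t → (b ℤ.- c ℤ.* (a ℤ.- k)) ℤ.+ d ≡ (b ℤ.+ d) ℤ.- c ℤ.* ((a ℤ.+ t) ℤ.- (t ℤ.+ k))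
      ring-pos = solve-∀
    ring neg = ring-neg
      where
      ring-neg : ∀ b c a k d t → (b ℤ.- (ℤ.- c) ℤ.* (a ℤ.- k)) ℤ.+ d ≡ (b ℤ.+ d) ℤ.- c ℤ.* ((ℤ.- a ℤ.+ t) ℤ.- (t ℤ.+ ℤ.- k))
      ring-neg = solve-∀

-- Rational points, strips of alcoves, and the crossing of one wall

recip : ℕ → ℚ
recip d = 1ℤ ℚ./ suc d

recip≃ : ∀ d → ℚ.toℚᵘ (recip d) ℚᵘ.≃ ℚᵘ.mkℚᵘ 1ℤ d
recip≃ d = ℚP.toℚᵘ-fromℚᵘ (ℚᵘ.mkℚᵘ 1ℤ d)

recip-* : ∀ d → recip d ℚ.* toℚ (+ suc d) ≡ ℚ.1ℚ
recip-* d = ℚP.toℚᵘ-injective (ℚᵘP.≃-trans (ℚP.toℚᵘ-homo-* (recip d) (toℚ (+ suc d)))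
  (ℚᵘP.≃-trans (ℚᵘP.*-cong (recip≃ d) (toℚ≃ (+ suc d))) (ℚᵘ.*≡* (ring (+ suc d)))))
  where
  ring : ∀ D → (1ℤ ℤ.* D) ℤ.* 1ℤ ≡ 1ℤ ℤ.* (D ℤ.* 1ℤ)
  ring = solve-∀

recip-nonNeg : ∀ d → ℚ.NonNegative (recip d)
recip-nonNeg d = ℚP.normalize-nonNeg 1 (suc d)

-- The point X/(d + 1); the successor keeps the denominator nonzero without a side condition.
fracVec : ∀ {n} → ℕ → Vec ℤ n → Vec ℚ n
fracVec d X = V.map (recip d ℚ.*_) (V.map toℚ X)

dotℚ-fracVec : ∀ {n} d (β X : Vec ℤ n) → dotℚ β (fracVec d X) ≡ recip d ℚ.* toℚ (dotℤ β X)
dotℚ-fracVec d β X = trans (Lℚ.dot-scaleʳ (recip d) β (V.map toℚ X)) (cong (recip d ℚ.*_) (Lℚ.dot-ι β X))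

recip-mono : ∀ d {a b} → a ℤ.≤ b → recip d ℚ.* toℚ a ℚ.≤ recip d ℚ.* toℚ b
recip-mono d a≤b = ℚP.*-monoˡ-≤-nonNeg (recip d) {{recip-nonNeg d}} (toℚ-mono-≤ a≤b)

recip-≡ : ∀ d {a m} → recip d ℚ.* toℚ a ≡ toℚ m → a ≡ m ℤ.* (+ suc d)
recip-≡ d {a} {m} eq = toℚ-injective (begin
  toℚ a  ≡⟨ ℚP.*-identityˡ _ ⟨
  ℚ.1ℚ ℚ.* toℚ a  ≡⟨ cong (ℚ._* toℚ a) (recip-* d) ⟨
  (recip d ℚ.* toℚ (+ suc d)) ℚ.* toℚ a  ≡⟨ ring (recip d) (toℚ (+ suc d)) (toℚ a) ⟩
  (recip d ℚ.* toℚ a) ℚ.* toℚ (+ suc d)  ≡⟨ cong (ℚ._* toℚ (+ suc d)) eq ⟩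
  toℚ m ℚ.* toℚ (+ suc d)  ≡⟨ toℚ-* m (+ suc d) ⟨
  toℚ (m ℤ.* (+ suc d))  ∎)
  where
  open ≡-Reasoning
  open ℚSolver
  ring : ∀ h D a → (h ℚ.* D) ℚ.* a ≡ (h ℚ.* a) ℚ.* D
  ring = solve 3 (λ h D a → (h :* D) :* a := (h :* a) :* D) refl

recip-≡⁻ : ∀ d {a} m → a ≡ m ℤ.* (+ suc d) → recip d ℚ.* toℚ a ≡ toℚ m
recip-≡⁻ d m refl = trans (cong (recip d ℚ.*_) (toℚ-* m (+ suc d))) (trans (ring (recip d) (toℚ m) (toℚ (+ suc d)))
  (trans (cong (ℚ._* toℚ m) (recip-* d)) (ℚP.*-identityˡ (toℚ m))))
  where
  open ℚSolver
  ring : ∀ h m D → h ℚ.* (m ℚ.* D) ≡ (h ℚ.* D) ℚ.* m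
  ring = solve 3 (λ h m D → h :* (m :* D) := (h :* D) :* m) refl

double-injective : ∀ {a b} → toℚ (+ 2) ℚ.* a ≡ toℚ (+ 2) ℚ.* b → a ≡ b
double-injective {a} {b} eq = trans (half a) (trans (cong (ℚ.½ ℚ.*_) eq) (sym (half b)))
  where
  open ℚSolver
  half : ∀ a → a ≡ ℚ.½ ℚ.* (toℚ (+ 2) ℚ.* a)
  half = solve 1 (λ a → a := con ℚ.½ :* (con (toℚ (+ 2)) :* a)) refl

-- Two different closed unit strips share at most an integer: if c < c′ then y ≤ c + 1 ≤ c′ ≤ y.
strip-unique : ∀ {y c c′} → toℚ c ℚ.≤ y → y ℚ.≤ toℚ (c ℤ.+ 1ℤ) → toℚ c′ ℚ.≤ y → y ℚ.≤ toℚ (c′ ℤ.+ 1ℤ) →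
  (∀ z → y ≢ toℚ z) → c ≡ c′
strip-unique {y} {c} {c′} l u l′ u′ nonint with ℤP.<-cmp c c′
... | tri≈ _ eq _ = eq
... | tri< c<c′ _ _ = ⊥-elim (nonint c′ (ℚP.≤-antisym (ℚP.≤-trans u (toℚ-mono-≤ (subst (ℤ._≤ c′) (ℤP.+-comm 1ℤ c) (ℤP.i<j⇒suc[i]≤j c<c′)))) l′))
... | tri> _ _ c′<c = ⊥-elim (nonint c (ℚP.≤-antisym (ℚP.≤-trans u′ (toℚ-mono-≤ (subst (ℤ._≤ c) (ℤP.+-comm 1ℤ c′) (ℤP.i<j⇒suc[i]≤j c′<c)))) l))

0≤k≤1 : ∀ {k} → 0ℤ ℤ.≤ k → k ℤ.≤ 1ℤ → k ≡ 0ℤ ⊎ k ≡ 1ℤ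
0≤k≤1 {+ 0} _ _ = inj₁ refl
0≤k≤1 {+ 1} _ _ = inj₂ refl
0≤k≤1 {+ suc (suc k)} _ (ℤ.+≤+ (ℕ.s≤s ()))

maxFin : ∀ {m} → (Fin m → ℕ) → ℕ
maxFin {zero} g = 0
maxFin {suc m} g = g zero ℕ.⊔ maxFin (g ∘ suc)

≤-maxFin : ∀ {m} (g : Fin m → ℕ) i → g i ℕ.≤ maxFin g
≤-maxFin g zero = ℕP.m≤m⊔n _ _
≤-maxFin g (suc i) = ℕP.≤-trans (≤-maxFin (g ∘ suc) i) (ℕP.m≤n⊔m (g zero) _)

module Crossing (D : RootDatum) where
  open Roots D public

  -- The floor of ε α_i on the interior of A_f for a positive root α_i, whose values there lie in
  -- (0,1).
  off : Sgn → ℤ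
  off pos = 0ℤ
  off neg = ℤ.- 1ℤ

  -- The same floor read off from the sign at ρ. The value at 0 is a mere convention: arguments are
  -- pairings of roots with Mρ, which are nonzero by regularity.
  floorSgn : ℤ → ℤ
  floorSgn (+ zero)  = ℤ.- 1ℤ
  floorSgn (+ suc _) = 0ℤ
  floorSgn -[1+ _ ]  = ℤ.- 1ℤ

  floorSgn-sg : ∀ ε {z} → 0ℤ ℤ.< z → floorSgn (sg ε z) ≡ off ε
  floorSgn-sg pos {+ suc z} _ = refl
  floorSgn-sg neg {+ suc z} _ = refl
  floorSgn-sg ε {+ 0} (ℤ.+<+ ())

  -- u A_f lies in the strip fl j u ≤ ⟨α_j, x⟩ ≤ fl j u + 1.
  fl : Fin r → Elt → ℤ
  fl j (M , μ) = dotℤ (root j) μ ℤ.+ floorSgn (dotℤ (root j) (matVec M ρ))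

  fl-img : ∀ {M j ε i} μ → Img M j ε i → Positive i → fl j (M , μ) ≡ dotℤ (root j) μ ℤ.+ off ε
  fl-img {j = j} {ε} μ im i>0 = cong (λ z → dotℤ (root j) μ ℤ.+ z) (trans (cong floorSgn (onℤ im ρ)) (floorSgn-sg ε i>0))

  dotℚ-act-img : ∀ {M j ε i} μ → Img M j ε i → ∀ x →
    dotℚ (root j) (act (M , μ) x) ≡ sgℚ ε (dotℚ (root i) x) ℚ.+ toℚ (dotℤ (root j) μ)
  dotℚ-act-img {M} {j} μ im x = trans (dotℚ-act (root j) M μ x) (cong (ℚ._+ toℚ (dotℤ (root j) μ)) (onℚ im x))

  fl-strip : ∀ {u} → InWa u → ∀ j {x} → InAf x →
    toℚ (fl j u) ℚ.≤ dotℚ (root j) (act u x) × dotℚ (root j) (act u x) ℚ.≤ toℚ (fl j u ℤ.+ 1ℤ)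
  fl-strip {M , μ} inW j {x} xA with signed-image inW j
  ... | ε , i , i>0 , im rewrite fl-img μ im i>0 | dotℚ-act-img μ im x = bounds ε (xA i i>0)
    where
    t = dotℤ (root j) μ
    bounds : ∀ ε {a} → (ℚ.0ℚ ℚ.≤ a) × (a ℚ.≤ ℚ.1ℚ) →
      toℚ (t ℤ.+ off ε) ℚ.≤ sgℚ ε a ℚ.+ toℚ t × sgℚ ε a ℚ.+ toℚ t ℚ.≤ toℚ (t ℤ.+ off ε ℤ.+ 1ℤ)
    bounds pos {a} (l , u) =
      subst (ℚ._≤ a ℚ.+ toℚ t) (trans (sym (toℚ-+ 0ℤ t)) (cong toℚ (ℤP.+-comm 0ℤ t))) (ℚP.+-monoˡ-≤ (toℚ t) l) ,
      subst (a ℚ.+ toℚ t ℚ.≤_) (trans (sym (toℚ-+ 1ℤ t)) (cong toℚ (ring t))) (ℚP.+-monoˡ-≤ (toℚ t) u)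
      where
      ring : ∀ t → 1ℤ ℤ.+ t ≡ t ℤ.+ 0ℤ ℤ.+ 1ℤ
      ring = solve-∀
    bounds neg {a} (l , u) =
      subst (ℚ._≤ ℚ.- a ℚ.+ toℚ t) (trans (sym (toℚ-+ (ℤ.- 1ℤ) t)) (cong toℚ (ℤP.+-comm (ℤ.- 1ℤ) t))) (ℚP.+-monoˡ-≤ (toℚ t) (ℚP.neg-antimono-≤ u)) ,
      subst (ℚ.- a ℚ.+ toℚ t ℚ.≤_) (trans (sym (toℚ-+ 0ℤ t)) (cong toℚ (ring t))) (ℚP.+-monoˡ-≤ (toℚ t) (ℚP.neg-antimono-≤ l))
      where
      ring : ∀ t → 0ℤ ℤ.+ t ≡ t ℤ.+ ℤ.- 1ℤ ℤ.+ 1ℤ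
      ring = solve-∀

  -- A common non-integral value of α_j on the two alcoves determines the strip of each.
  fl-≡ : ∀ {u u′} → InWa u → InWa u′ → ∀ j {x x′} → InAf x → InAf x′ →
    dotℚ (root j) (act u x) ≡ dotℚ (root j) (act u′ x′) → (∀ z → dotℚ (root j) (act u x) ≢ toℚ z) → fl j u ≡ fl j u′
  fl-≡ {u} {u′} inu inu′ j {x} {x′} xA x′A eq nonint with fl-strip inu j xA | fl-strip inu′ j x′A
  ... | l , h | l′ , h′ = strip-unique {dotℚ (root j) (act u x)} {fl j u} {fl j u′} l h
    (subst (toℚ (fl j u′) ℚ.≤_) (sym eq) l′) (subst (ℚ._≤ toℚ (fl j u′ ℤ.+ 1ℤ)) (sym eq) h′) nonint

  -- Dividing ρ by one more than the largest |⟨α_i,ρ⟩| brings all positive roots into the open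
  -- interval (0,1), so `base` is an interior point of A_f.
  scale : ℕ
  scale = maxFin (λ i → ℤ.∣ dotℤ (root i) ρ ∣)

  base : Vec ℚ n
  base = fracVec scale ρ

  root-ρ-< : ∀ i → Positive i → dotℤ (root i) ρ ℤ.< + suc scale
  root-ρ-< i i>0 with dotℤ (root i) ρ | ≤-maxFin (λ i → ℤ.∣ dotℤ (root i) ρ ∣) i
  ... | + p | le = ℤ.+<+ (ℕ.s≤s le)
  ... | -[1+ p ] | le = ℤ.-<+

  base-InAf : InAf base
  base-InAf i i>0 = subst (ℚ.0ℚ ℚ.≤_) (sym (dotℚ-fracVec scale (root i) ρ))
      (subst (ℚ._≤ recip scale ℚ.* toℚ (dotℤ (root i) ρ)) (ℚP.*-zeroʳ (recip scale)) (recip-mono scale (ℤP.<⇒≤ i>0)))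
    , subst (ℚ._≤ ℚ.1ℚ) (sym (dotℚ-fracVec scale (root i) ρ))
      (subst (recip scale ℚ.* toℚ (dotℤ (root i) ρ) ℚ.≤_) (recip-* scale) (recip-mono scale (ℤP.<⇒≤ (root-ρ-< i i>0))))

  no-multiple : ∀ {p d} z → 0ℤ ℤ.< p → p ℤ.< + suc d → p ≢ z ℤ.* (+ suc d)
  no-multiple {p} {d} (+ zero) 0<p _ refl = ℤP.<-irrefl refl 0<p
  no-multiple {p} {d} (+ suc z) _ p<D refl = ℤP.<⇒≱ p<D (ℤ.+≤+ (ℕP.m≤m+n (suc d) _))
  no-multiple {d = d} -[1+ z ] (ℤ.+<+ _) _ ()

  base-nonint : ∀ i → Positive i → ∀ z → dotℚ (root i) base ≢ toℚ z
  base-nonint i i>0 z eq = no-multiple z i>0 (root-ρ-< i i>0) (recip-≡ scale {dotℤ (root i) ρ} {z} (trans (sym (dotℚ-fracVec scale (root i) ρ)) eq))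

  -- The point x lies on H_{α_i,k} and on no other hyperplane, hence in the relative interior of the
  -- face. It is the probe by which uA_f and usA_f are compared.
  record Wall (s : Elt) (i : Fin r) (k : ℤ) : Set where
    field
      i>0      : Positive i
      x        : Vec ℚ n
      x-InAf   : InAf x
      x-on     : dotℚ (root i) x ≡ toℚ k
      x-only   : ∀ j m → Positive j → dotℚ (root j) x ≡ toℚ m → (j ≡ i × m ≡ k)
      s≡       : s ≡ reflE i k
    k-01 : k ≡ 0ℤ ⊎ k ≡ 1ℤ
    k-01 = 0≤k≤1 (toℚ-cancel-≤ (subst (ℚ.0ℚ ℚ.≤_) x-on (proj₁ (x-InAf i i>0)))) (toℚ-cancel-≤ (subst (ℚ._≤ ℚ.1ℚ) x-on (proj₂ (x-InAf i i>0))))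

  wall : ∀ {s} → IsS s → ∃[ i ] ∃[ k ] Wall s i k
  wall (i , k , i>0 , (x , xA , on , only) , s≡) = i , k , record { i>0 = i>0 ; x = x ; x-InAf = xA ; x-on = on ; x-only = only ; s≡ = s≡ }

  Wall⇒IsS : ∀ {s i k} → Wall s i k → IsS s
  Wall⇒IsS {i = i} {k} W = i , k , i>0 , (x , x-InAf , x-on , x-only) , s≡
    where open Wall W

  dotℚ-reflE : ∀ i k β x → dotℚ β (act (reflE i k) x)
    ≡ dotℚ β x ℚ.- toℚ (dotℤ β (coroot i)) ℚ.* (dotℚ (root i) x ℚ.- toℚ k)
  dotℚ-reflE i k β x = trans (dotℚ-act β (reflMat i) (scaleℤ k (coroot i)) x)
    (trans (cong₂ ℚ._+_ (dotℚ-reflMat i β x) (trans (cong toℚ (Lℤ.dot-scaleʳ k β (coroot i))) (toℚ-* k (dotℤ β (coroot i)))))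
      (ring (dotℚ β x) (toℚ (dotℤ β (coroot i))) (dotℚ (root i) x) (toℚ k)))
    where
    open ℚSolver
    ring : ∀ b c a k → (b ℚ.- c ℚ.* a) ℚ.+ k ℚ.* c ≡ b ℚ.- c ℚ.* (a ℚ.- k)
    ring = solve 4 (λ b c a k → (b :- c :* a) :+ k :* c := b :- c :* (a :- k)) refl

  dotℚ-transposed : ∀ M β x → dotℚ (transposed M β) x ≡ dotℚ β (matVecℚ M x)
  dotℚ-transposed M β x = Lℚ.dot-matMul-row β M x

  reflE-fixes : ∀ i k {x} → dotℚ (root i) x ≡ toℚ k → ∀ u β → dotℚ β (act (u · reflE i k) x) ≡ dotℚ β (act u x)
  reflE-fixes i k {x} on u@(M , μ) β = begin
    dotℚ β (act (u · reflE i k) x)      ≡⟨ cong (dotℚ β) (act-· u (reflE i k) x) ⟩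
    dotℚ β (act u (act (reflE i k) x))  ≡⟨ dotℚ-act β M μ _ ⟩
    dotℚ β (matVecℚ M (act (reflE i k) x)) ℚ.+ toℚ (dotℤ β μ) ≡⟨ cong (ℚ._+ toℚ (dotℤ β μ)) (dotℚ-transposed M β _) ⟨
    dotℚ γ (act (reflE i k) x) ℚ.+ toℚ (dotℤ β μ)  ≡⟨ cong (ℚ._+ toℚ (dotℤ β μ)) (dotℚ-reflE i k γ x) ⟩
    (dotℚ γ x ℚ.- toℚ (dotℤ γ (coroot i)) ℚ.* (dotℚ (root i) x ℚ.- toℚ k)) ℚ.+ toℚ (dotℤ β μ)
      ≡⟨ cong (λ t → (dotℚ γ x ℚ.- toℚ (dotℤ γ (coroot i)) ℚ.* (t ℚ.- toℚ k)) ℚ.+ toℚ (dotℤ β μ)) on ⟩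
    (dotℚ γ x ℚ.- toℚ (dotℤ γ (coroot i)) ℚ.* (toℚ k ℚ.- toℚ k)) ℚ.+ toℚ (dotℤ β μ)
      ≡⟨ ring (dotℚ γ x) (toℚ (dotℤ γ (coroot i))) (toℚ k) (toℚ (dotℤ β μ)) ⟩
    dotℚ γ x ℚ.+ toℚ (dotℤ β μ)              ≡⟨ cong (ℚ._+ toℚ (dotℤ β μ)) (dotℚ-transposed M β x) ⟩
    dotℚ β (matVecℚ M x) ℚ.+ toℚ (dotℤ β μ)  ≡⟨ dotℚ-act β M μ x ⟨
    dotℚ β (act u x)                         ∎
    where
    open ≡-Reasoning
    open ℚSolver
    γ = transposed M β
    ring : ∀ g c k t → (g ℚ.- c ℚ.* (k ℚ.- k)) ℚ.+ t ≡ g ℚ.+ t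
    ring = solve 4 (λ g c k t → (g :- c :* (k :- k)) :+ t := g :+ t) refl

  -- Integrality of α_j at ux passes to α_i at x; thus what is known about the hyperplanes through x
  -- transfers to those through ux.
  sgℚ-solve : ∀ ε a (t m : ℤ) → sgℚ ε a ℚ.+ toℚ t ≡ toℚ m → a ≡ toℚ (sg ε (m ℤ.- t))
  sgℚ-solve ε a t m eq = trans (sym (sgℚ-sgℚ ε a)) (trans (cong (sgℚ ε) step) (sym (toℚ-sg ε (m ℤ.- t))))
    where
    open ℚSolver
    ring : ∀ a t → a ≡ (a ℚ.+ t) ℚ.- t
    ring = solve 2 (λ a t → a := (a :+ t) :- t) refl
    step : sgℚ ε a ≡ toℚ (m ℤ.- t)
    step = trans (ring (sgℚ ε a) (toℚ t)) (trans (cong₂ ℚ._+_ eq (sym (toℚ-neg t))) (sym (toℚ-+ m (ℤ.- t))))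

  sgℚ-eval : ∀ ε {a k} → a ≡ toℚ k → ∀ t → sgℚ ε a ℚ.+ toℚ t ≡ toℚ (t ℤ.+ sg ε k)
  sgℚ-eval ε {k = k} refl t = trans (cong (ℚ._+ toℚ t) (sym (toℚ-sg ε k))) (trans (sym (toℚ-+ (sg ε k) t)) (cong toℚ (ℤP.+-comm (sg ε k) t)))

  img-reflMat : ∀ j → Img (reflMat j) j neg j
  img-reflMat j = img
    (λ y → trans (dot-reflMat j (root j) y) (trans (cong (λ t → dotℤ (root j) y ℤ.- t ℤ.* dotℤ (root j) y) (pairing-2 j)) (ring (dotℤ (root j) y))))
    (λ x → trans (dotℚ-reflMat j (root j) x) (trans (cong (λ t → dotℚ (root j) x ℚ.- toℚ t ℚ.* dotℚ (root j) x) (pairing-2 j)) (ringℚ (dotℚ (root j) x))))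
    where
    ring : ∀ a → a ℤ.- (+ 2) ℤ.* a ≡ ℤ.- a
    ring = solve-∀
    open ℚSolver
    ringℚ : ∀ a → a ℚ.- toℚ (+ 2) ℚ.* a ≡ ℚ.- a
    ringℚ = solve 1 (λ a → a :- con (toℚ (+ 2)) :* a := :- a) refl

  off-⊙ : ∀ ε → off (neg ⊙ ε) ≡ ℤ.- 1ℤ ℤ.- off ε
  off-⊙ pos = refl
  off-⊙ neg = refl

  -- Throughout, H_{α_j,m} with α_j positive is the image under u of the wall H_{α_i,k}, and ε is
  -- the sign in α_j ∘ M = ε α_i.
  module Cross {u} (inu : InWa u) {s i k} (W : Wall s i k) where
    open Wall W

    private
      inv = InW-inverse inu
      M′ = proj₁ inv
      MM′ : matMul (proj₁ u) M′ ≡ idMat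
      MM′ = proj₁ (proj₂ (proj₂ inv))
      -- Here α_i is given and α_j is sought, so the image is taken under the inverse matrix and
      -- turned around afterwards.
      sim = signed-image (proj₁ (proj₂ inv)) i

    ε : Sgn
    ε = proj₁ sim
    j : Fin r
    j = proj₁ (proj₂ sim)
    j>0 : Positive j
    j>0 = proj₁ (proj₂ (proj₂ sim))
    im : Img (proj₁ u) j ε i
    im = img-inverse (proj₂ (proj₂ (proj₂ inv))) (proj₂ (proj₂ (proj₂ sim)))
    t : ℤ
    t = dotℤ (root j) (proj₂ u)
    m : ℤ
    m = t ℤ.+ sg ε k

    inus : InWa (u · s)
    inus = subst (λ s → InWa (u · s)) (sym s≡) (InW-* inu (InW-reflMat i))

    conj : u · s ≡ reflE j m · u
    conj = trans (cong (u ·_) s≡) (reflE-conj inu im k)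

    dot-x : dotℚ (root j) (act u x) ≡ toℚ m
    dot-x = trans (dotℚ-act-img (proj₂ u) im x) (sgℚ-eval ε x-on t)

    inverse-img : Img M′ i ε j
    inverse-img = proj₂ (proj₂ (proj₂ sim))

    img-unique : ∀ {j′ ε′} → Positive j′ → Img (proj₁ u) j′ ε′ i → j′ ≡ j
    img-unique {j′} {ε′} j′>0 im′ = positive-unique {j′} {j} {ε′ ⊙ ε} j′>0 j>0 λ y → begin
      dotℤ (root j′) y                 ≡⟨ cong (dotℤ (root j′)) (matVec-id y) ⟨
      dotℤ (root j′) (matVec idMat y)  ≡⟨ cong (λ B → dotℤ (root j′) (matVec B y)) MM′ ⟨
      dotℤ (root j′) (matVec (matMul (proj₁ u) M′) y) ≡⟨ cong (dotℤ (root j′)) (matVec-* (proj₁ u) M′ y) ⟩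
      dotℤ (root j′) (matVec (proj₁ u) (matVec M′ y)) ≡⟨ onℤ im′ (matVec M′ y) ⟩
      sg ε′ (dotℤ (root i) (matVec M′ y))  ≡⟨ cong (sg ε′) (onℤ inverse-img y) ⟩
      sg ε′ (sg ε (dotℤ (root j) y))       ≡⟨ sg-⊙ ε′ ε (dotℤ (root j) y) ⟨
      sg (ε′ ⊙ ε) (dotℤ (root j) y)        ∎
      where open ≡-Reasoning

    -- u permutes the hyperplanes, and x lies on just one of them, so ux lies only on the image of
    -- that one.
    int-unique : ∀ j′ z → Positive j′ → dotℚ (root j′) (act u x) ≡ toℚ z → j′ ≡ j
    int-unique j′ z j′>0 eq = go (signed-image inu j′)
      where
      go : ∃[ ε′ ] ∃[ i′ ] (Positive i′ × Img (proj₁ u) j′ ε′ i′) → j′ ≡ j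
      go (ε′ , i′ , i′>0 , im′) = img-unique j′>0 (subst (Img (proj₁ u) j′ ε′) (proj₁ (x-only i′ (sg ε′ (z ℤ.- t′)) i′>0
          (sgℚ-solve ε′ (dotℚ (root i′) x) t′ z (trans (sym (dotℚ-act-img (proj₂ u) im′ x)) eq)))) im′)
        where
        t′ = dotℤ (root j′) (proj₂ u)

    -- Since s fixes x, the point ux belongs to both closed alcoves; at it α_{j′} is not an integer
    -- unless j′ = j.
    others : ∀ j′ → Positive j′ → j′ ≢ j → fl j′ (u · s) ≡ fl j′ u
    others j′ j′>0 j′≢j = sym (fl-≡ inu inus j′ x-InAf x-InAf
      (sym (trans (cong (λ s → dotℚ (root j′) (act (u · s) x)) s≡) (reflE-fixes i k x-on u (root j′))))
      (λ z eq → j′≢j (int-unique j′ z j′>0 eq)))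

    fl-u : fl j u ≡ t ℤ.+ off ε
    fl-u = fl-img (proj₂ u) im i>0

    -- Reflection at level m takes the strip [f, f + 1] to [2m - f - 1, 2m - f].
    fl-us : fl j (u · s) ≡ (+ 2) ℤ.* m ℤ.- 1ℤ ℤ.- fl j u
    fl-us = begin
      fl j (u · s)          ≡⟨ cong (fl j) conj ⟩
      fl j (reflE j m · u)  ≡⟨ fl-img (matVec (reflMat j) (proj₂ u) +ᵛ scaleℤ m (coroot j)) (img-* (img-reflMat j) im) i>0 ⟩
      dotℤ (root j) (actℤ (reflE j m) (proj₂ u)) ℤ.+ off (neg ⊙ ε)
        ≡⟨ cong₂ ℤ._+_ (dot-reflE j m (root j) (proj₂ u)) (off-⊙ ε) ⟩
      (t ℤ.- dotℤ (root j) (coroot j) ℤ.* (t ℤ.- m)) ℤ.+ (ℤ.- 1ℤ ℤ.- off ε)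
        ≡⟨ cong (λ p → (t ℤ.- p ℤ.* (t ℤ.- m)) ℤ.+ (ℤ.- 1ℤ ℤ.- off ε)) (pairing-2 j) ⟩
      (t ℤ.- (+ 2) ℤ.* (t ℤ.- m)) ℤ.+ (ℤ.- 1ℤ ℤ.- off ε)
        ≡⟨ ring t m (off ε) ⟩
      (+ 2) ℤ.* m ℤ.- 1ℤ ℤ.- (t ℤ.+ off ε)
        ≡⟨ cong (λ p → (+ 2) ℤ.* m ℤ.- 1ℤ ℤ.- p) fl-u ⟨
      (+ 2) ℤ.* m ℤ.- 1ℤ ℤ.- fl j u ∎
      where
      open ≡-Reasoning
      ring : ∀ t m o → (t ℤ.- (+ 2) ℤ.* (t ℤ.- m)) ℤ.+ (ℤ.- 1ℤ ℤ.- o) ≡ (+ 2) ℤ.* m ℤ.- 1ℤ ℤ.- (t ℤ.+ o)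
      ring = solve-∀

    Up Down : Set
    Up = fl j u ≡ m ℤ.- 1ℤ × fl j (u · s) ≡ m
    Down = fl j u ≡ m × fl j (u · s) ≡ m ℤ.- 1ℤ

    up : fl j u ≡ m ℤ.- 1ℤ → Up
    up eq = eq , trans fl-us (trans (cong (λ p → (+ 2) ℤ.* m ℤ.- 1ℤ ℤ.- p) eq) (ring m))
      where
      ring : ∀ m → (+ 2) ℤ.* m ℤ.- 1ℤ ℤ.- (m ℤ.- 1ℤ) ≡ m
      ring = solve-∀

    down : fl j u ≡ m → Down
    down eq = eq , trans fl-us (trans (cong (λ p → (+ 2) ℤ.* m ℤ.- 1ℤ ℤ.- p) eq) (ring m))
      where
      ring : ∀ m → (+ 2) ℤ.* m ℤ.- 1ℤ ℤ.- m ≡ m ℤ.- 1ℤ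
      ring = solve-∀

    -- A_f lies between the levels 0 and 1 of α_i and k is one of the two, so m is an end of the
    -- strip of uA_f. The pair (ε, k) tells which end.
    direction : Up ⊎ Down
    direction = go ε k k-01 fl-u refl
      where
      ring₁ : ∀ t → t ℤ.+ 0ℤ ≡ t ℤ.+ 1ℤ ℤ.- 1ℤ
      ring₁ = solve-∀
      ring₂ : ∀ t → t ℤ.+ ℤ.- 1ℤ ≡ t ℤ.+ 0ℤ ℤ.- 1ℤ
      ring₂ = solve-∀
      go : ∀ ε k → k ≡ 0ℤ ⊎ k ≡ 1ℤ → fl j u ≡ t ℤ.+ off ε → t ℤ.+ sg ε k ≡ m → Up ⊎ Down
      go pos _ (inj₁ refl) eq m≡ = inj₂ (down (trans eq m≡))
      go pos _ (inj₂ refl) eq m≡ = inj₁ (up (trans eq (trans (ring₁ t) (cong (ℤ._- 1ℤ) m≡))))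
      go neg _ (inj₁ refl) eq m≡ = inj₁ (up (trans eq (trans (ring₂ t) (cong (ℤ._- 1ℤ) m≡))))
      go neg _ (inj₂ refl) eq m≡ = inj₂ (down (trans eq m≡))

    up⇒Prec : Up → Prec u s
    up⇒Prec (fl≡ , _) = i , k , j , m , i>0 , s≡ , j>0
      , (λ y → (λ on → trans (dotℚ-act-img (proj₂ u) im y) (sgℚ-eval ε on t))
             , (λ eq → trans (sgℚ-solve ε (dotℚ (root i) y) t m (trans (sym (dotℚ-act-img (proj₂ u) im y)) eq)) (cong toℚ (trans (cong (sg ε) (ring t (sg ε k))) (sg-sg ε k)))))
      , (λ y yA → subst (λ p → dotℚ (root j) (act u y) ℚ.≤ toℚ p) (trans (cong (ℤ._+ 1ℤ) fl≡) (ring′ m)) (proj₂ (fl-strip inu j yA)))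
      where
      ring : ∀ t e → (t ℤ.+ e) ℤ.- t ≡ e
      ring = solve-∀
      ring′ : ∀ m → m ℤ.- 1ℤ ℤ.+ 1ℤ ≡ m
      ring′ = solve-∀

    -- `Prec` may bring its own root, level and hyperplane. They are first identified with the
    -- present ones by means of x; then the interior point `base` contradicts the inequality.
    down⇒¬Prec : Down → ¬ Prec u s
    down⇒¬Prec (fl≡ , _) (i₀ , k₀ , j₀ , m₀ , i₀>0 , s≡₀ , j₀>0 , iff , bound) = contra same-i same-k j₀≡j m₀≡m
      where
      open ℚSolver
      -- s fixes x but changes α_{i₀}(x) by -2(α_{i₀}(x) - k₀), so x lies on H_{α_{i₀},k₀}.
      on₀ : dotℚ (root i₀) x ≡ toℚ k₀
      on₀ = double-injective (begin
        toℚ (+ 2) ℚ.* a  ≡⟨ ring₁ (toℚ (+ 2)) a (toℚ k₀) ⟩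
        a ℚ.- (a ℚ.- toℚ (+ 2) ℚ.* (a ℚ.- toℚ k₀)) ℚ.+ toℚ (+ 2) ℚ.* toℚ k₀
          ≡⟨ cong (λ z → a ℚ.- (a ℚ.- toℚ z ℚ.* (a ℚ.- toℚ k₀)) ℚ.+ toℚ (+ 2) ℚ.* toℚ k₀) (pairing-2 i₀) ⟨
        a ℚ.- (a ℚ.- toℚ (dotℤ (root i₀) (coroot i₀)) ℚ.* (a ℚ.- toℚ k₀)) ℚ.+ toℚ (+ 2) ℚ.* toℚ k₀
          ≡⟨ cong (λ z → a ℚ.- z ℚ.+ toℚ (+ 2) ℚ.* toℚ k₀) (dotℚ-reflE i₀ k₀ (root i₀) x) ⟨
        a ℚ.- dotℚ (root i₀) (act (reflE i₀ k₀) x) ℚ.+ toℚ (+ 2) ℚ.* toℚ k₀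
          ≡⟨ cong (λ z → a ℚ.- dotℚ (root i₀) (act z x) ℚ.+ toℚ (+ 2) ℚ.* toℚ k₀) (trans (sym s≡₀) s≡) ⟩
        a ℚ.- dotℚ (root i₀) (act (reflE i k) x) ℚ.+ toℚ (+ 2) ℚ.* toℚ k₀
          ≡⟨ cong (λ z → a ℚ.- z ℚ.+ toℚ (+ 2) ℚ.* toℚ k₀) (trans (cong (λ e → dotℚ (root i₀) (act e x)) (sym (·-idˡ (reflE i k))))
               (trans (reflE-fixes i k x-on idE (root i₀)) (cong (dotℚ (root i₀)) (act-id x)))) ⟩
        a ℚ.- a ℚ.+ toℚ (+ 2) ℚ.* toℚ k₀  ≡⟨ ring₂ a (toℚ (+ 2)) (toℚ k₀) ⟩
        toℚ (+ 2) ℚ.* toℚ k₀              ∎)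
        where
        open ≡-Reasoning
        a = dotℚ (root i₀) x
        ring₁ : ∀ c a k → c ℚ.* a ≡ a ℚ.- (a ℚ.- c ℚ.* (a ℚ.- k)) ℚ.+ c ℚ.* k
        ring₁ = solve 3 (λ c a k → c :* a := a :- (a :- c :* (a :- k)) :+ c :* k) refl
        ring₂ : ∀ a c k → a ℚ.- a ℚ.+ c ℚ.* k ≡ c ℚ.* k
        ring₂ = solve 3 (λ a c k → a :- a :+ c :* k := c :* k) refl
      same-i : i₀ ≡ i
      same-i = proj₁ (x-only i₀ k₀ i₀>0 on₀)
      same-k : k₀ ≡ k
      same-k = proj₂ (x-only i₀ k₀ i₀>0 on₀)
      on-m₀ : dotℚ (root j₀) (act u x) ≡ toℚ m₀
      on-m₀ = proj₁ (iff x) on₀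
      j₀≡j : j₀ ≡ j
      j₀≡j = int-unique j₀ m₀ j₀>0 on-m₀
      m₀≡m : m₀ ≡ m
      m₀≡m = toℚ-injective (trans (sym on-m₀) (trans (cong (λ j → dotℚ (root j) (act u x)) j₀≡j) dot-x))
      contra : i₀ ≡ i → k₀ ≡ k → j₀ ≡ j → m₀ ≡ m → ⊥
      -- The claimed bound and the lower end of the strip force α_j(u base) = m, an integral value
      -- at an interior point.
      contra refl refl refl refl = base-nonint i i>0 (sg ε (m ℤ.- t)) (sgℚ-solve ε (dotℚ (root i) base) t m (trans (sym (dotℚ-act-img (proj₂ u) im base))
        (ℚP.≤-antisym (bound base base-InAf) (subst (λ z → toℚ z ℚ.≤ dotℚ (root j) (act u base)) fl≡ (proj₁ (fl-strip inu j base-InAf))))))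

    Prec? : Dec (Prec u s)
    Prec? with direction
    ... | inj₁ u↑ = yes (up⇒Prec u↑)
    ... | inj₂ u↓ = no (down⇒¬Prec u↓)

    Prec⇒Up : Prec u s → Up
    Prec⇒Up p with direction
    ... | inj₁ u↑ = u↑
    ... | inj₂ u↓ = ⊥-elim (down⇒¬Prec u↓ p)

    ¬Prec⇒Down : ¬ Prec u s → Down
    ¬Prec⇒Down ¬p with direction
    ... | inj₁ u↑ = ⊥-elim (¬p (up⇒Prec u↑))
    ... | inj₂ u↓ = u↓

-- Integer inequalities, general position, and the first violated constraint

0<+suc : ∀ {k} → 0ℤ ℤ.< + suc k
0<+suc = ℤ.+<+ (ℕ.s≤s ℕ.z≤n)

nonNeg-* : ∀ {a b} → 0ℤ ℤ.≤ a → 0ℤ ℤ.≤ b → 0ℤ ℤ.≤ a ℤ.* b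
nonNeg-* {+ a} {+ b} _ _ = subst (0ℤ ℤ.≤_) (ℤP.pos-* a b) (ℤ.+≤+ ℕ.z≤n)

pos-*′ : ∀ {a b} → 0ℤ ℤ.< a → 0ℤ ℤ.< b → 0ℤ ℤ.< a ℤ.* b
pos-*′ {+ suc a} {+ suc b} _ _ = 0<+suc
pos-*′ {+ zero} (ℤ.+<+ ())
pos-*′ {_} {+ zero} _ (ℤ.+<+ ())

nonNeg-cancel : ∀ {a b} → 0ℤ ℤ.< a → 0ℤ ℤ.≤ a ℤ.* b → 0ℤ ℤ.≤ b
nonNeg-cancel {+ suc a} {+ b} _ _ = ℤ.+≤+ ℕ.z≤n
nonNeg-cancel {+ zero} (ℤ.+<+ ())
nonNeg-cancel {+ suc a} { -[1+ b ]} _ ()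

pos-cancel : ∀ {a b} → 0ℤ ℤ.< a → 0ℤ ℤ.< a ℤ.* b → 0ℤ ℤ.< b
pos-cancel {a} {b} 0<a 0<ab = ℤP.≤∧≢⇒< (nonNeg-cancel 0<a (ℤP.<⇒≤ 0<ab))
  (λ { refl → ℤP.<-irrefl (sym (ℤP.*-zeroʳ a)) 0<ab })

0<j-i : ∀ {i j} → i ℤ.< j → 0ℤ ℤ.< j ℤ.- i
0<j-i {i} {j} i<j = subst (ℤ._< j ℤ.- i) (ℤP.+-inverseʳ i) (ℤP.+-monoˡ-< (ℤ.- i) i<j)

0<j-i⇒i<j : ∀ {i j} → 0ℤ ℤ.< j ℤ.- i → i ℤ.< j
0<j-i⇒i<j {i} {j} lt = subst₂ ℤ._<_ (ℤP.+-identityˡ i) (ring i j) (ℤP.+-monoˡ-< i lt)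
  where
  ring : ∀ i j → j ℤ.- i ℤ.+ i ≡ j
  ring = solve-∀

nonzero-witness : ∀ {m} (g : Vec ℤ m) → g ≢ V.replicate m 0ℤ → ∃[ d ] dotℤ g d ≢ 0ℤ
nonzero-witness [] g≢0 = ⊥-elim (g≢0 refl)
nonzero-witness (x ∷ g) g≢0 with x ℤ.≟ 0ℤ
... | no x≢0 = 1ℤ ∷ V.replicate _ 0ℤ , λ eq → x≢0 (trans (sym (trans (cong₂ ℤ._+_ (ℤP.*-identityʳ x) (dot-0ʳ g)) (ℤP.+-identityʳ x))) eq)
... | yes refl with nonzero-witness g (λ eq → g≢0 (cong (0ℤ ∷_) eq))
... | d , h = 0ℤ ∷ d , λ eq → h (trans (sym (ℤP.+-identityˡ (dotℤ g d))) eq)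

dominating : ∀ {m} (d p : Vec ℤ m) (ls : List (Vec ℤ m)) → All (λ l → 0ℤ ℤ.< dotℤ l p) ls →
  ∃[ K ] All (λ l → ∀ K′ → K ℤ.≤ K′ → 0ℤ ℤ.< dotℤ l (scaleℤ K′ p +ᵛ d)) ls
dominating d p [] [] = 0ℤ , []
dominating d p (l ∷ ls) (0<l ∷ h) with dominating d p ls h
... | K , hK = k ℤ.⊔ K , bound ∷ All.map (λ f K′ le → f K′ (ℤP.≤-trans (ℤP.i≤j⊔i k K) le)) hK
  where
  -- ⟨l,p⟩ ≥ 1, so K′ ≥ 1 + |⟨l,d⟩| already gives K′⟨l,p⟩ + ⟨l,d⟩ ≥ 1.
  k = 1ℤ ℤ.+ (+ ℤ.∣ dotℤ l d ∣)
  neg-abs : ∀ z → 0ℤ ℤ.≤ (+ ℤ.∣ z ∣) ℤ.+ z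
  neg-abs (+ z) = ℤ.+≤+ ℕ.z≤n
  neg-abs -[1+ z ] = ℤP.≤-reflexive (sym (ℤP.+-inverseʳ (+ suc z)))
  ring : ∀ a x y z p → ((a ℤ.- (1ℤ ℤ.+ y)) ℤ.* (1ℤ ℤ.+ p) ℤ.+ (1ℤ ℤ.+ y) ℤ.* p) ℤ.+ (1ℤ ℤ.+ (y ℤ.+ z)) ≡ a ℤ.* (1ℤ ℤ.+ p) ℤ.+ z
  ring = solve-∀
  bound : ∀ K′ → k ℤ.⊔ K ℤ.≤ K′ → 0ℤ ℤ.< dotℤ l (scaleℤ K′ p +ᵛ d)
  bound K′ le = subst (0ℤ ℤ.<_) (sym (trans (Lℤ.dot-+ʳ l (scaleℤ K′ p) d) (cong (ℤ._+ dotℤ l d) (Lℤ.dot-scaleʳ K′ l p))))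
    (subst (λ q → 0ℤ ℤ.< K′ ℤ.* q ℤ.+ dotℤ l d) 1+p′ (subst (0ℤ ℤ.<_) (ring K′ (dotℤ l p) (+ ℤ.∣ dotℤ l d ∣) (dotℤ l d) p′)
      (ℤP.+-mono-≤-< (ℤP.+-mono-≤ (nonNeg-* (ℤP.i≤j⇒0≤j-i k≤K′) (ℤP.≤-trans 0≤p′ (ℤP.i≤j+i p′ (+ 1)))) (nonNeg-* {k} (ℤ.+≤+ ℕ.z≤n) 0≤p′))
        (ℤP.+-mono-<-≤ {0ℤ} {1ℤ} 0<+suc (neg-abs (dotℤ l d))))))
    where
    k≤K′ = ℤP.≤-trans (ℤP.i≤i⊔j k K) le
    p′ = ℤ.pred (dotℤ l p)
    1+p′ : 1ℤ ℤ.+ p′ ≡ dotℤ l p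
    1+p′ = ℤP.suc-pred (dotℤ l p)
    0≤p′ : 0ℤ ℤ.≤ p′
    0≤p′ = ℤP.i<j⇒i≤pred[j] 0<l

-- K p + d with K large is, projectively, an arbitrarily small displacement of p in direction d.
leave-plane : ∀ {m} (g : Vec ℤ m) (ls : List (Vec ℤ m)) (p : Vec ℤ m) →
  ∃[ d ] dotℤ g d ≢ 0ℤ → All (λ l → 0ℤ ℤ.< dotℤ l p) ls →
  ∃[ q ] (dotℤ g q ≢ 0ℤ × All (λ l → 0ℤ ℤ.< dotℤ l q) ls)
leave-plane g ls p (d , gd≢0) hl with dotℤ g p ℤ.≟ 0ℤ
... | no gp≢0 = p , gp≢0 , hl
... | yes gp≡0 with dominating d p ls hl
... | K , hK = scaleℤ K p +ᵛ d
    , (λ eq → gd≢0 (trans (sym (trans (Lℤ.dot-+ʳ g (scaleℤ K p) d) (trans (cong (ℤ._+ dotℤ g d) (trans (Lℤ.dot-scaleʳ K g p)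
       (trans (cong (K ℤ.*_) gp≡0) (ℤP.*-zeroʳ K)))) (ℤP.+-identityˡ _)))) eq))
    , All.map (λ f → f K ℤP.≤-refl) hK

-- Once g is nonzero at the current point, g or -g joins the strict inequalities, which all further
-- displacements preserve; so the planes can be left one after another.
perturb : ∀ {m} (gs ls : List (Vec ℤ m)) (p : Vec ℤ m) →
  All (λ g → ∃[ d ] dotℤ g d ≢ 0ℤ) gs → All (λ l → 0ℤ ℤ.< dotℤ l p) ls →
  ∃[ q ] (All (λ g → dotℤ g q ≢ 0ℤ) gs × All (λ l → 0ℤ ℤ.< dotℤ l q) ls)
perturb [] ls p [] h = p , [] , h
perturb (g ∷ gs) ls p (hd ∷ hg) hl with leave-plane g ls p hd hl
... | p′ , gp≢0 , hl′ with ℤP.<-cmp (dotℤ g p′) 0ℤ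
... | tri≈ _ eq _ = ⊥-elim (gp≢0 eq)
... | tri> _ _ gp>0 with perturb gs (g ∷ ls) p′ hg (gp>0 ∷ hl′)
... | q , hg″ , (gq>0 ∷ hl″) = q , (λ eq → ℤP.<-irrefl (sym eq) gq>0) ∷ hg″ , hl″
perturb (g ∷ gs) ls p (hd ∷ hg) hl | p′ , gp≢0 , hl′ | tri< gp<0 _ _ with perturb gs (scaleℤ (ℤ.- 1ℤ) g ∷ ls) p′ hg
      (subst (0ℤ ℤ.<_) (sym (trans (Lℤ.dot-scaleˡ (ℤ.- 1ℤ) g p′) (ℤP.-1*i≡-i _))) (ℤP.neg-mono-< gp<0) ∷ hl′)
... | q , hg″ , (gq>0 ∷ hl″) = q , (λ eq → ℤP.<-irrefl (sym (trans (Lℤ.dot-scaleˡ (ℤ.- 1ℤ) g q) (cong (ℤ.- 1ℤ ℤ.*_) eq))) gq>0) ∷ hg″ , hl″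

-- A and B are the values of the affine constraints at the two ends of a segment: A c · B c′ − B c · A c′ is, up to
-- a positive factor, the value of c′ at the point where c vanishes, so the c found is the first one to be violated.
first-violated : ∀ {C : Set} (A B : C → ℤ) (cs : List C) → All (λ c → 0ℤ ℤ.< A c) cs →
  All (λ c → 0ℤ ℤ.≤ B c) cs ⊎
  ∃[ c ] (c ∈ cs × B c ℤ.< 0ℤ × All (λ c′ → 0ℤ ℤ.≤ A c ℤ.* B c′ ℤ.- B c ℤ.* A c′) cs)
first-violated A B [] [] = inj₁ []
first-violated A B (c₀ ∷ cs) (a₀ ∷ as) with first-violated A B cs as
... | inj₁ nn = case 0ℤ ℤ.≤? B c₀ of λ where
    (yes b₀) → inj₁ (b₀ ∷ nn)
    (no ¬b₀) → let b₀<0 = ℤP.≰⇒> ¬b₀ in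
      inj₂ (c₀ , here refl , b₀<0 , ℤP.≤-reflexive (sym (trans (cong (λ z → A c₀ ℤ.* B c₀ ℤ.- z) (ℤP.*-comm (B c₀) (A c₀))) (ℤP.+-inverseʳ (A c₀ ℤ.* B c₀))))
        ∷ All.zipWith (λ { {c′} (b , a) → subst (0ℤ ℤ.≤_) (ring (A c₀) (B c₀) (A c′) (B c′))
             (ℤP.+-mono-≤ (nonNeg-* (ℤP.<⇒≤ a₀) b) (nonNeg-* (ℤP.neg-mono-≤ (ℤP.<⇒≤ b₀<0)) (ℤP.<⇒≤ a))) }) (nn , as))
  where
  ring : ∀ a b a′ b′ → a ℤ.* b′ ℤ.+ (ℤ.- b) ℤ.* a′ ≡ a ℤ.* b′ ℤ.- b ℤ.* a′
  ring = solve-∀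
... | inj₂ (c , c∈ , b<0 , h) = case 0ℤ ℤ.≤? A c ℤ.* B c₀ ℤ.- B c ℤ.* A c₀ of λ where
    (yes h₀) → inj₂ (c , there c∈ , b<0 , h₀ ∷ h)
    (no ¬h₀) → let lt = ℤP.<⇒≤ (ℤP.≰⇒> ¬h₀) in
      inj₂ (c₀ , here refl , b₀<0 (ℤP.≰⇒> ¬h₀) , ℤP.≤-reflexive (sym (trans (cong (λ z → A c₀ ℤ.* B c₀ ℤ.- z) (ℤP.*-comm (B c₀) (A c₀))) (ℤP.+-inverseʳ (A c₀ ℤ.* B c₀))))
        ∷ All.zipWith (λ { {c′} (h′ , a) → nonNeg-cancel (All.lookup as c∈) (subst (0ℤ ℤ.≤_) (ring (A c) (B c) (A c₀) (B c₀) (A c′) (B c′))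
             (ℤP.+-mono-≤ (nonNeg-* (ℤP.<⇒≤ a₀) h′) (nonNeg-* (ℤP.<⇒≤ a) (ℤP.neg-mono-≤ lt)))) }) (h , as))
  where
  -- Transitivity of the order in which constraints vanish along the segment: if c₀ comes before c
  -- and c before c′, then c₀ comes before c′, after cancelling the positive factor a.
  ring : ∀ a b a₀ b₀ a′ b′ → a₀ ℤ.* (a ℤ.* b′ ℤ.- b ℤ.* a′) ℤ.+ a′ ℤ.* (ℤ.- (a ℤ.* b₀ ℤ.- b ℤ.* a₀)) ≡ a ℤ.* (a₀ ℤ.* b′ ℤ.- b₀ ℤ.* a′)
  ring = solve-∀
  ring′ : ∀ a b a₀ b₀ → ℤ.- (a ℤ.* b₀ ℤ.- b ℤ.* a₀) ℤ.+ (ℤ.- b) ℤ.* a₀ ≡ a ℤ.* (ℤ.- b₀)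
  ring′ = solve-∀
  b₀<0 : A c ℤ.* B c₀ ℤ.- B c ℤ.* A c₀ ℤ.< 0ℤ → B c₀ ℤ.< 0ℤ
  b₀<0 lt = subst (ℤ._< 0ℤ) (ℤP.neg-involutive (B c₀)) (ℤP.neg-mono-< (pos-cancel (All.lookup as c∈)
    (subst (0ℤ ℤ.<_) (ring′ (A c) (B c) (A c₀) (B c₀)) (ℤP.+-mono-<-≤ (ℤP.neg-mono-< lt) (nonNeg-* (ℤP.neg-mono-≤ (ℤP.<⇒≤ b<0)) (ℤP.<⇒≤ a₀))))))

-- The wall through which a generic segment leaves A_f

module Descent (D : RootDatum) where
  open Crossing D public

  -- The Cartan integers p and q of proportional roots are positive here with pq = 4. The value 1
  -- for either means that one root is twice the other, excluded since the datum is reduced; p = q =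
  -- 2 means equality.
  proportional-positive : ∀ {i j a b} → 0ℤ ℤ.< a → 0ℤ ℤ.< b → Positive i → Positive j →
    (∀ z → a ℤ.* dotℤ (root j) z ≡ b ℤ.* dotℤ (root i) z) → i ≡ j
  proportional-positive {i} {j} {a} {b} 0<a 0<b i>0 j>0 h = cases p q 0<p 0<q pq≡4 h₁ h₂
    where
    p = dotℤ (root j) (coroot i)
    q = dotℤ (root i) (coroot j)
    ap : a ℤ.* p ≡ b ℤ.* (+ 2)
    ap = trans (h (coroot i)) (cong (b ℤ.*_) (pairing-2 i))
    bq : b ℤ.* q ≡ a ℤ.* (+ 2)
    bq = trans (sym (h (coroot j))) (cong (a ℤ.*_) (pairing-2 j))
    0<p : 0ℤ ℤ.< p
    0<p = pos-cancel 0<a (subst (0ℤ ℤ.<_) (sym ap) (pos-*′ {b} {+ 2} 0<b 0<+suc))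
    0<q : 0ℤ ℤ.< q
    0<q = pos-cancel 0<b (subst (0ℤ ℤ.<_) (sym bq) (pos-*′ {a} {+ 2} 0<a 0<+suc))
    cancel : ∀ {c x y} → 0ℤ ℤ.< c → c ℤ.* x ≡ c ℤ.* y → x ≡ y
    cancel {c} {x} {y} 0<c eq = ℤP.*-cancelˡ-≡ c x y {{ℤ.>-nonZero 0<c}} eq
    h₁ : ∀ z → (+ 2) ℤ.* dotℤ (root j) z ≡ p ℤ.* dotℤ (root i) z
    h₁ z = cancel 0<a (begin
      a ℤ.* ((+ 2) ℤ.* y)  ≡⟨ ring a (+ 2) y ⟩
      (+ 2) ℤ.* (a ℤ.* y)  ≡⟨ cong ((+ 2) ℤ.*_) (h z) ⟩
      (+ 2) ℤ.* (b ℤ.* x)  ≡⟨ ring₂ (+ 2) b x ⟩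
      (b ℤ.* (+ 2)) ℤ.* x  ≡⟨ cong (ℤ._* x) ap ⟨
      (a ℤ.* p) ℤ.* x      ≡⟨ ℤP.*-assoc a p x ⟩
      a ℤ.* (p ℤ.* x)      ∎)
      where
      open ≡-Reasoning
      x = dotℤ (root i) z
      y = dotℤ (root j) z
      ring : ∀ a t y → a ℤ.* (t ℤ.* y) ≡ t ℤ.* (a ℤ.* y)
      ring = solve-∀
      ring₂ : ∀ t b x → t ℤ.* (b ℤ.* x) ≡ (b ℤ.* t) ℤ.* x
      ring₂ = solve-∀
    pq≡4 : p ℤ.* q ≡ + 4
    pq≡4 = trans (sym (h₁ (coroot j))) (cong (λ z → (+ 2) ℤ.* z) (pairing-2 j))
    h₂ : ∀ z → (+ 2) ℤ.* dotℤ (root i) z ≡ q ℤ.* dotℤ (root j) z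
    h₂ z = cancel {+ 2} 0<+suc (begin
      (+ 2) ℤ.* ((+ 2) ℤ.* x) ≡⟨ ℤP.*-assoc (+ 2) (+ 2) x ⟨
      (+ 4) ℤ.* x          ≡⟨ cong (ℤ._* x) pq≡4 ⟨
      (p ℤ.* q) ℤ.* x      ≡⟨ ring p q x ⟩
      q ℤ.* (p ℤ.* x)      ≡⟨ cong (q ℤ.*_) (h₁ z) ⟨
      q ℤ.* ((+ 2) ℤ.* y)  ≡⟨ ring₃ q (+ 2) y ⟩
      (+ 2) ℤ.* (q ℤ.* y)  ∎)
      where
      open ≡-Reasoning
      x = dotℤ (root i) z
      y = dotℤ (root j) z
      ring : ∀ p q x → (p ℤ.* q) ℤ.* x ≡ q ℤ.* (p ℤ.* x)
      ring = solve-∀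
      ring₃ : ∀ q t y → q ℤ.* (t ℤ.* y) ≡ t ℤ.* (q ℤ.* y)
      ring₃ = solve-∀
    cases : ∀ p q → 0ℤ ℤ.< p → 0ℤ ℤ.< q → p ℤ.* q ≡ + 4 → (∀ z → (+ 2) ℤ.* dotℤ (root j) z ≡ p ℤ.* dotℤ (root i) z) →
      (∀ z → (+ 2) ℤ.* dotℤ (root i) z ≡ q ℤ.* dotℤ (root j) z) → i ≡ j
    cases (+ 1) q _ _ _ h₁ _ = ⊥-elim (reduced j i (dot-ext λ z → sym (trans (Lℤ.dot-scaleˡ (+ 2) (root j) z) (trans (h₁ z) (ℤP.*-identityˡ _)))))
    cases (+ 2) q _ _ _ h₁ _ = sym (root-inj j i (dot-ext λ z → cancel {+ 2} 0<+suc (h₁ z)))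
    cases p (+ 1) _ _ _ _ h₂ = ⊥-elim (reduced i j (dot-ext λ z → sym (trans (Lℤ.dot-scaleˡ (+ 2) (root i) z) (trans (h₂ z) (ℤP.*-identityˡ _)))))
    cases p (+ 2) _ _ _ _ h₂ = root-inj i j (dot-ext λ z → cancel {+ 2} 0<+suc (h₂ z))
    cases (+ 0) _ (ℤ.+<+ ()) _ _ _ _
    cases (+ suc _) (+ 0) _ (ℤ.+<+ ()) _ _ _
    cases (+ suc (suc (suc p))) (+ suc (suc (suc q))) _ _ eq _ _ = ⊥-elim (absurd (ℤP.+-injective eq))
      where
      absurd : (3 ℕ.+ p) ℕ.* (3 ℕ.+ q) ≢ 4
      absurd eq = ℕP.<⇒≢ (ℕP.≤-trans {5} {9} (ℕP.m≤m+n 5 4) (ℕP.*-mono-≤ {3} {3 ℕ.+ p} {3} {3 ℕ.+ q} (ℕP.m≤m+n 3 p) (ℕP.m≤m+n 3 q))) (sym eq)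

  -- The half-spaces ⟨α_j, x⟩ ≥ 0 (false) and ⟨α_j, x⟩ ≤ 1 (true), as functionals in homogeneous coordinates D ∷ X.
  Constraint : Set
  Constraint = Fin r × Bool

  functional : Constraint → Vec ℤ (suc n)
  functional (j , false) = 0ℤ ∷ root j
  functional (j , true)  = 1ℤ ∷ scaleℤ (ℤ.- 1ℤ) (root j)

  value : Constraint → ℤ → Vec ℤ n → ℤ
  value (j , false) d X = dotℤ (root j) X
  value (j , true)  d X = d ℤ.- dotℤ (root j) X

  dot-functional : ∀ c d X → dotℤ (functional c) (d ∷ X) ≡ value c d X
  dot-functional (j , false) d X = ℤP.+-identityˡ (dotℤ (root j) X)
  dot-functional (j , true)  d X = cong₂ ℤ._+_ (ℤP.*-identityˡ d) (trans (Lℤ.dot-scaleˡ (ℤ.- 1ℤ) (root j) X) (ℤP.-1*i≡-i _))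

  constraints : List Constraint
  constraints = filter (positive? ∘ proj₁) (L.cartesianProduct (L.allFin r) (false ∷ true ∷ []))

  ∈-constraints : ∀ {j} e → Positive j → (j , e) ∈ constraints
  ∈-constraints {j} e j>0 = ∈-filter⁺ (positive? ∘ proj₁) (∈-cartesianProduct⁺ (∈-allFin j) (∈-bool e)) j>0
    where
    ∈-bool : ∀ e → e ∈ (false ∷ true ∷ [])
    ∈-bool false = here refl
    ∈-bool true  = there (here refl)

  constraint-positive : ∀ {c} → c ∈ constraints → Positive (proj₁ c)
  constraint-positive c∈ = proj₂ (∈-filter⁻ (positive? ∘ proj₁) {xs = L.cartesianProduct (L.allFin r) (false ∷ true ∷ [])} c∈)

  valueρ : Constraint → ℤ
  valueρ c = value c (+ suc scale) ρ

  valueρ>0 : ∀ {c} → Positive (proj₁ c) → 0ℤ ℤ.< valueρ c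
  valueρ>0 {j , false} j>0 = j>0
  valueρ>0 {j , true}  j>0 = 0<j-i (root-ρ-< j j>0)

  -- Its vanishing at (d : X) says that c and c′ become zero at the same point of the line from
  -- `base` to X/d, since their values at the two ends are proportional.
  separator : Constraint → Constraint → Vec ℤ (suc n)
  separator c c′ = scaleℤ (valueρ c) (functional c′) -ᵛ scaleℤ (valueρ c′) (functional c)

  dot-separator : ∀ c c′ d X → dotℤ (separator c c′) (d ∷ X) ≡ valueρ c ℤ.* value c′ d X ℤ.- valueρ c′ ℤ.* value c d X
  dot-separator c c′ d X = trans (Lℤ.dot-−ˡ (scaleℤ (valueρ c) (functional c′)) (scaleℤ (valueρ c′) (functional c)) (d ∷ X))
    (cong₂ ℤ._-_ (trans (Lℤ.dot-scaleˡ (valueρ c) (functional c′) (d ∷ X)) (cong (valueρ c ℤ.*_) (dot-functional c′ d X)))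
                 (trans (Lℤ.dot-scaleˡ (valueρ c′) (functional c) (d ∷ X)) (cong (valueρ c′ ℤ.*_) (dot-functional c d X))))

  -- Otherwise the two constraints are positive multiples of each other. Setting d = 0 leaves
  -- proportional roots: equal bounds give equal roots, and a lower against an upper bound has
  -- opposite signs at ρ.
  separator-zero : ∀ c c′ → Positive (proj₁ c) → Positive (proj₁ c′) → (∀ d X → dotℤ (separator c c′) (d ∷ X) ≡ 0ℤ) → c ≡ c′
  separator-zero c c′ c>0 c′>0 h = cases c c′ c>0 c′>0 (valueρ>0 {c} c>0) (valueρ>0 {c′} c′>0)
    (λ d X → ℤP.i-j≡0⇒i≡j _ _ (trans (sym (dot-separator c c′ d X)) (h d X)))
    where
    neg-* : ∀ a b → a ℤ.* (0ℤ ℤ.- b) ≡ ℤ.- (a ℤ.* b)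
    neg-* = solve-∀
    cases : ∀ {a a′} (c c′ : Constraint) → Positive (proj₁ c) → Positive (proj₁ c′) → 0ℤ ℤ.< a → 0ℤ ℤ.< a′ →
      (∀ d X → a ℤ.* value c′ d X ≡ a′ ℤ.* value c d X) → c ≡ c′
    cases (j , false) (j′ , false) p p′ a a′ h = cong (_, false) (proportional-positive a a′ p p′ (h 0ℤ))
    cases {x} {x′} (j , true) (j′ , true) p p′ a a′ h = cong (_, true) (proportional-positive a a′ p p′
      (λ X → ℤP.neg-injective (trans (sym (neg-* x (dotℤ (root j′) X))) (trans (h 0ℤ X) (neg-* x′ (dotℤ (root j) X))))))
    cases {x} {x′} (j , true) (j′ , false) p p′ a a′ h = ⊥-elim (ℤP.<-asym (pos-*′ a p′)
      (subst (ℤ._< 0ℤ) (sym (trans (h 0ℤ ρ) (neg-* x′ (dotℤ (root j) ρ)))) (ℤP.neg-mono-< (pos-*′ a′ p))))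
    cases {x} {x′} (j , false) (j′ , true) p p′ a a′ h = ⊥-elim (ℤP.<-asym (pos-*′ a′ p)
      (subst (ℤ._< 0ℤ) (trans (sym (neg-* x (dotℤ (root j′) ρ))) (h 0ℤ ρ)) (ℤP.neg-mono-< (pos-*′ a p′))))

  _≟c_ : (c c′ : Constraint) → Dec (c ≡ c′)
  _≟c_ = ≡-dec FinP._≟_ BoolP._≟_

  lower upper : Elt → Fin r → Vec ℤ (suc n)
  lower w j = ℤ.- fl j w ∷ root j
  upper w j = (1ℤ ℤ.+ fl j w) ∷ scaleℤ (ℤ.- 1ℤ) (root j)

  dot-lower : ∀ w j d X → dotℤ (lower w j) (d ∷ X) ≡ dotℤ (root j) X ℤ.- fl j w ℤ.* d
  dot-lower w j d X = ring (fl j w) d (dotℤ (root j) X)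
    where
    ring : ∀ f d x → ℤ.- f ℤ.* d ℤ.+ x ≡ x ℤ.- f ℤ.* d
    ring = solve-∀

  dot-upper : ∀ w j d X → dotℤ (upper w j) (d ∷ X) ≡ (1ℤ ℤ.+ fl j w) ℤ.* d ℤ.- dotℤ (root j) X
  dot-upper w j d X = cong (λ z → (1ℤ ℤ.+ fl j w) ℤ.* d ℤ.+ z) (trans (Lℤ.dot-scaleˡ (ℤ.- 1ℤ) (root j) X) (ℤP.-1*i≡-i _))

  positives : List (Fin r)
  positives = filter positive? (L.allFin r)

  ∈-positives : ∀ {j} → Positive j → j ∈ positives
  ∈-positives {j} j>0 = ∈-filter⁺ positive? (∈-allFin j) j>0

  strict : Elt → List (Vec ℤ (suc n))
  -- The first functional is the denominator, which must remain positive when the point is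
  -- displaced.
  strict w = (1ℤ ∷ V.replicate n 0ℤ) ∷ map (lower w) positives ++ map (upper w) positives

  distinct? : (cc : Constraint × Constraint) → Dec (proj₁ cc ≢ proj₂ cc)
  distinct? (c , c′) = ¬? (c ≟c c′)

  constraintPairs : List (Constraint × Constraint)
  constraintPairs = L.cartesianProduct constraints constraints

  distinctPairs : List (Constraint × Constraint)
  distinctPairs = filter distinct? (constraintPairs)

  separators : List (Vec ℤ (suc n))
  separators = map (λ cc → separator (proj₁ cc) (proj₂ cc)) distinctPairs

  separators-nonzero : All (λ g → ∃[ d ] dotℤ g d ≢ 0ℤ) separators
  separators-nonzero = AllP.map⁺ (All.tabulate λ {cc} cc∈ → nonzero (proj₁ cc) (proj₂ cc) (∈-filter⁻ distinct? {xs = constraintPairs} cc∈))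
    where
    nonzero : ∀ c c′ → (c , c′) ∈ constraintPairs × c ≢ c′ → ∃[ d ] dotℤ (separator c c′) d ≢ 0ℤ
    nonzero c c′ (cc∈ , c≢c′) with ∈-cartesianProduct⁻ constraints constraints cc∈
    ... | c∈ , c′∈ = nonzero-witness (separator c c′) λ eq → c≢c′ (separator-zero c c′ (constraint-positive c∈) (constraint-positive c′∈)
          (λ d X → trans (cong (λ v → dotℤ v (d ∷ X)) eq) (Lℤ.dot-0ˡ (d ∷ X))))

  separated : ∀ q → All (λ g → dotℤ g q ≢ 0ℤ) separators → ∀ {c c′} → c ∈ constraints → c′ ∈ constraints → c ≢ c′ → dotℤ (separator c c′) q ≢ 0ℤ
  separated q h {c} {c′} c∈ c′∈ c≢c′ = All.lookup (AllP.map⁻ h) (∈-filter⁺ distinct? (∈-cartesianProduct⁺ c∈ c′∈) c≢c′)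

  -- The starting vector is w applied to `base` with the denominator cleared, an interior point of
  -- wA_f.
  strict-start : ∀ {M μ} → InW M → All (λ l → 0ℤ ℤ.< dotℤ l (+ suc scale ∷ (scaleℤ (+ suc scale) μ +ᵛ matVec M ρ))) (strict (M , μ))
  strict-start {M} {μ} inW =
    subst (0ℤ ℤ.<_) (sym (trans (cong₂ ℤ._+_ (ℤP.*-identityˡ N) (Lℤ.dot-0ˡ X)) (ℤP.+-identityʳ N))) 0<+suc
    ∷ AllP.++⁺ (AllP.map⁺ {f = lower w} (All.tabulate {xs = positives} λ {j} _ → low j)) (AllP.map⁺ {f = upper w} (All.tabulate {xs = positives} λ {j} _ → upp j))
    where
    N = + suc scale
    X = scaleℤ N μ +ᵛ matVec M ρ
    w = M , μ
    dotX : ∀ j {ε i} → Img M j ε i → dotℤ (root j) X ≡ N ℤ.* dotℤ (root j) μ ℤ.+ sg ε (dotℤ (root i) ρ)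
    dotX j im = trans (Lℤ.dot-+ʳ (root j) (scaleℤ N μ) (matVec M ρ)) (cong₂ ℤ._+_ (Lℤ.dot-scaleʳ N (root j) μ) (onℤ im ρ))
    sg-low : ∀ ε {z} → 0ℤ ℤ.< z → z ℤ.< N → 0ℤ ℤ.< sg ε z ℤ.- off ε ℤ.* N
    sg-low pos {z} 0<z _ = subst (0ℤ ℤ.<_) (sym (ℤP.+-identityʳ z)) 0<z
    sg-low neg {z} _ z<N = subst (0ℤ ℤ.<_) (ring N z) (0<j-i z<N)
      where
      ring : ∀ N z → N ℤ.- z ≡ ℤ.- z ℤ.- (ℤ.- 1ℤ) ℤ.* N
      ring = solve-∀
    sg-upp : ∀ ε {z} → 0ℤ ℤ.< z → z ℤ.< N → 0ℤ ℤ.< (1ℤ ℤ.+ off ε) ℤ.* N ℤ.- sg ε z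
    sg-upp pos {z} _ z<N = subst (0ℤ ℤ.<_) (ring N z) (0<j-i z<N)
      where
      ring : ∀ N z → N ℤ.- z ≡ (1ℤ ℤ.+ 0ℤ) ℤ.* N ℤ.- z
      ring = solve-∀
    sg-upp neg {z} 0<z _ = subst (0ℤ ℤ.<_) (ring N z) 0<z
      where
      ring : ∀ N z → z ≡ (1ℤ ℤ.+ ℤ.- 1ℤ) ℤ.* N ℤ.- (ℤ.- z)
      ring = solve-∀
    low : ∀ j → 0ℤ ℤ.< dotℤ (lower w j) (N ∷ X)
    low j with signed-image inW j
    ... | ε , i , i>0 , im = subst (0ℤ ℤ.<_) (sym (trans (dot-lower w j N X) (trans (cong₂ (λ p q → p ℤ.- q ℤ.* N) (dotX j im) (fl-img μ im i>0))
            (ring N (dotℤ (root j) μ) (sg ε (dotℤ (root i) ρ)) (off ε))))) (sg-low ε i>0 (root-ρ-< i i>0))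
      where
      ring : ∀ N t z o → (N ℤ.* t ℤ.+ z) ℤ.- (t ℤ.+ o) ℤ.* N ≡ z ℤ.- o ℤ.* N
      ring = solve-∀
    upp : ∀ j → 0ℤ ℤ.< dotℤ (upper w j) (N ∷ X)
    upp j with signed-image inW j
    ... | ε , i , i>0 , im = subst (0ℤ ℤ.<_) (sym (trans (dot-upper w j N X) (trans (cong₂ (λ p q → (1ℤ ℤ.+ q) ℤ.* N ℤ.- p) (dotX j im) (fl-img μ im i>0))
            (ring N (dotℤ (root j) μ) (sg ε (dotℤ (root i) ρ)) (off ε))))) (sg-upp ε i>0 (root-ρ-< i i>0))
      where
      ring : ∀ N t z o → (1ℤ ℤ.+ (t ℤ.+ o)) ℤ.* N ℤ.- (N ℤ.* t ℤ.+ z) ≡ (1ℤ ℤ.+ o) ℤ.* N ℤ.- z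
      ring = solve-∀

  -- A point of the interior of w A_f in homogeneous coordinates, in general position with respect to ρ.
  record Generic (w : Elt) : Set where
    field
      d        : ℤ
      X        : Vec ℤ n
      d>0      : 0ℤ ℤ.< d
      above    : ∀ {j} → Positive j → fl j w ℤ.* d ℤ.< dotℤ (root j) X
      below    : ∀ {j} → Positive j → dotℤ (root j) X ℤ.< (1ℤ ℤ.+ fl j w) ℤ.* d
      distinct : ∀ {c c′} → c ∈ constraints → c′ ∈ constraints → c ≢ c′ → valueρ c ℤ.* value c′ d X ℤ.- valueρ c′ ℤ.* value c d X ≢ 0ℤ

  generic : ∀ {w} → InWa w → Generic w
  generic {w} inW with perturb separators (strict w) _ separators-nonzero (strict-start inW)
  ... | d ∷ X , hg , (hd ∷ hs) with AllP.++⁻ (map (lower w) positives) hs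
  ... | hl , hu = record
    { d = d ; X = X
    ; d>0 = subst (0ℤ ℤ.<_) (trans (cong₂ ℤ._+_ (ℤP.*-identityˡ d) (Lℤ.dot-0ˡ X)) (ℤP.+-identityʳ d)) hd
    ; above = λ {j} j>0 → 0<j-i⇒i<j (subst (0ℤ ℤ.<_) (dot-lower w j d X) (All.lookup (AllP.map⁻ hl) (∈-positives j>0)))
    ; below = λ {j} j>0 → 0<j-i⇒i<j (subst (0ℤ ℤ.<_) (dot-upper w j d X) (All.lookup (AllP.map⁻ hu) (∈-positives j>0)))
    ; distinct = λ {c} {c′} c∈ c′∈ c≢c′ eq → separated (d ∷ X) hg c∈ c′∈ c≢c′ (trans (dot-separator c c′ d X) eq) }

  -- The alcove wA_f lies beyond the wall H_{α_i,k} of A_f: below level 0 or above level 1.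
  Separates : Fin r → ℤ → Elt → Set
  Separates i k w = (k ≡ 0ℤ × fl i w ℤ.< 0ℤ) ⊎ (k ≡ 1ℤ × 0ℤ ℤ.< fl i w)

  -- The first wall of A_f crossed by a generic segment from a point of A_f to a point of w A_f.
  separating-wall : ∀ {w} → InWa w → ∀ {i₀} → Positive i₀ → fl i₀ w ≢ 0ℤ →
    ∃[ i ] ∃[ k ] (Wall (reflE i k) i k × Separates i k w)
  separating-wall {w} inW {i₀} i₀>0 fl≢0 = result (first-violated valueρ B constraints (All.tabulate λ {c} c∈ → valueρ>0 {c} (constraint-positive c∈)))
    where
    open Generic (generic inW)
    B : Constraint → ℤ
    B c = value c d X
    neg-mul : ∀ {f} → f ℤ.≤ 0ℤ → f ℤ.* d ℤ.≤ 0ℤ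
    neg-mul {f} f≤0 = subst (ℤ._≤ 0ℤ) (ring f d) (ℤP.neg-mono-≤ (nonNeg-* (ℤP.neg-mono-≤ f≤0) (ℤP.<⇒≤ d>0)))
      where
      ring : ∀ f d → ℤ.- (ℤ.- f ℤ.* d) ≡ f ℤ.* d
      ring = solve-∀
    pos-mul : ∀ {f} → 0ℤ ℤ.< f → d ℤ.≤ f ℤ.* d
    pos-mul {f} 0<f = subst₂ ℤ._≤_ (ℤP.+-identityˡ d) (ring f d) (ℤP.+-monoˡ-≤ d (nonNeg-* (ℤP.i<j⇒i≤pred[j] 0<f) (ℤP.<⇒≤ d>0)))
      where
      ring : ∀ f d → (ℤ.- 1ℤ ℤ.+ f) ℤ.* d ℤ.+ d ≡ f ℤ.* d
      ring = solve-∀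
    suc≤0 : ∀ {f} → f ℤ.< 0ℤ → 1ℤ ℤ.+ f ℤ.≤ 0ℤ
    suc≤0 = ℤP.i<j⇒suc[i]≤j
    -- A nonzero floor places X/d strictly outside A_f.
    not-inside : ¬ All (λ c → 0ℤ ℤ.≤ B c) constraints
    not-inside h = case ℤP.<-cmp (fl i₀ w) 0ℤ of λ where
      (tri≈ _ eq _) → fl≢0 eq
      (tri< f<0 _ _) → ℤP.<⇒≱ (ℤP.<-≤-trans (below i₀>0) (neg-mul (suc≤0 f<0))) (All.lookup h (∈-constraints false i₀>0))
      (tri> _ _ f>0) → ℤP.<⇒≱ (ℤP.≤-<-trans (pos-mul f>0) (above i₀>0)) (ℤP.0≤i-j⇒j≤i (All.lookup h (∈-constraints true i₀>0)))
    module Exit (c : Constraint) (c∈ : c ∈ constraints) (Bc<0 : B c ℤ.< 0ℤ)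
                (h : All (λ c′ → 0ℤ ℤ.≤ valueρ c ℤ.* B c′ ℤ.- B c ℤ.* valueρ c′) constraints) where
      A>0 : 0ℤ ℤ.< valueρ c
      A>0 = valueρ>0 {c} (constraint-positive c∈)
      -- (e : Y) = A(c)(d : X) - B(c)(N : ρ), with A = `valueρ` and N = `+ suc scale`, is the point
      -- of the segment at which c vanishes; both weights are positive because B(c) < 0.
      e : ℤ
      e = valueρ c ℤ.* d ℤ.- B c ℤ.* (+ suc scale)
      Y : Vec ℤ n
      Y = scaleℤ (valueρ c) X +ᵛ scaleℤ (ℤ.- B c) ρ
      e>0 : 0ℤ ℤ.< e
      e>0 = subst (0ℤ ℤ.<_) (ring (valueρ c) d (B c) (+ suc scale)) (ℤP.+-mono-<-≤ (pos-*′ A>0 d>0)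
              (nonNeg-* {ℤ.- B c} {+ suc scale} (ℤP.neg-mono-≤ (ℤP.<⇒≤ Bc<0)) (ℤ.+≤+ ℕ.z≤n)))
        where
        ring : ∀ a d b s → a ℤ.* d ℤ.+ (ℤ.- b) ℤ.* s ≡ a ℤ.* d ℤ.- b ℤ.* s
        ring = solve-∀
      dotY : ∀ j → dotℤ (root j) Y ≡ valueρ c ℤ.* dotℤ (root j) X ℤ.- B c ℤ.* dotℤ (root j) ρ
      dotY j = trans (Lℤ.dot-+ʳ (root j) (scaleℤ (valueρ c) X) (scaleℤ (ℤ.- B c) ρ))
        (trans (cong₂ ℤ._+_ (Lℤ.dot-scaleʳ (valueρ c) (root j) X) (Lℤ.dot-scaleʳ (ℤ.- B c) (root j) ρ))
          (ring (valueρ c) (dotℤ (root j) X) (B c) (dotℤ (root j) ρ)))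
        where
        ring : ∀ a x b y → a ℤ.* x ℤ.+ (ℤ.- b) ℤ.* y ≡ a ℤ.* x ℤ.- b ℤ.* y
        ring = solve-∀
      valueY : ∀ c′ → value c′ e Y ≡ valueρ c ℤ.* B c′ ℤ.- B c ℤ.* valueρ c′
      valueY (j , false) = dotY j
      valueY (j , true) = trans (cong (λ z → e ℤ.- z) (dotY j)) (ring (valueρ c) d (B c) (+ suc scale) (dotℤ (root j) X) (dotℤ (root j) ρ))
        where
        ring : ∀ a d b s x y → (a ℤ.* d ℤ.- b ℤ.* s) ℤ.- (a ℤ.* x ℤ.- b ℤ.* y) ≡ a ℤ.* (d ℤ.- x) ℤ.- b ℤ.* (s ℤ.- y)
        ring = solve-∀
      valueY≥0 : ∀ {c′} → c′ ∈ constraints → 0ℤ ℤ.≤ value c′ e Y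
      valueY≥0 {c′} c′∈ = subst (0ℤ ℤ.≤_) (sym (valueY c′)) (All.lookup h c′∈)
      valueYc : value c e Y ≡ 0ℤ
      valueYc = trans (valueY c) (trans (cong (λ z → valueρ c ℤ.* B c ℤ.- z) (ℤP.*-comm (B c) (valueρ c))) (ℤP.+-inverseʳ (valueρ c ℤ.* B c)))
      -- General position enters here: another constraint vanishing at Y/e would make its separator
      -- from c vanish at (d : X).
      valueY-only : ∀ {c′} → c′ ∈ constraints → value c′ e Y ≡ 0ℤ → c′ ≡ c
      valueY-only {c′} c′∈ eq = case c ≟c c′ of λ where
        (yes c≡c′) → sym c≡c′
        (no c≢c′) → ⊥-elim (distinct c∈ c′∈ c≢c′ (trans (cong (λ z → valueρ c ℤ.* B c′ ℤ.- z) (ℤP.*-comm (valueρ c′) (B c))) (trans (sym (valueY c′)) eq)))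

      level : Bool → ℤ
      level false = 0ℤ
      level true  = 1ℤ

      value-level : ∀ j b {e} → value (j , b) e Y ≡ 0ℤ → dotℤ (root j) Y ≡ level b ℤ.* e
      value-level j false eq = eq
      value-level j true {e} eq = trans (sym (ℤP.i-j≡0⇒i≡j e _ eq)) (sym (ℤP.*-identityˡ e))

      level-value : ∀ j b {e} → dotℤ (root j) Y ≡ level b ℤ.* e → value (j , b) e Y ≡ 0ℤ
      level-value j false eq = eq
      level-value j true {e} eq = trans (cong (λ z → e ℤ.- z) (trans eq (ℤP.*-identityˡ e))) (ℤP.+-inverseʳ e)

      -- Abstracting over e allows it to be matched as `+ suc m`, which supplies the denominator for
      -- `fracVec`.
      conclude : ∀ {e} → 0ℤ ℤ.< e → (∀ {c′} → c′ ∈ constraints → 0ℤ ℤ.≤ value c′ e Y) → value c e Y ≡ 0ℤ →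
        (∀ {c′} → c′ ∈ constraints → value c′ e Y ≡ 0ℤ → c′ ≡ c) → ∃[ i ] ∃[ k ] (Wall (reflE i k) i k × Separates i k w)
      conclude {+ 0} (ℤ.+<+ ()) _ _ _
      conclude {+ suc m} _ nonneg vanish only = proj₁ c , level (proj₂ c)
        , record
          { i>0 = c>0 ; x = fracVec m Y ; x-InAf = inAf
          ; x-on = trans (dotℚ-fracVec m (root (proj₁ c)) Y) (recip-≡⁻ m (level (proj₂ c)) (value-level (proj₁ c) (proj₂ c) vanish))
          ; x-only = λ j z j>0 eq → unique j z j>0 (recip-≡ m {dotℤ (root j) Y} {z} (trans (sym (dotℚ-fracVec m (root j) Y)) eq))
          ; s≡ = refl }
        , separates c c>0 Bc<0
        where
        c>0 : Positive (proj₁ c)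
        c>0 = constraint-positive c∈
        upper-bound : ∀ j → Positive j → dotℤ (root j) Y ℤ.≤ + suc m
        upper-bound j j>0 = ℤP.0≤i-j⇒j≤i (nonneg (∈-constraints true j>0))
        inAf : InAf (fracVec m Y)
        inAf j j>0 = subst₂ ℚ._≤_ (ℚP.*-zeroʳ (recip m)) (sym (dotℚ-fracVec m (root j) Y)) (recip-mono m (nonneg (∈-constraints false j>0)))
          , subst₂ ℚ._≤_ (sym (dotℚ-fracVec m (root j) Y)) (recip-* m) (recip-mono m (upper-bound j j>0))
        unique : ∀ j z → Positive j → dotℤ (root j) Y ≡ z ℤ.* (+ suc m) → j ≡ proj₁ c × z ≡ level (proj₂ c)
        unique j z j>0 eq = go z eq (0≤k≤1 {z} (nonNeg-cancel {+ suc m} 0<+suc (subst (0ℤ ℤ.≤_) (trans eq (ℤP.*-comm z (+ suc m))) (nonneg (∈-constraints false j>0))))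
               (ℤP.*-cancelʳ-≤-pos z 1ℤ (+ suc m) (subst₂ ℤ._≤_ eq (sym (ℤP.*-identityˡ (+ suc m))) (upper-bound j j>0))))
          where
          hit : ∀ b → dotℤ (root j) Y ≡ level b ℤ.* (+ suc m) → (j , b) ≡ c
          hit b eq = only {j , b} (∈-constraints b j>0) (level-value j b eq)
          go : ∀ z → dotℤ (root j) Y ≡ z ℤ.* (+ suc m) → z ≡ 0ℤ ⊎ z ≡ 1ℤ → j ≡ proj₁ c × z ≡ level (proj₂ c)
          go _ eq (inj₁ refl) = cong proj₁ (hit false eq) , cong (λ c → level (proj₂ c)) (hit false eq)
          go _ eq (inj₂ refl) = cong proj₁ (hit true eq) , cong (λ c → level (proj₂ c)) (hit true eq)
        separates : ∀ c → Positive (proj₁ c) → B c ℤ.< 0ℤ → Separates (proj₁ c) (level (proj₂ c)) w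
        separates (j , false) j>0 lt = inj₁ (refl , (case fl j w ℤ.<? 0ℤ of λ where
          (yes p) → p
          (no ¬p) → ⊥-elim (ℤP.<⇒≱ (ℤP.<-trans (above j>0) lt) (nonNeg-* (ℤP.≮⇒≥ ¬p) (ℤP.<⇒≤ d>0)))))
        separates (j , true) j>0 lt = inj₂ (refl , (case 0ℤ ℤ.<? fl j w of λ where
          (yes p) → p
          (no ¬p) → ⊥-elim (ℤP.<-irrefl refl (ℤP.<-trans lt (0<j-i (ℤP.<-≤-trans (below j>0)
             (subst (λ z → (1ℤ ℤ.+ fl j w) ℤ.* d ℤ.≤ z) (ℤP.*-identityˡ d) (ℤP.*-monoʳ-≤-nonNeg d {{ℤ.nonNegative (ℤP.<⇒≤ d>0)}} (ℤP.+-monoʳ-≤ 1ℤ (ℤP.≮⇒≥ ¬p))))))))))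

    result : All (λ c → 0ℤ ℤ.≤ B c) constraints ⊎
      ∃[ c ] (c ∈ constraints × B c ℤ.< 0ℤ × All (λ c′ → 0ℤ ℤ.≤ valueρ c ℤ.* B c′ ℤ.- B c ℤ.* valueρ c′) constraints) →
      ∃[ i ] ∃[ k ] (Wall (reflE i k) i k × Separates i k w)
    result (inj₁ h) = ⊥-elim (not-inside h)
    result (inj₂ (c , c∈ , Bc<0 , h)) = conclude e>0 valueY≥0 valueYc valueY-only
      where open Exit c c∈ Bc<0 h

-- The hyperplane count, its change under a letter, and descents

abs-suc : ∀ {m} → 1ℤ ℤ.≤ m → ℤ.∣ m ∣ ≡ suc ℤ.∣ m ℤ.- 1ℤ ∣
abs-suc {+ suc m} _ = refl
abs-suc {+ 0} (ℤ.+≤+ ())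

abs-pred : ∀ {m} → m ℤ.≤ 0ℤ → ℤ.∣ m ℤ.- 1ℤ ∣ ≡ suc ℤ.∣ m ∣
abs-pred {+ 0} _ = refl
abs-pred { -[1+ m ]} _ = cong (λ k → suc (suc k)) (ℕP.+-identityʳ m)
abs-pred {+ suc m} (ℤ.+≤+ ())

sum-map-cong : ∀ {A : Set} {f g : A → ℕ} (xs : List A) → (∀ {x} → x ∈ xs → f x ≡ g x) → sum (map f xs) ≡ sum (map g xs)
sum-map-cong [] h = refl
sum-map-cong (x ∷ xs) h = cong₂ ℕ._+_ (h (here refl)) (sum-map-cong xs (h ∘ there))

sum-map-suc : ∀ {A : Set} {f g : A → ℕ} {xs : List A} {y} → Unique xs → y ∈ xs →
  f y ≡ suc (g y) → (∀ {x} → x ∈ xs → x ≢ y → f x ≡ g x) → sum (map f xs) ≡ suc (sum (map g xs))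
sum-map-suc {xs = x ∷ xs} (x∉ ∷ _) (here refl) eq h =
  cong₂ ℕ._+_ eq (sum-map-cong xs λ {z} z∈ → h (there z∈) λ { refl → All.lookup x∉ z∈ refl })
sum-map-suc {f = f} {g} {x ∷ xs} (x∉ ∷ uniq) (there y∈) eq h =
  trans (cong₂ ℕ._+_ (h (here refl) (λ { refl → All.lookup x∉ y∈ refl })) (sum-map-suc uniq y∈ eq (h ∘ there)))
    (ℕP.+-suc (g x) (sum (map g xs)))

module Length (D : RootDatum) where
  open Descent D public

  positive-∈ : ∀ {j} → j ∈ positives → Positive j
  positive-∈ j∈ = proj₂ (∈-filter⁻ positive? {xs = L.allFin r} j∈)

  positives-unique : Unique positives
  positives-unique = UniqueP.filter⁺ positive? (UniqueP.allFin⁺ r)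

  len : Elt → ℕ
  len v = sum (map (λ j → ℤ.∣ fl j v ∣) positives)

  len-cong : ∀ {u v} → (∀ {j} → Positive j → fl j u ≡ fl j v) → len u ≡ len v
  len-cong h = sum-map-cong positives λ j∈ → cong ℤ.∣_∣ (h (positive-∈ j∈))

  module Step {u} (inu : InWa u) {s i k} (W : Wall s i k) where
    open Cross {u} inu W public

    -- A_f has floor 0, so it lies below H_{α_j,m} if m ≥ 1 and above it if m ≤ 0. `away` means that
    -- uA_f is on the side of A_f, `toward` that the hyperplane separates them.
    away toward : Set
    away   = (fl j u ≡ m ℤ.- 1ℤ × 1ℤ ℤ.≤ m) ⊎ (fl j u ≡ m × m ℤ.≤ 0ℤ)
    toward = (fl j u ≡ m × 1ℤ ℤ.≤ m) ⊎ (fl j u ≡ m ℤ.- 1ℤ × m ℤ.≤ 0ℤ)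

    away⊎toward : away ⊎ toward
    away⊎toward with direction | 1ℤ ℤ.≤? m
    ... | inj₁ (eq , _) | yes p = inj₁ (inj₁ (eq , p))
    ... | inj₁ (eq , _) | no ¬p = inj₂ (inj₂ (eq , ℤP.i<j⇒i≤pred[j] (ℤP.≰⇒> ¬p)))
    ... | inj₂ (eq , _) | yes p = inj₂ (inj₁ (eq , p))
    ... | inj₂ (eq , _) | no ¬p = inj₁ (inj₂ (eq , ℤP.i<j⇒i≤pred[j] (ℤP.≰⇒> ¬p)))

    len-away : away → len (u · s) ≡ suc (len u)
    len-away a = sum-map-suc positives-unique (∈-positives j>0) (abs-eq a) (λ j′∈ j′≢j → cong ℤ.∣_∣ (others _ (positive-∈ j′∈) j′≢j))
      where
      abs-eq : away → ℤ.∣ fl j (u · s) ∣ ≡ suc ℤ.∣ fl j u ∣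
      abs-eq (inj₁ (eq , p)) = trans (cong ℤ.∣_∣ (proj₂ (up eq))) (trans (abs-suc p) (cong (suc ∘ ℤ.∣_∣) (sym eq)))
      abs-eq (inj₂ (eq , p)) = trans (cong ℤ.∣_∣ (proj₂ (down eq))) (trans (abs-pred p) (cong (suc ∘ ℤ.∣_∣) (sym eq)))

    len-toward : toward → len u ≡ suc (len (u · s))
    len-toward a = sum-map-suc positives-unique (∈-positives j>0) (abs-eq a) (λ j′∈ j′≢j → cong ℤ.∣_∣ (sym (others _ (positive-∈ j′∈) j′≢j)))
      where
      abs-eq : toward → ℤ.∣ fl j u ∣ ≡ suc ℤ.∣ fl j (u · s) ∣
      abs-eq (inj₁ (eq , p)) = trans (cong ℤ.∣_∣ eq) (trans (abs-suc p) (cong (suc ∘ ℤ.∣_∣) (sym (proj₂ (down eq)))))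
      abs-eq (inj₂ (eq , p)) = trans (cong ℤ.∣_∣ eq) (trans (abs-pred p) (cong (suc ∘ ℤ.∣_∣) (sym (proj₂ (up eq)))))

    len-≤ : len (u · s) ℕ.≤ suc (len u)
    len-≤ with away⊎toward
    ... | inj₁ a = ℕP.≤-reflexive (len-away a)
    ... | inj₂ t = ℕP.≤-trans (ℕP.n≤1+n _) (ℕP.≤-trans (ℕP.≤-reflexive (sym (len-toward t))) (ℕP.n≤1+n _))

  orbit-nonint : ∀ {u} → InWa u → ∀ j z → dotℚ (root j) (act u base) ≢ toℚ z
  orbit-nonint {M , μ} inu j z eq = case signed-image inu j of λ where
    (ε , i , i>0 , im) → base-nonint i i>0 (sg ε (z ℤ.- dotℤ (root j) μ))
        (sgℚ-solve ε (dotℚ (root i) base) (dotℤ (root j) μ) z (trans (sym (dotℚ-act-img μ im base)) eq))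

  -- The point vg(base) is v applied to the point g(base) of A_f; its non-integral values of α_j lie
  -- in both strips.
  fl-Ω : ∀ {v g} → InWa v → IsΩ g → ∀ j → fl j (v · g) ≡ fl j v
  fl-Ω {v} {g} inv (ing , pres) j = fl-≡ {v · g} {v} (InWa-· {v} {g} inv ing) inv j base-InAf (proj₁ (pres base) base-InAf)
    (cong (dotℚ (root j)) (act-· v g base)) (orbit-nonint {v · g} (InWa-· {v} {g} inv ing) j)

  len-Ω : ∀ {v g} → InWa v → IsΩ g → len (v · g) ≡ len v
  len-Ω {v} {g} inv Ωg = len-cong {v · g} {v} λ {j} _ → fl-Ω {v} {g} inv Ωg j

  fl-idE : ∀ {j} → Positive j → fl j idE ≡ 0ℤ
  fl-idE {j} j>0 = trans (fl-img (V.replicate n 0ℤ) (img-id j) j>0) (trans (ℤP.+-identityʳ _) (dot-0ʳ (root j)))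

  len-idE : len idE ≡ 0
  len-idE = trans (sum-map-cong positives λ j∈ → cong ℤ.∣_∣ (fl-idE (positive-∈ j∈))) (zeros positives)
    where
    zeros : ∀ {A : Set} (xs : List A) → sum (map (λ _ → 0) xs) ≡ 0
    zeros [] = refl
    zeros (_ ∷ xs) = zeros xs

  Ω-id : IsΩ idE
  Ω-id = InW-id , λ x → subst InAf (sym (act-id x)) , subst InAf (act-id x)

  Ω-· : ∀ {g h} → IsΩ g → IsΩ h → IsΩ (g · h)
  Ω-· {g} {h} (ing , pg) (inh , ph) = InWa-· {g} {h} ing inh , λ x →
    (λ p → subst InAf (sym (act-· g h x)) (proj₁ (pg (act h x)) (proj₁ (ph x) p))) ,
    (λ p → proj₂ (ph x) (proj₂ (pg (act h x)) (subst InAf (act-· g h x) p)))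

  Ω-inverse : ∀ {g h} → IsΩ g → InWa h → g · h ≡ idE → IsΩ h
  Ω-inverse {g} {h} (ing , pg) inh gh = inh , λ x →
    (λ p → proj₂ (pg (act h x)) (subst InAf (sym (cancel x)) p)) , (λ p → subst InAf (cancel x) (proj₁ (pg (act h x)) p))
    where
    cancel : ∀ x → act g (act h x) ≡ x
    cancel x = trans (sym (act-· g h x)) (trans (cong (λ u → act u x) gh) (act-id x))

  -- The strips bound vA_f inside A_f. Conversely a positive α_i is read off from a positive α_j at
  -- vx: floor 0 leaves only α_j(vx) = α_i(x) and α_j(vx) = 1 - α_i(x), and both preserve [0,1].
  Ω-criterion : ∀ {v} → InWa v → (∀ {j} → Positive j → fl j v ≡ 0ℤ) → IsΩ v
  Ω-criterion {v@(M , μ)} inv h = inv , λ x → forward x , backward x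
    where
    forward : ∀ x → InAf x → InAf (act v x)
    forward x xA j j>0 = subst (λ z → toℚ z ℚ.≤ dotℚ (root j) (act v x) × dotℚ (root j) (act v x) ℚ.≤ toℚ (z ℤ.+ 1ℤ)) (h j>0) (fl-strip {v} inv j xA)
    backward : ∀ x → InAf (act v x) → InAf x
    backward x vxA i i>0 with InW-inverse inv
    ... | M′ , inW′ , MM′ , M′M with signed-image inW′ i
    ... | ε , j , j>0 , im′ = bounds ε (dotℤ (root j) μ) (trans (sym (fl-img μ im i>0)) (h j>0)) (subst (λ y → (ℚ.0ℚ ℚ.≤ y) × (y ℚ.≤ ℚ.1ℚ)) (dotℚ-act-img μ im x) (vxA j j>0))
      where
      im : Img M j ε i
      im = img-inverse M′M im′
      bounds : ∀ ε t {a} → t ℤ.+ off ε ≡ 0ℤ → (ℚ.0ℚ ℚ.≤ sgℚ ε a ℚ.+ toℚ t) × (sgℚ ε a ℚ.+ toℚ t ℚ.≤ ℚ.1ℚ) → (ℚ.0ℚ ℚ.≤ a) × (a ℚ.≤ ℚ.1ℚ)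
      bounds pos t {a} eq lu with trans (sym (ℤP.+-identityʳ t)) eq
      ... | refl = subst (λ y → (ℚ.0ℚ ℚ.≤ y) × (y ℚ.≤ ℚ.1ℚ)) (ℚP.+-identityʳ a) lu
      bounds neg t {a} eq (l , u) with ℤP.i-j≡0⇒i≡j t 1ℤ eq
      ... | refl = subst (ℚ.0ℚ ℚ.≤_) (ring a) (ℚP.+-monoˡ-≤ ℚ.1ℚ (ℚP.neg-antimono-≤ u)) , subst (ℚ._≤ ℚ.1ℚ) (ring a) (ℚP.+-monoˡ-≤ ℚ.1ℚ (ℚP.neg-antimono-≤ l))
        where
        open ℚSolver
        ring : ∀ a → ℚ.- (ℚ.- a ℚ.+ toℚ 1ℤ) ℚ.+ ℚ.1ℚ ≡ a
        ring = solve 1 (λ a → :- (:- a :+ con (toℚ 1ℤ)) :+ con ℚ.1ℚ := a) refl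

  IsS-InWa : ∀ {s} → IsS s → InWa s
  IsS-InWa (i , k , _ , _ , refl) = InW-reflMat i

  IsS-involutive : ∀ {s} → IsS s → s · s ≡ idE
  IsS-involutive (i , k , _ , _ , refl) = reflE-involutive i k

  -- g preserves A_f and permutes hyperplanes, so the image of the probe point of the wall of s is
  -- again a point of A_f on a single hyperplane.
  Ω-conj : ∀ {g s} → IsΩ g → IsS s → ∃[ s′ ] (IsS s′ × g · s ≡ s′ · g)
  Ω-conj {g} {s} (ing , pg) S-s with wall S-s
  ... | i , k , W = reflE j m , (j , m , j>0 , (act g x , proj₁ (pg x) x-InAf , dot-x , only) , refl) , conj
    where
    open Wall W
    open Cross {g} ing W
    only : ∀ j′ z → Positive j′ → dotℚ (root j′) (act g x) ≡ toℚ z → j′ ≡ j × z ≡ m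
    only j′ z j′>0 eq = j′≡j , toℚ-injective (trans (sym eq) (trans (cong (λ j → dotℚ (root j) (act g x)) j′≡j) dot-x))
      where
      j′≡j : j′ ≡ j
      j′≡j = int-unique j′ z j′>0 eq

  prodE-++ : ∀ ss ss′ → prodE (ss ++ ss′) ≡ prodE ss · prodE ss′
  prodE-++ [] ss′ = sym (·-idˡ (prodE ss′))
  prodE-++ (s ∷ ss) ss′ = trans (cong (s ·_) (prodE-++ ss ss′)) (sym (·-assoc s (prodE ss) (prodE ss′)))

  prodE-InWa : ∀ {ss} → All IsS ss → InWa (prodE ss)
  prodE-InWa [] = InW-id
  prodE-InWa {s ∷ ss} (h ∷ hs) = InWa-· {s} {prodE ss} (IsS-InWa h) (prodE-InWa hs)

  len-prodE : ∀ {u ss} → InWa u → All IsS ss → len (u · prodE ss) ℕ.≤ len u ℕ.+ length ss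
  len-prodE {u} {[]} inu [] = ℕP.≤-reflexive (trans (cong len (·-idʳ u)) (sym (ℕP.+-identityʳ (len u))))
  len-prodE {u} {s ∷ ss} inu (h ∷ hs) with wall h
  ... | i , k , W = begin
    len (u · (s · prodE ss))   ≡⟨ cong len (·-assoc u s (prodE ss)) ⟨
    len ((u · s) · prodE ss)   ≤⟨ len-prodE {u · s} (InWa-· {u} {s} inu (IsS-InWa h)) hs ⟩
    len (u · s) ℕ.+ length ss  ≤⟨ ℕP.+-monoˡ-≤ (length ss) (Step.len-≤ {u} inu W) ⟩
    suc (len u) ℕ.+ length ss  ≡⟨ ℕP.+-suc (len u) (length ss) ⟨
    len u ℕ.+ suc (length ss)  ∎
    where open ℕP.≤-Reasoning

  -- The count is 0 at the identity, rises by at most one per letter, and ignores the factor in Ω.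
  len-≤-factorization : ∀ {v ss g} → Factorization v ss g → len v ℕ.≤ length ss
  len-≤-factorization {v} {ss} {g} (hs , Ωg , refl) = begin
    len (prodE ss · g)     ≡⟨ len-Ω {prodE ss} {g} (prodE-InWa hs) Ωg ⟩
    len (prodE ss)         ≡⟨ cong len (·-idˡ (prodE ss)) ⟨
    len (idE · prodE ss)   ≤⟨ len-prodE {idE} InW-id hs ⟩
    len idE ℕ.+ length ss  ≡⟨ cong (ℕ._+ length ss) len-idE ⟩
    length ss              ∎
    where open ℕP.≤-Reasoning

  -- Applying v to a wall separating A_f from v⁻¹A_f gives a hyperplane separating vA_f from A_f,
  -- and this is the one crossed by multiplying v by s on the right.
  toward-inverse : ∀ {v w} (inv : InWa v) → v · w ≡ idE → ∀ {s i k} (W : Wall s i k) → Separates i k w → Step.toward {v} inv W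
  toward-inverse {M , μ} {M′ , ν} inv vw {s} {i} {k} W sep = cases ε k sep fl-w fl-u refl
    where
    open Step {M , μ} inv W
    t≡ : sg ε (dotℤ (root i) ν) ≡ ℤ.- t
    t≡ = trans (sym (onℤ im ν)) (trans (ring (dotℤ (root j) (matVec M ν)) t) (trans (cong (ℤ._- t)
      (trans (sym (Lℤ.dot-+ʳ (root j) (matVec M ν) μ)) (trans (cong (dotℤ (root j) ∘ proj₂) vw) (dot-0ʳ (root j))))) (ℤP.+-identityˡ (ℤ.- t))))
      where
      ring : ∀ a t → a ≡ (a ℤ.+ t) ℤ.- t
      ring = solve-∀
    fl-w : fl i (M′ , ν) ≡ sg ε (ℤ.- t) ℤ.+ off ε
    fl-w = trans (fl-img ν (img-inverse (cong proj₁ vw) im) j>0) (cong (ℤ._+ off ε) (trans (sym (sg-sg ε _)) (cong (sg ε) t≡)))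
    neg>0 : ∀ {t} → 0ℤ ℤ.< ℤ.- t → t ℤ.< 0ℤ
    neg>0 {t} lt = subst (ℤ._< 0ℤ) (ℤP.neg-involutive t) (ℤP.neg-mono-< lt)
    neg<0 : ∀ {t} → ℤ.- t ℤ.< 0ℤ → 0ℤ ℤ.< t
    neg<0 {t} lt = subst (0ℤ ℤ.<_) (ℤP.neg-involutive t) (ℤP.neg-mono-< lt)
    cases : ∀ {f} ε k → (k ≡ 0ℤ × f ℤ.< 0ℤ) ⊎ (k ≡ 1ℤ × 0ℤ ℤ.< f) → f ≡ sg ε (ℤ.- t) ℤ.+ off ε → fl j (M , μ) ≡ t ℤ.+ off ε →
      t ℤ.+ sg ε k ≡ m → toward
    cases pos _ (inj₁ (refl , f<0)) refl eq m≡ = inj₁ (trans eq m≡ , subst (1ℤ ℤ.≤_) (trans (sym (ℤP.+-identityʳ t)) m≡)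
      (ℤP.i<j⇒suc[i]≤j (neg<0 (subst (ℤ._< 0ℤ) (ℤP.+-identityʳ (ℤ.- t)) f<0))))
    cases neg _ (inj₁ (refl , f<0)) refl eq m≡ = inj₂ (trans eq (trans (ring t) (cong (ℤ._- 1ℤ) m≡)) , subst (ℤ._≤ 0ℤ) (trans (sym (ℤP.+-identityʳ t)) m≡)
      (subst (ℤ._≤ 0ℤ) (ring′ t) (ℤP.i<j⇒suc[i]≤j f<0)))
      where
      ring : ∀ t → t ℤ.+ ℤ.- 1ℤ ≡ t ℤ.+ 0ℤ ℤ.- 1ℤ
      ring = solve-∀
      ring′ : ∀ t → 1ℤ ℤ.+ (ℤ.- (ℤ.- t) ℤ.+ ℤ.- 1ℤ) ≡ t
      ring′ = solve-∀
    cases pos _ (inj₂ (refl , f>0)) refl eq m≡ = inj₂ (trans eq (trans (ring t) (cong (ℤ._- 1ℤ) m≡)) , subst (ℤ._≤ 0ℤ) (trans (ℤP.+-comm 1ℤ t) m≡)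
      (ℤP.i<j⇒suc[i]≤j (neg>0 (subst (0ℤ ℤ.<_) (ℤP.+-identityʳ (ℤ.- t)) f>0))))
      where
      ring : ∀ t → t ℤ.+ 0ℤ ≡ t ℤ.+ 1ℤ ℤ.- 1ℤ
      ring = solve-∀
    cases neg _ (inj₂ (refl , f>0)) refl eq m≡ = inj₁ (trans eq m≡ , subst (1ℤ ℤ.≤_) m≡ (subst (1ℤ ℤ.≤_) (ring t) (ℤP.i<j⇒suc[i]≤j f>0)))
      where
      ring : ∀ t → ℤ.- (ℤ.- t) ℤ.+ ℤ.- 1ℤ ≡ t ℤ.+ ℤ.- 1ℤ
      ring = solve-∀

  -- There are finitely many positive roots, so it is decidable whether v⁻¹ has only zero floors. If
  -- so it lies in Ω; otherwise a nonzero floor provides a separating wall of A_f.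
  descent : ∀ {v} → InWa v → IsΩ v ⊎ ∃[ s ] (IsS s × len v ≡ suc (len (v · s)))
  descent {v} inv with inverse {v} inv
  ... | w , inw , vw , wv = decide (All.all? (λ i → fl i w ℤ.≟ 0ℤ) positives)
    where
    decide : Dec (All (λ i → fl i w ≡ 0ℤ) positives) → IsΩ v ⊎ ∃[ s ] (IsS s × len v ≡ suc (len (v · s)))
    decide (yes all0) = inj₁ (Ω-inverse {w} {v} (Ω-criterion {w} inw (λ i>0 → All.lookup all0 (∈-positives i>0))) inv wv)
    decide (no ¬all0) = found (AllP.¬All⇒Any¬ (λ i → fl i w ℤ.≟ 0ℤ) positives ¬all0)
      where
      conclude : ∃[ i ] ∃[ k ] (Wall (reflE i k) i k × Separates i k w) → ∃[ s ] (IsS s × len v ≡ suc (len (v · s)))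
      conclude (i , k , W , sep) = reflE i k , Wall⇒IsS W , Step.len-toward {v} inv W (toward-inverse {v} {w} inv vw W sep)
      found : Any (λ i → ¬ fl i w ≡ 0ℤ) positives → IsΩ v ⊎ ∃[ s ] (IsS s × len v ≡ suc (len (v · s)))
      found any = inj₂ (let (i₀ , i₀∈ , fl≢0) = find any in conclude (separating-wall {w} inw (positive-∈ i₀∈) fl≢0))

-- Weighted factorizations, deletion, and minimal galleries

module Factor (D : RootDatum) (d : Geometry.Elt D → ℕ) (d-conj : Geometry.ConjInvariant D d) where
  open Length D public

  weight : List Elt → ℕ
  weight ss = sum (map d ss)

  -- Length and d-weight travel together, so that every construction on words serves both the
  -- Coxeter length and q_v.
  record FactorsAs (v : Elt) (l q : ℕ) : Set where
    constructor factors
    field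
      word     : List Elt
      last     : Elt
      isFact   : Factorization v word last
      length≡  : length word ≡ l
      weight≡  : weight word ≡ q

  weight-++ : ∀ ss ss′ → weight (ss ++ ss′) ≡ weight ss ℕ.+ weight ss′
  weight-++ ss ss′ = trans (cong sum (LP.map-++ d ss ss′)) (SumP.sum-++ (map d ss) (map d ss′))

  -- Conjugation by g permutes S^a, and d is constant on conjugates, so neither the length nor the
  -- weight changes.
  Ω-commute : ∀ {g ss} → IsΩ g → All IsS ss →
    ∃[ ss′ ] (All IsS ss′ × g · prodE ss ≡ prodE ss′ · g × length ss′ ≡ length ss × weight ss′ ≡ weight ss)
  Ω-commute {g} Ωg [] = [] , [] , trans (·-idʳ g) (sym (·-idˡ g)) , refl , refl
  Ω-commute {g} {s ∷ ss} Ωg (h ∷ hs) =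
    let (s′ , h′ , eq) = Ω-conj {g} {s} Ωg h
        (ss′ , hs′ , eqs , leq , weq) = Ω-commute {g} {ss} Ωg hs
    in s′ ∷ ss′ , h′ ∷ hs′ , move s′ ss′ eq eqs , cong suc leq , cong₂ ℕ._+_ (sym (d-conj s s′ g h h′ (proj₁ Ωg) eq)) weq
    where
    move : ∀ s′ ss′ → g · s ≡ s′ · g → g · prodE ss ≡ prodE ss′ · g → g · (s · prodE ss) ≡ (s′ · prodE ss′) · g
    move s′ ss′ eq eqs = begin
      g · (s · prodE ss)    ≡⟨ ·-assoc g s (prodE ss) ⟨
      (g · s) · prodE ss    ≡⟨ cong (_· prodE ss) eq ⟩
      (s′ · g) · prodE ss   ≡⟨ ·-assoc s′ g (prodE ss) ⟩
      s′ · (g · prodE ss)   ≡⟨ cong (s′ ·_) eqs ⟩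
      s′ · (prodE ss′ · g)  ≡⟨ ·-assoc s′ (prodE ss′) g ⟨
      (s′ · prodE ss′) · g  ∎
      where open ≡-Reasoning

  factors-· : ∀ {v w l q l′ q′} → FactorsAs v l q → FactorsAs w l′ q′ → FactorsAs (v · w) (l ℕ.+ l′) (q ℕ.+ q′)
  factors-· {v} {w} (factors ss g (hs , Ωg , veq) leq₁ weq₁) (factors ss′ g′ (hs′ , Ωg′ , weq) leq₂ weq₂) =
    let (ss″ , hs″ , eq , leq , weq′) = Ω-commute {g} {ss′} Ωg hs′
    in factors (ss ++ ss″) (g · g′) (AllP.++⁺ hs hs″ , Ω-· {g} {g′} Ωg Ωg′ , trans (cong₂ _·_ veq weq) (move ss″ eq))
      (trans (LP.length-++ ss) (cong₂ ℕ._+_ leq₁ (trans leq leq₂))) (trans (weight-++ ss ss″) (cong₂ ℕ._+_ weq₁ (trans weq′ weq₂)))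
    where
    move : ∀ ss″ → g · prodE ss′ ≡ prodE ss″ · g → (prodE ss · g) · (prodE ss′ · g′) ≡ prodE (ss ++ ss″) · (g · g′)
    move ss″ eq = begin
      (prodE ss · g) · (prodE ss′ · g′)  ≡⟨ ·-assoc (prodE ss) g (prodE ss′ · g′) ⟩
      prodE ss · (g · (prodE ss′ · g′))  ≡⟨ cong (prodE ss ·_) (·-assoc g (prodE ss′) g′) ⟨
      prodE ss · ((g · prodE ss′) · g′)  ≡⟨ cong (λ z → prodE ss · (z · g′)) eq ⟩
      prodE ss · ((prodE ss″ · g) · g′)  ≡⟨ cong (prodE ss ·_) (·-assoc (prodE ss″) g g′) ⟩
      prodE ss · (prodE ss″ · (g · g′))  ≡⟨ ·-assoc (prodE ss) (prodE ss″) (g · g′) ⟨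
      (prodE ss · prodE ss″) · (g · g′)  ≡⟨ cong (_· (g · g′)) (prodE-++ ss ss″) ⟨
      prodE (ss ++ ss″) · (g · g′)       ∎
      where open ≡-Reasoning

  factors-S : ∀ {s} → IsS s → FactorsAs s 1 (d s)
  factors-S {s} h = factors (s ∷ []) idE (h ∷ [] , Ω-id , sym (trans (·-idʳ (s · idE)) (·-idʳ s))) refl (ℕP.+-identityʳ (d s))

  factors-Ω : ∀ {g} → IsΩ g → FactorsAs g 0 0
  factors-Ω {g} h = factors [] g ([] , h , sym (·-idˡ g)) refl refl

  factors-cong : ∀ {v w l q l′ q′} → v ≡ w → l ≡ l′ → q ≡ q′ → FactorsAs v l q → FactorsAs w l′ q′
  factors-cong refl refl refl F = F

  ·-cancel-involution : ∀ v {s} → s · s ≡ idE → (v · s) · s ≡ v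
  ·-cancel-involution v {s} ss = trans (·-assoc v s s) (trans (cong (v ·_) ss) (·-idʳ v))

  reduced-factorization : ∀ {v} → InWa v → ∃[ q ] FactorsAs v (len v) q
  reduced-factorization {v} inv = go (len v) inv refl
    where
    go : ∀ l {v} → InWa v → len v ≡ l → ∃[ q ] FactorsAs v l q
    go l {v} inv eq with descent {v} inv
    go zero    {v} inv eq | inj₁ Ωv = 0 , factors-Ω Ωv
    go (suc l) {v} inv eq | inj₁ Ωv = ⊥-elim (ℕP.1+n≢0 (trans (sym eq) (trans (cong len (sym (·-idˡ v))) (trans (len-Ω {idE} {v} InW-id Ωv) len-idE))))
    go zero    {v} inv eq | inj₂ (s , h , eq′) = ⊥-elim (ℕP.1+n≢0 (trans (sym eq′) eq))
    go (suc l) {v} inv eq | inj₂ (s , h , eq′) with go l {v · s} (InWa-· {v} {s} inv (IsS-InWa h)) (ℕP.suc-injective (trans (sym eq′) eq))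
    ... | q , F = q ℕ.+ d s , factors-cong (·-cancel-involution v (IsS-involutive h)) (ℕP.+-comm l 1) refl (factors-· F (factors-S h))

  -- Successive descents give a word with `len v` letters; `len-≤-factorization` says that none is
  -- shorter.
  isLength : ∀ {v} → InWa v → IsLength v (len v)
  isLength {v} inv =
    let (q , F) = reduced-factorization {v} inv
    in (FactorsAs.word F , FactorsAs.last F , FactorsAs.isFact F , FactorsAs.length≡ F) , λ ss g f → len-≤-factorization {v} {ss} {g} f

  factors-inverse : ∀ {v v′ l q} → FactorsAs v l q → InWa v′ → v · v′ ≡ idE → v′ · v ≡ idE → FactorsAs v′ l q
  factors-inverse {v} {v′} (factors ss g (hs , Ωg , eq) leq weq) inv′ vv′ v′v =
    factors-cong refl leq weq (go ss {g} {v′} hs Ωg inv′ (trans (cong (_· v′) (sym eq)) vv′) (trans (cong (v′ ·_) (sym eq)) v′v))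
    where
    go : ∀ ss {g v′} → All IsS ss → IsΩ g → InWa v′ → (prodE ss · g) · v′ ≡ idE → v′ · (prodE ss · g) ≡ idE → FactorsAs v′ (length ss) (weight ss)
    go [] {g} {v′} [] Ωg inv′ vv′ v′v = factors-Ω (Ω-inverse {g} {v′} Ωg inv′ (trans (cong (_· v′) (sym (·-idˡ g))) vv′))
    go (s ∷ ss) {g} {v′} (h ∷ hs) Ωg inv′ vv′ v′v = factors-cong (·-cancel-involution v′ (IsS-involutive h)) (ℕP.+-comm (length ss) 1) (ℕP.+-comm (weight ss) (d s))
      (factors-· (go ss {g} {v′ · s} hs Ωg (InWa-· {v′} {s} inv′ (IsS-InWa h)) right left) (factors-S h))
      where
      open ≡-Reasoning
      w = prodE ss · g
      sw : s · w ≡ (s · prodE ss) · g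
      sw = sym (·-assoc s (prodE ss) g)
      w≡ : w ≡ s · ((s · prodE ss) · g)
      w≡ = begin
        w                ≡⟨ ·-idˡ w ⟨
        idE · w      ≡⟨ cong (_· w) (IsS-involutive h) ⟨
        (s · s) · w  ≡⟨ ·-assoc s s w ⟩
        s · (s · w)  ≡⟨ cong (s ·_) sw ⟩
        s · ((s · prodE ss) · g) ∎
      right : w · (v′ · s) ≡ idE
      right = begin
        w · (v′ · s)  ≡⟨ cong (_· (v′ · s)) w≡ ⟩
        (s · ((s · prodE ss) · g)) · (v′ · s)  ≡⟨ ·-assoc s _ (v′ · s) ⟩
        s · (((s · prodE ss) · g) · (v′ · s))  ≡⟨ cong (s ·_) (·-assoc ((s · prodE ss) · g) v′ s) ⟨
        s · ((((s · prodE ss) · g) · v′) · s)  ≡⟨ cong (λ z → s · (z · s)) vv′ ⟩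
        s · (idE · s)  ≡⟨ cong (s ·_) (·-idˡ s) ⟩
        s · s  ≡⟨ IsS-involutive h ⟩
        idE  ∎
      left : (v′ · s) · w ≡ idE
      left = begin
        (v′ · s) · w               ≡⟨ ·-assoc v′ s w ⟩
        v′ · (s · w)               ≡⟨ cong (v′ ·_) sw ⟩
        v′ · ((s · prodE ss) · g)  ≡⟨ v′v ⟩
        idE                        ∎

  len-inverse : ∀ {v v′} → InWa v → InWa v′ → v · v′ ≡ idE → v′ · v ≡ idE → len v′ ≡ len v
  len-inverse {v} {v′} inv inv′ vv′ v′v = ℕP.≤-antisym (half {v} {v′} inv inv′ vv′ v′v) (half {v′} {v} inv′ inv v′v vv′)
    where
    half : ∀ {v v′} → InWa v → InWa v′ → v · v′ ≡ idE → v′ · v ≡ idE → len v′ ℕ.≤ len v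
    half {v} {v′} inv inv′ vv′ v′v = subst (len v′ ℕ.≤_) length≡ (len-≤-factorization {v′} {word} {last} isFact)
      where open FactorsAs (factors-inverse {v} {v′} (proj₂ (reduced-factorization {v} inv)) inv′ vv′ v′v)

  prodL : List Letter → Elt
  prodL ts = prodE (map eltOf ts)

  letter-InWa : ∀ {l} → ValidLetter l → InWa (eltOf l)
  letter-InWa {S s} h = IsS-InWa h
  letter-InWa {O g} h = proj₁ h

  prodL-InWa : ∀ {ts} → ValidType ts → InWa (prodL ts)
  prodL-InWa [] = InW-id
  prodL-InWa {l ∷ ts} (h ∷ hs) = InWa-· {eltOf l} {prodL ts} (letter-InWa {l} h) (prodL-InWa hs)

  -- The side of H_{α_j,m} on which vA_f lies. Being Boolean, it can be compared step by step along
  -- a word.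
  beyond : Fin r → ℤ → Elt → Bool
  beyond j m v = does (m ℤ.≤? fl j v)

  beyond-cong : ∀ {j m u v} → fl j u ≡ fl j v → beyond j m u ≡ beyond j m v
  beyond-cong {m = m} {u} {v} eq = cong (λ f → does (m ℤ.≤? f)) eq

  m-1<m : ∀ m → m ℤ.- 1ℤ ℤ.< m
  m-1<m m = 0<j-i⇒i<j (subst (0ℤ ℤ.<_) (ring m) 0<+suc)
    where
    ring : ∀ m → 1ℤ ≡ m ℤ.- (m ℤ.- 1ℤ)
    ring = solve-∀

  beyond-true : ∀ {j m v} → fl j v ≡ m → beyond j m v ≡ true
  beyond-true {m = m} refl = dec-true (m ℤ.≤? m) ℤP.≤-refl

  beyond-false : ∀ {j m v} → fl j v ≡ m ℤ.- 1ℤ → beyond j m v ≡ false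
  beyond-false {j} {m} {v} eq = dec-false (m ℤ.≤? fl j v) (ℤP.<⇒≱ (subst (ℤ._< m) (sym eq) (m-1<m m)))

  adjacent-levels : ∀ {m m′} → does (m ℤ.≤? m′) ≢ does (m ℤ.≤? (m′ ℤ.- 1ℤ)) → m ≡ m′
  adjacent-levels {m} {m′} ne with m ℤ.≤? m′ | m ℤ.≤? (m′ ℤ.- 1ℤ)
  ... | yes p | yes q = ⊥-elim (ne refl)
  ... | no ¬p | no ¬q = ⊥-elim (ne refl)
  ... | no ¬p | yes q = ⊥-elim (¬p (ℤP.≤-trans q (ℤP.<⇒≤ (m-1<m m′))))
  ... | yes p | no ¬q = ℤP.≤-antisym p (ℤP.≮⇒≥ λ m<m′ → ¬q (subst (m ℤ.≤_) (ℤP.+-comm (ℤ.- 1ℤ) m′) (ℤP.i<j⇒i≤pred[j] m<m′)))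

  -- Only the floor of one root changes, and only between m′ - 1 and m′ for the hyperplane actually
  -- crossed; a change of side with respect to H_{α_j,m} identifies it as that hyperplane.
  crossed-wall : ∀ {v} (inv : InWa v) {s i k} (W : Wall s i k) {j m} → Positive j → beyond j m v ≢ beyond j m (v · s) → v · s ≡ reflE j m · v
  crossed-wall {v} inv {s} W {j} {m} j>0 ne = subst₂ (λ j m → v · s ≡ reflE j m · v) (sym j≡) (sym m≡) X.conj
    where
    module X = Cross {v} inv W
    j≡ : j ≡ X.j
    j≡ = case j FinP.≟ X.j of λ where
      (yes p) → p
      (no ¬p) → ⊥-elim (ne (beyond-cong {j} {m} {v} {v · s} (sym (X.others j j>0 ¬p))))
    ne′ : does (m ℤ.≤? fl X.j v) ≢ does (m ℤ.≤? fl X.j (v · s))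
    ne′ = subst (λ j → beyond j m v ≢ beyond j m (v · s)) j≡ ne
    levels : ∀ {a b} → (a ≡ X.m ℤ.- 1ℤ × b ≡ X.m) ⊎ (a ≡ X.m × b ≡ X.m ℤ.- 1ℤ) → does (m ℤ.≤? a) ≢ does (m ℤ.≤? b) → m ≡ X.m
    levels (inj₁ (refl , refl)) ne = adjacent-levels (ne ∘ sym)
    levels (inj₂ (refl , refl)) ne = adjacent-levels ne
    m≡ : m ≡ X.m
    m≡ = levels X.direction ne′

  -- Somewhere on the walk from v along `ts` the side of H_{α_j,m} changes. At the first change,
  -- from v′ to v′l, the reflection in that hyperplane maps v′ to v′l; omitting l therefore reflects
  -- the rest of the walk.
  deletion : ∀ {ts} → ValidType ts → ∀ {v} → InWa v → ∀ {j m} → Positive j → beyond j m v ≢ beyond j m (v · prodL ts) →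
    ∃[ ts′ ] (ValidType ts′ × length ts ≡ suc (length ts′) × v · prodL ts′ ≡ reflE j m · (v · prodL ts))
  deletion [] {v} inv {j} {m} j>0 ne = ⊥-elim (ne (cong (beyond j m) (sym (·-idʳ v))))
  deletion {l ∷ ts} (h ∷ hs) {v} inv {j} {m} j>0 ne = split (beyond j m v BoolP.≟ beyond j m (v · eltOf l))
    where
    assoc : (v · eltOf l) · prodL ts ≡ v · (eltOf l · prodL ts)
    assoc = ·-assoc v (eltOf l) (prodL ts)
    invl : InWa (v · eltOf l)
    invl = InWa-· {v} {eltOf l} inv (letter-InWa {l} h)
    delete : ∀ {l} → ValidLetter l → beyond j m v ≢ beyond j m (v · eltOf l) → v · eltOf l ≡ reflE j m · v
    delete {S s} h ne′ = let (i , k , W) = wall h in crossed-wall {v} inv W {j} {m} j>0 ne′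
    delete {O g} h ne′ = ⊥-elim (ne′ (beyond-cong {j} {m} {v} {v · g} (sym (fl-Ω {v} {g} inv h j))))
    split : Dec (beyond j m v ≡ beyond j m (v · eltOf l)) →
      ∃[ ts′ ] (ValidType ts′ × suc (length ts) ≡ suc (length ts′) × v · prodL ts′ ≡ reflE j m · (v · (eltOf l · prodL ts)))
    split (yes same) =
      let (ts′ , hs′ , leq , eq) = deletion hs {v · eltOf l} invl {j} {m} j>0 (λ eq → ne (trans same (trans eq (cong (beyond j m) assoc))))
      in l ∷ ts′ , h ∷ hs′ , cong suc leq
        , trans (sym (·-assoc v (eltOf l) (prodL ts′))) (trans eq (cong (reflE j m ·_) assoc))
    split (no ne′) = ts , hs , refl , sym (begin
      reflE j m · (v · (eltOf l · prodL ts))    ≡⟨ cong (reflE j m ·_) assoc ⟨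
      reflE j m · ((v · eltOf l) · prodL ts)    ≡⟨ cong (λ z → reflE j m · (z · prodL ts)) (delete {l} h ne′) ⟩
      reflE j m · ((reflE j m · v) · prodL ts)  ≡⟨ cong (reflE j m ·_) (·-assoc (reflE j m) v (prodL ts)) ⟩
      reflE j m · (reflE j m · (v · prodL ts))  ≡⟨ ·-assoc (reflE j m) (reflE j m) (v · prodL ts) ⟨
      (reflE j m · reflE j m) · (v · prodL ts)  ≡⟨ cong (_· (v · prodL ts)) (reflE-involutive j m) ⟩
      idE · (v · prodL ts)                      ≡⟨ ·-idˡ (v · prodL ts) ⟩
      v · prodL ts                              ∎)
      where open ≡-Reasoning

  -- A fold leaves the alcove in place, so removing it gives a shorter gallery between the same
  -- ends; without folds the end is the product of the letters.
  gallery-end : ∀ {u t B} → Gallery u t B → ValidType t →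
    (B ≡ u · prodL t) ⊎ ∃[ t′ ] (ValidType t′ × length t′ ℕ.< length t × Gallery u t′ B)
  gallery-end {u} nil _ = inj₁ (sym (·-idʳ u))
  gallery-end (fold s σ) (h ∷ hs) = inj₂ (_ , hs , ℕP.n<1+n _ , σ)
  gallery-end {u} (cross {ts = ts} l σ) (h ∷ hs) = case gallery-end σ hs of λ where
    (inj₁ eq) → inj₁ (trans eq (·-assoc u (eltOf l) (prodL ts)))
    (inj₂ (t′ , hs′ , lt , σ′)) → inj₂ (l ∷ t′ , h ∷ hs′ , ℕ.s≤s lt , cross l σ′)

  straight : ∀ u t → Gallery u t (u · prodL t)
  straight u [] = subst (Gallery u []) (sym (·-idʳ u)) nil
  straight u (l ∷ t) = cross l (subst (Gallery (u · eltOf l) t) (·-assoc u (eltOf l) (prodL t)) (straight (u · eltOf l) t))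

  minimal-end : ∀ {t v} → MinimalType t v → v ≡ prodL t
  minimal-end {t} (valid , σ , minimal) = case gallery-end σ valid of λ where
    (inj₁ eq) → trans eq (·-idˡ (prodL t))
    (inj₂ (t′ , valid′ , lt , σ′)) → ⊥-elim (ℕP.<⇒≱ lt (minimal t′ valid′ σ′))

  minimal-≤ : ∀ {t v} → MinimalType t v → ∀ t′ → ValidType t′ → prodL t′ ≡ prodL t → length t ℕ.≤ length t′
  minimal-≤ {t} M@(valid , σ , minimal) t′ valid′ eq =
    minimal t′ valid′ (subst (Gallery idE t′) (trans (·-idˡ (prodL t′)) (trans eq (sym (minimal-end M)))) (straight idE t′))

  prodL-++ : ∀ ts ts′ → prodL (ts ++ ts′) ≡ prodL ts · prodL ts′
  prodL-++ ts ts′ = trans (cong prodE (LP.map-++ eltOf ts ts′)) (prodE-++ (map eltOf ts) (map eltOf ts′))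

  -- If s led back towards A_f, the hyperplane it crosses would already separate A_f from the end of
  -- `pre`. Deleting a letter of `pre` then yields the product of `pre` and s, and the whole type
  -- gets shorter by two.
  minimal-len : ∀ {v} pre {s} rest → MinimalType (pre ++ S s ∷ rest) v → len (prodL pre · s) ≡ suc (len (prodL pre))
  minimal-len {v} pre {s} rest M@(valid , _) = conclude (wall h)
    where
    validpre : ValidType pre
    validpre = AllP.++⁻ˡ pre valid
    h : IsS s
    h = All.head (AllP.++⁻ʳ pre valid)
    validrest : ValidType rest
    validrest = All.tail (AllP.++⁻ʳ pre valid)
    u = prodL pre
    inu : InWa u
    inu = prodL-InWa validpre
    conclude : ∃[ i ] ∃[ k ] Wall s i k → len (u · s) ≡ suc (len u)
    conclude (i , k , W) = split away⊎toward
      where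
      open Step {u} inu W
      open ≡-Reasoning
      absurd : beyond j m idE ≢ beyond j m u → len (u · s) ≡ suc (len u)
      absurd ne = ⊥-elim (ℕP.<⇒≱ shorter (minimal-≤ M (ts′ ++ rest) (AllP.++⁺ valid′ validrest) same))
        where
        deleted : ∃[ ts′ ] (ValidType ts′ × length pre ≡ suc (length ts′) × idE · prodL ts′ ≡ reflE j m · (idE · u))
        deleted = deletion validpre {idE} InW-id {j} {m} j>0 (λ eq → ne (trans eq (cong (beyond j m) (·-idˡ u))))
        ts′ = proj₁ deleted
        valid′ = proj₁ (proj₂ deleted)
        leq = proj₁ (proj₂ (proj₂ deleted))
        eq = proj₂ (proj₂ (proj₂ deleted))
        shorter : length (ts′ ++ rest) ℕ.< length (pre ++ S s ∷ rest)
        shorter = subst₂ ℕ._<_ (sym (LP.length-++ ts′)) (sym (LP.length-++ pre))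
          (ℕP.+-mono-<-≤ (subst (length ts′ ℕ.<_) (sym leq) (ℕP.n<1+n _)) (ℕP.n≤1+n _))
        same : prodL (ts′ ++ rest) ≡ prodL (pre ++ S s ∷ rest)
        same = begin
          prodL (ts′ ++ rest)           ≡⟨ prodL-++ ts′ rest ⟩
          prodL ts′ · prodL rest        ≡⟨ cong (_· prodL rest) (trans (sym (·-idˡ (prodL ts′))) (trans eq (cong (reflE j m ·_) (·-idˡ u)))) ⟩
          (reflE j m · u) · prodL rest  ≡⟨ cong (_· prodL rest) conj ⟨
          (u · s) · prodL rest          ≡⟨ ·-assoc u s (prodL rest) ⟩
          u · (s · prodL rest)          ≡⟨ prodL-++ pre (S s ∷ rest) ⟨
          prodL (pre ++ S s ∷ rest)     ∎
      split : away ⊎ toward → len (u · s) ≡ suc (len u)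
      split (inj₁ a) = len-away a
      split (inj₂ (inj₁ (eq , 1≤m))) = absurd λ same → case trans (sym (beyond-true {j} {m} {u} eq)) (trans (sym same) (not-beyond)) of λ ()
        where
        not-beyond : beyond j m idE ≡ false
        not-beyond = dec-false (m ℤ.≤? fl j idE) λ le → ℤP.<⇒≱ 0<+suc (ℤP.≤-trans 1≤m (subst (m ℤ.≤_) (fl-idE j>0) le))
      split (inj₂ (inj₂ (eq , m≤0))) = absurd λ same → case trans (sym (beyond-false {j} {m} {u} eq)) (trans (sym same) is-beyond) of λ ()
        where
        is-beyond : beyond j m idE ≡ true
        is-beyond = dec-true (m ℤ.≤? fl j idE) (subst (m ℤ.≤_) (sym (fl-idE j>0)) m≤0)

-- Lengths after translation into the dominant chamber

sum-map-+ : ∀ {A : Set} {f g h : A → ℕ} (xs : List A) → (∀ {x} → x ∈ xs → h x ≡ f x ℕ.+ g x) → sum (map h xs) ≡ sum (map f xs) ℕ.+ sum (map g xs)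
sum-map-+ [] eq = refl
sum-map-+ {f = f} {g} {h} (x ∷ xs) eq = trans (cong₂ ℕ._+_ (eq (here refl)) (sum-map-+ xs (eq ∘ there))) (interchange (f x) (g x) (sum (map f xs)) (sum (map g xs)))
  where
  open import Algebra.Properties.CommutativeSemigroup ℕP.+-commutativeSemigroup using (interchange)

abs-+ : ∀ {a b} → 0ℤ ℤ.≤ a → 0ℤ ℤ.≤ b → ℤ.∣ a ℤ.+ b ∣ ≡ ℤ.∣ a ∣ ℕ.+ ℤ.∣ b ∣
abs-+ {+ a} {+ b} _ _ = refl

module Dominance (D : RootDatum) (d : Geometry.Elt D → ℕ) (d-conj : Geometry.ConjInvariant D d) where
  open Factor D d d-conj public

  -- Pairings of at least 1 absorb the possible offset -1, so every floor of (M, ν) at a positive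
  -- root is nonnegative whatever M in W is.
  Deep : Vec ℤ n → Set
  Deep ν = ∀ i → Positive i → 1ℤ ℤ.≤ dotℤ (root i) ν

  Deep⇒Dominant : ∀ {ν} → Deep ν → Dominant ν
  Deep⇒Dominant deep i i>0 = ℤP.≤-trans (ℤ.+≤+ ℕ.z≤n) (deep i i>0)

  multiple-dominant : ∀ K → Dominant (scaleℤ (+ K) ρ)
  multiple-dominant K i i>0 = subst (0ℤ ℤ.≤_) (sym (Lℤ.dot-scaleʳ (+ K) (root i) ρ)) (nonNeg-* {+ K} (ℤ.+≤+ ℕ.z≤n) (ℤP.<⇒≤ i>0))

  -- |⟨α_i,μ⟩| < K and ⟨α_i,ρ⟩ ≥ 1 give ⟨α_i, μ + Kρ⟩ ≥ 1.
  multiple-deep : ∀ μ K → maxFin (λ i → ℤ.∣ dotℤ (root i) μ ∣) ℕ.< K → Deep (μ +ᵛ scaleℤ (+ K) ρ)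
  multiple-deep μ K max<K i i>0 = subst (1ℤ ℤ.≤_) (sym (trans (Lℤ.dot-+ʳ (root i) μ (scaleℤ (+ K) ρ)) (cong (λ z → dotℤ (root i) μ ℤ.+ z) (Lℤ.dot-scaleʳ (+ K) (root i) ρ))))
    (bound (dotℤ (root i) μ) (dotℤ (root i) ρ) (ℕP.≤-<-trans (≤-maxFin (λ i → ℤ.∣ dotℤ (root i) μ ∣) i) max<K) i>0)
    where
    bound : ∀ a b → ℤ.∣ a ∣ ℕ.< K → 0ℤ ℤ.< b → 1ℤ ℤ.≤ a ℤ.+ (+ K) ℤ.* b
    bound a (+ suc b) a<K _ = ℤP.≤-trans (lemma a a<K) (ℤP.+-monoʳ-≤ a (subst (+ K ℤ.≤_) (ℤP.pos-* K (suc b)) (ℤ.+≤+ (ℕP.m≤m*n K (suc b)))))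
      where
      lemma : ∀ a → ℤ.∣ a ∣ ℕ.< K → 1ℤ ℤ.≤ a ℤ.+ (+ K)
      lemma (+ a) lt = ℤ.+≤+ (ℕP.≤-trans (ℕP.≤-trans (ℕ.s≤s ℕ.z≤n) lt) (ℕP.m≤n+m K a))
      lemma -[1+ a ] lt = subst (ℤ._≤ -[1+ a ] ℤ.+ (+ K)) (ring a) (ℤP.+-monoʳ-≤ -[1+ a ] (ℤ.+≤+ lt))
        where
        ring : ∀ a → -[1+ a ] ℤ.+ (+ suc (suc a)) ≡ 1ℤ
        ring a = trans (cong (λ z → z ℤ.+ (+ suc (suc a))) (ℤP.neg-suc a)) (help (+ a))
          where
          help : ∀ a → (ℤ.- 1ℤ ℤ.+ ℤ.- a) ℤ.+ (1ℤ ℤ.+ (1ℤ ℤ.+ a)) ≡ 1ℤ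
          help = solve-∀
    bound a (+ 0) _ (ℤ.+<+ ())

  shift : Vec ℤ n → Elt → Elt
  shift λ′ (M , μ) = M , μ +ᵛ λ′

  fl-shift : ∀ λ′ j u → fl j (shift λ′ u) ≡ fl j u ℤ.+ dotℤ (root j) λ′
  fl-shift λ′ j (M , μ) = trans (cong (ℤ._+ floorSgn (dotℤ (root j) (matVec M ρ))) (Lℤ.dot-+ʳ (root j) μ λ′))
    (ring (dotℤ (root j) μ) (dotℤ (root j) λ′) (floorSgn (dotℤ (root j) (matVec M ρ))))
    where
    ring : ∀ a b c → (a ℤ.+ b) ℤ.+ c ≡ (a ℤ.+ c) ℤ.+ b
    ring = solve-∀

  shift-· : ∀ λ′ u v → shift λ′ (u · v) ≡ shift λ′ u · v
  shift-· λ′ (M , μ) (M′ , μ′) = cong (matMul M M′ ,_) (VP.zipWith-assoc ℤP.+-assoc (matVec M μ′) μ λ′)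

  fl-deep : ∀ {M ν} → InW M → Deep ν → ∀ {j} → Positive j → 0ℤ ℤ.≤ fl j (M , ν)
  fl-deep {M} {ν} inW deep {j} j>0 =
    let (ε , i , i>0 , im) = signed-image inW j
    in subst (0ℤ ℤ.≤_) (sym (fl-img ν im i>0)) (ℤP.+-mono-≤ {1ℤ} {dotℤ (root j) ν} {ℤ.- 1ℤ} (deep j j>0) (off≥-1 ε))
    where
    off≥-1 : ∀ ε → ℤ.- 1ℤ ℤ.≤ off ε
    off≥-1 pos = ℤ.-≤+
    off≥-1 neg = ℤP.≤-refl

  len-up : ∀ {u s i k} (inu : InWa u) (W : Wall s i k) → ∀ λ′ → Deep (proj₂ u +ᵛ λ′) → Cross.Up {u} inu W →
    len (shift λ′ u · s) ≡ suc (len (shift λ′ u))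
  len-up {u} {s} {k = k} inu W λ′ deep (eq , _) = len-away (inj₁ (fl≡ , subst (1ℤ ℤ.≤_) (ring m) (ℤP.+-monoʳ-≤ 1ℤ (subst (0ℤ ℤ.≤_) fl≡ (fl-deep {proj₁ u} inu deep j>0)))))
    where
    open Step {shift λ′ u} inu W
    ring : ∀ m → 1ℤ ℤ.+ (m ℤ.- 1ℤ) ≡ m
    ring = solve-∀
    fl≡ : fl j (shift λ′ u) ≡ m ℤ.- 1ℤ
    fl≡ = trans (fl-shift λ′ j u) (trans (cong (ℤ._+ dotℤ (root j) λ′) eq) (trans (ring′ (dotℤ (root j) (proj₂ u)) (dotℤ (root j) λ′) (sg ε k))
      (cong (λ z → z ℤ.+ sg ε k ℤ.- 1ℤ) (sym (Lℤ.dot-+ʳ (root j) (proj₂ u) λ′)))))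
      where
      ring′ : ∀ a b c → (a ℤ.+ c ℤ.- 1ℤ) ℤ.+ b ≡ (a ℤ.+ b) ℤ.+ c ℤ.- 1ℤ
      ring′ = solve-∀

  -- Depth is asked of the lower end us: its floor m - 1 ≥ 0 gives m ≥ 1, so that going down leads
  -- towards A_f.
  len-down : ∀ {u s i k} (inu : InWa u) (W : Wall s i k) → ∀ λ′ → Deep (proj₂ (u · s) +ᵛ λ′) → Cross.Down {u} inu W →
    len (shift λ′ u) ≡ suc (len (shift λ′ u · s))
  len-down {u} {s} {k = k} inu W λ′ deep (eq , _) = len-toward (inj₁ (fl≡ , subst (1ℤ ℤ.≤_) (ring m) (ℤP.+-monoʳ-≤ 1ℤ
      (subst (0ℤ ℤ.≤_) (trans (cong (fl j) (shift-· λ′ u s)) (proj₂ (down fl≡))) (fl-deep {proj₁ (u · s)} inus deep j>0)))))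
    where
    open Step {shift λ′ u} inu W
    ring : ∀ m → 1ℤ ℤ.+ (m ℤ.- 1ℤ) ≡ m
    ring = solve-∀
    fl≡ : fl j (shift λ′ u) ≡ m
    fl≡ = trans (fl-shift λ′ j u) (trans (cong (ℤ._+ dotℤ (root j) λ′) eq) (trans (ring′ (dotℤ (root j) (proj₂ u)) (dotℤ (root j) λ′) (sg ε k))
      (cong (λ z → z ℤ.+ sg ε k) (sym (Lℤ.dot-+ʳ (root j) (proj₂ u) λ′)))))
      where
      ring′ : ∀ a b c → (a ℤ.+ c) ℤ.+ b ≡ (a ℤ.+ b) ℤ.+ c
      ring′ = solve-∀

  fl-τ : ∀ {j} ν → Positive j → fl j (τ ν) ≡ dotℤ (root j) ν
  fl-τ {j} ν j>0 = trans (fl-img ν (img-id j) j>0) (ℤP.+-identityʳ _)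

  len-τ-+ : ∀ {ν ν′} → Dominant ν → Dominant ν′ → len (τ (ν +ᵛ ν′)) ≡ len (τ ν) ℕ.+ len (τ ν′)
  len-τ-+ {ν} {ν′} dom dom′ = sum-map-+ positives λ {j} j∈ → let j>0 = positive-∈ j∈ in begin
    ℤ.∣ fl j (τ (ν +ᵛ ν′)) ∣                    ≡⟨ cong ℤ.∣_∣ (trans (fl-τ (ν +ᵛ ν′) j>0) (Lℤ.dot-+ʳ (root j) ν ν′)) ⟩
    ℤ.∣ dotℤ (root j) ν ℤ.+ dotℤ (root j) ν′ ∣  ≡⟨ abs-+ (dom j j>0) (dom′ j j>0) ⟩
    ℤ.∣ dotℤ (root j) ν ∣ ℕ.+ ℤ.∣ dotℤ (root j) ν′ ∣ ≡⟨ cong₂ (λ a b → ℤ.∣ a ∣ ℕ.+ ℤ.∣ b ∣) (fl-τ ν j>0) (fl-τ ν′ j>0) ⟨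
    ℤ.∣ fl j (τ ν) ∣ ℕ.+ ℤ.∣ fl j (τ ν′) ∣  ∎
    where open ≡-Reasoning

  -- Each positive root contributes t = t + 0 or t = (t - 1) + 1, according to its sign under M.
  -- Hence lengths add in τ_ν = (τ_ν w)w⁻¹.
  len-deep : ∀ {M ν} → InW M → Deep ν → len (τ ν) ≡ len (M , ν) ℕ.+ len (M , V.replicate n 0ℤ)
  len-deep {M} {ν} inW deep = sum-map-+ positives pointwise
    where
    cases : ∀ ε {t} → 1ℤ ℤ.≤ t → ℤ.∣ t ∣ ≡ ℤ.∣ t ℤ.+ off ε ∣ ℕ.+ ℤ.∣ 0ℤ ℤ.+ off ε ∣
    cases pos {t} _ = sym (trans (ℕP.+-identityʳ _) (cong ℤ.∣_∣ (ℤP.+-identityʳ t)))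
    cases neg {t} 1≤t = trans (abs-suc 1≤t) (ℕP.+-comm 1 _)
    pointwise : ∀ {j} → j ∈ positives → ℤ.∣ fl j (τ ν) ∣ ≡ ℤ.∣ fl j (M , ν) ∣ ℕ.+ ℤ.∣ fl j (M , V.replicate n 0ℤ) ∣
    pointwise {j} j∈ =
      let (ε , i , i>0 , im) = signed-image inW j
          j>0 = positive-∈ j∈
      in trans (cong ℤ.∣_∣ (fl-τ ν j>0)) (trans (cases ε (deep j j>0))
           (sym (cong₂ (λ a b → ℤ.∣ a ∣ ℕ.+ ℤ.∣ b ∣) (fl-img ν im i>0) (trans (fl-img (V.replicate n 0ℤ) im i>0) (cong (ℤ._+ off ε) (dot-0ʳ (root j)))))))

  len-S : ∀ {s} → IsS s → len s ≡ 1
  len-S {s} h = let (i , k , W) = wall h in trans (cong len (sym (·-idˡ s))) (Split.result W)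
    where
    module Split {i k} (W : Wall s i k) where
      open Step {idE} InW-id W
      result : len (idE · s) ≡ 1
      result = case away⊎toward of λ where
        (inj₁ a) → trans (len-away a) (cong suc len-idE)
        (inj₂ t) → ⊥-elim (ℕP.1+n≢0 (trans (sym (len-toward t)) len-idE))

  len-of-Ω : ∀ {g} → IsΩ g → len g ≡ 0
  len-of-Ω {g} Ωg = trans (cong len (sym (·-idˡ g))) (trans (len-Ω {idE} {g} InW-id Ωg) len-idE)

-- Right multiplication of X_A by the generators

module Hecke {c ℓ : Level} (D : RootDatum) (d : Geometry.Elt D → ℕ) (d-conj : Geometry.ConjInvariant D d) (R : Ring c ℓ)
  (Q Qi : Ring.Carrier R) (T : Geometry.Elt D → Ring.Carrier R) (H : HeckeOver.IsHecke D d R Q Qi T)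
  (BD : HeckeOver.Bernstein D d R Q Qi T) where
  open Dominance D d d-conj public
  open HeckeOver D d R using (Carrier; _≈_; _+_; _*_; -_; 0#; 1#; module IsHecke; module Bernstein)
  module ℛ = Ring R
  open ℛ using (*-assoc; *-cong; *-congˡ; *-congʳ; *-identityˡ; *-identityʳ; +-cong; +-congˡ; +-congʳ; distribˡ; distribʳ)
  open IsHecke H
  open Bernstein BD
  open SetoidReasoning ℛ.setoid

  Qpow : ℤ → Carrier
  Qpow = HeckeOver.Qpow D d R Q Qi

  qs : Elt → Carrier
  qs = HeckeOver.qs D d R Q Qi

  Qpow-suc : ∀ z → Qpow (1ℤ ℤ.+ z) ≈ Q * Qpow z
  Qpow-suc (+ k) = ℛ.refl
  Qpow-suc -[1+ zero ] = begin
    1#             ≈⟨ Q-Qi ⟨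
    Q * Qi         ≈⟨ *-congˡ (*-identityʳ Qi) ⟨
    Q * (Qi * 1#)  ∎
  Qpow-suc -[1+ suc k ] = begin
    Qpow -[1+ k ]             ≈⟨ *-identityˡ _ ⟨
    1# * Qpow -[1+ k ]        ≈⟨ *-congʳ Q-Qi ⟨
    (Q * Qi) * Qpow -[1+ k ]  ≈⟨ *-assoc Q Qi _ ⟩
    Q * (Qi * Qpow -[1+ k ])  ∎

  Qpow-pred : ∀ z → Qpow (ℤ.- 1ℤ ℤ.+ z) ≈ Qi * Qpow z
  Qpow-pred z = begin
    Qpow (ℤ.- 1ℤ ℤ.+ z)                ≈⟨ *-identityˡ _ ⟨
    1# * Qpow (ℤ.- 1ℤ ℤ.+ z)           ≈⟨ *-congʳ Qi-Q ⟨
    (Qi * Q) * Qpow (ℤ.- 1ℤ ℤ.+ z)     ≈⟨ *-assoc Qi Q _ ⟩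
    Qi * (Q * Qpow (ℤ.- 1ℤ ℤ.+ z))     ≈⟨ *-congˡ (Qpow-suc (ℤ.- 1ℤ ℤ.+ z)) ⟨
    Qi * Qpow (1ℤ ℤ.+ (ℤ.- 1ℤ ℤ.+ z))  ≡⟨ cong (λ w → Qi * Qpow w) (ring z) ⟩
    Qi * Qpow z                        ∎
    where
    ring : ∀ z → 1ℤ ℤ.+ (ℤ.- 1ℤ ℤ.+ z) ≡ z
    ring = solve-∀

  Qpow-+ : ∀ a b → Qpow (a ℤ.+ b) ≈ Qpow a * Qpow b
  Qpow-+ (+ zero) b = ℛ.trans (ℛ.reflexive (cong Qpow (ℤP.+-identityˡ b))) (ℛ.sym (*-identityˡ _))
  Qpow-+ (+ suc k) b = begin
    Qpow ((+ suc k) ℤ.+ b)       ≡⟨ cong Qpow (ℤP.+-assoc 1ℤ (+ k) b) ⟩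
    Qpow (1ℤ ℤ.+ ((+ k) ℤ.+ b))  ≈⟨ Qpow-suc ((+ k) ℤ.+ b) ⟩
    Q * Qpow ((+ k) ℤ.+ b)       ≈⟨ *-congˡ (Qpow-+ (+ k) b) ⟩
    Q * (Qpow (+ k) * Qpow b)    ≈⟨ *-assoc Q _ _ ⟨
    (Q * Qpow (+ k)) * Qpow b    ∎
  Qpow-+ -[1+ zero ] b = ℛ.trans (Qpow-pred b) (*-congʳ (ℛ.sym (*-identityʳ Qi)))
  Qpow-+ -[1+ suc k ] b = begin
    Qpow (-[1+ suc k ] ℤ.+ b)  ≡⟨ cong Qpow (ℤP.+-assoc (ℤ.- 1ℤ) -[1+ k ] b) ⟩
    Qpow (ℤ.- 1ℤ ℤ.+ (-[1+ k ] ℤ.+ b)) ≈⟨ Qpow-pred (-[1+ k ] ℤ.+ b) ⟩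
    Qi * Qpow (-[1+ k ] ℤ.+ b)     ≈⟨ *-congˡ (Qpow-+ -[1+ k ] b) ⟩
    Qi * (Qpow -[1+ k ] * Qpow b)  ≈⟨ *-assoc Qi _ _ ⟨
    (Qi * Qpow -[1+ k ]) * Qpow b  ∎

  Qi-central : ∀ h → Qi * h ≈ h * Qi
  Qi-central h = begin
    Qi * h               ≈⟨ *-congˡ (*-identityʳ h) ⟨
    Qi * (h * 1#)        ≈⟨ *-congˡ (*-congˡ Q-Qi) ⟨
    Qi * (h * (Q * Qi))  ≈⟨ *-congˡ (*-assoc h Q Qi) ⟨
    Qi * ((h * Q) * Qi)  ≈⟨ *-congˡ (*-congʳ (Q-central h)) ⟨
    Qi * ((Q * h) * Qi)  ≈⟨ *-assoc Qi (Q * h) Qi ⟨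
    (Qi * (Q * h)) * Qi  ≈⟨ *-congʳ (*-assoc Qi Q h) ⟨
    ((Qi * Q) * h) * Qi  ≈⟨ *-congʳ (*-congʳ Qi-Q) ⟩
    (1# * h) * Qi        ≈⟨ *-congʳ (*-identityˡ h) ⟩
    h * Qi               ∎

  Central : Carrier → Set _
  Central z = ∀ h → z * h ≈ h * z

  central-* : ∀ {x y} → Central x → Central y → Central (x * y)
  central-* {x} {y} cx cy h = begin
    (x * y) * h  ≈⟨ *-assoc x y h ⟩
    x * (y * h)  ≈⟨ *-congˡ (cy h) ⟩
    x * (h * y)  ≈⟨ *-assoc x h y ⟨
    (x * h) * y  ≈⟨ *-congʳ (cx h) ⟩
    (h * x) * y  ≈⟨ *-assoc h x y ⟩
    h * (x * y)  ∎

  central-1 : Central 1#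
  central-1 h = ℛ.trans (*-identityˡ h) (ℛ.sym (*-identityʳ h))

  central-powℕ : ∀ {x} → Central x → ∀ k → Central (HeckeOver.powℕ D d R x k)
  central-powℕ cx zero = central-1
  central-powℕ cx (suc k) = central-* cx (central-powℕ cx k)

  Qpow-central : ∀ z → Central (Qpow z)
  Qpow-central (+ k) = central-powℕ Q-central k
  Qpow-central -[1+ k ] = central-powℕ Qi-central (suc k)

  qs-central : ∀ s → Central (qs s)
  qs-central s = Qpow-central (+ (2 ℕ.* d s))

  pull : ∀ {z} → Central z → ∀ x y → x * (z * y) ≈ z * (x * y)
  pull {z} cz x y = begin
    x * (z * y)  ≈⟨ *-assoc x z y ⟨
    (x * z) * y  ≈⟨ *-congʳ (cz x) ⟨
    (z * x) * y  ≈⟨ *-assoc z x y ⟩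
    z * (x * y)  ∎

  T-· : ∀ {v w} → InWa v → InWa w → len (v · w) ≡ len v ℕ.+ len w → T v * T w ≈ T (v · w)
  T-· {v} {w} inv inw eq = length-add v w (len v) (len w) inv inw (isLength {v} inv) (isLength {w} inw)
    (subst (IsLength (v · w)) eq (isLength {v · w} (InWa-· {v} {w} inv inw)))

  -- A word of `len v` letters is reduced, so its weight is the exponent of q_v.
  qv-≡ : ∀ {v q} → InWa v → FactorsAs v (len v) q → qv v ≡ q
  qv-≡ {v} inv F = trans (qv-spec v word last inv isFact (subst (IsLength v) (sym length≡) (isLength {v} inv))) weight≡
    where open FactorsAs F

  qv-factors : ∀ {v} → InWa v → FactorsAs v (len v) (qv v)
  qv-factors {v} inv = let (q , F) = reduced-factorization {v} inv in factors-cong refl refl (sym (qv-≡ {v} inv F)) F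

  qv-· : ∀ {v w} → InWa v → InWa w → len (v · w) ≡ len v ℕ.+ len w → qv (v · w) ≡ qv v ℕ.+ qv w
  qv-· {v} {w} inv inw eq = qv-≡ {v · w} (InWa-· {v} {w} inv inw)
    (factors-cong refl (sym eq) refl (factors-· (qv-factors {v} inv) (qv-factors {w} inw)))

  qv-inverse : ∀ {v w} → InWa v → InWa w → v · w ≡ idE → w · v ≡ idE → qv w ≡ qv v
  qv-inverse {v} {w} inv inw vw wv = qv-≡ {w} inw (factors-cong refl (sym (len-inverse {v} {w} inv inw vw wv)) refl
    (factors-inverse {v} {w} (qv-factors {v} inv) inw vw wv))

  qv-S : ∀ {s} → IsS s → qv s ≡ d s
  qv-S {s} h = qv-≡ {s} (IsS-InWa h) (factors-cong refl (sym (len-S h)) refl (factors-S h))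

  qv-Ω : ∀ {g} → IsΩ g → qv g ≡ 0
  qv-Ω {g} h = qv-≡ {g} (proj₁ h) (factors-cong refl (sym (len-of-Ω {g} h)) refl (factors-Ω {g} h))

  -- The exponent of Q in q_{τ_λ′} / q_{τ_λ′ u}; each term occurs twice because q = Q².
  expo : Vec ℤ n → Elt → ℤ
  expo λ′ u = (+ qv (τ λ′)) ℤ.+ (+ qv (τ λ′)) ℤ.- ((+ qv (shift λ′ u)) ℤ.+ (+ qv (shift λ′ u)))

  -- T̄_w inverts T_{w⁻¹}, so the inverse of T_{τ_λ′} is T̄ at the inverse translation.
  T⁻¹ : Vec ℤ n → Carrier
  T⁻¹ λ′ = Tbar (proj₁ (inverse {τ λ′} InW-id))

  T⁻¹-inverse : ∀ λ′ → (T⁻¹ λ′ * T (τ λ′) ≈ 1#) × (T (τ λ′) * T⁻¹ λ′ ≈ 1#)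
  T⁻¹-inverse λ′ = Tbar-spec (proj₁ inv) (τ λ′) (proj₁ (proj₂ inv)) (proj₁ (proj₂ (proj₂ inv)))
    where inv = inverse {τ λ′} InW-id

  T-τ-comm : ∀ {λ′ ν} → Dominant λ′ → Dominant ν → T (τ λ′) * T (τ ν) ≈ T (τ ν) * T (τ λ′)
  T-τ-comm {λ′} {ν} dom dom′ = begin
    T (τ λ′) * T (τ ν)  ≈⟨ T-· {τ λ′} {τ ν} InW-id InW-id (trans (cong len (τ-· λ′ ν)) (trans (cong (len ∘ τ) (+ᵛ-comm ν λ′)) (len-τ-+ dom dom′))) ⟩
    T (τ λ′ · τ ν)      ≡⟨ cong T (trans (τ-· λ′ ν) (trans (cong τ (+ᵛ-comm ν λ′)) (sym (τ-· ν λ′)))) ⟩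
    T (τ ν · τ λ′)      ≈⟨ T-· {τ ν} {τ λ′} InW-id InW-id (trans (cong len (τ-· ν λ′)) (trans (cong (len ∘ τ) (+ᵛ-comm λ′ ν)) (len-τ-+ dom′ dom))) ⟨
    T (τ ν) * T (τ λ′)  ∎
    where
    +ᵛ-comm : ∀ (x y : Vec ℤ n) → x +ᵛ y ≡ y +ᵛ x
    +ᵛ-comm = VP.zipWith-comm ℤP.+-comm
    τ-· : ∀ x y → τ x · τ y ≡ τ (y +ᵛ x)
    τ-· x y = cong₂ _,_ (matMul-idˡ idMat) (cong (_+ᵛ x) (matVec-id y))

  -- For λ′ deep in the dominant chamber, X_A is q^{l(τ_λ′) − l(τ_λ′ u)} T_{τ_λ′}⁻¹ T_{τ_λ′ u}.
  XA-deep : ∀ {u} → InWa u → ∀ {λ′} → Dominant λ′ → Deep (proj₂ u +ᵛ λ′) →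
    XA u ≈ Qpow (expo λ′ u) * (T⁻¹ λ′ * T (shift λ′ u))
  XA-deep {u@(M , μ)} inu {λ′} dom deep = begin
    Qpow (qw (-ᵛ μ)) * (Qpow (+ (2 ℕ.* qv w)) * (X μ * Tbar w))
      ≈⟨ *-congˡ (*-congˡ (*-congʳ X≈)) ⟩
    Qpow (qw (-ᵛ μ)) * (Qpow (+ (2 ℕ.* qv w)) * ((Qpow (ℤ.- qw μ) * (y * T (τ ν))) * Tbar w))
      ≈⟨ *-congˡ (*-congˡ (ℛ.trans (*-assoc _ _ _) (*-congˡ (ℛ.trans (*-assoc y (T (τ ν)) (Tbar w)) (*-congˡ TτTbar))))) ⟩
    Qpow (qw (-ᵛ μ)) * (Qpow (+ (2 ℕ.* qv w)) * (Qpow (ℤ.- qw μ) * (y * T uλ)))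
      ≈⟨ *-congˡ (*-assoc _ _ _) ⟨
    Qpow (qw (-ᵛ μ)) * ((Qpow (+ (2 ℕ.* qv w)) * Qpow (ℤ.- qw μ)) * (y * T uλ))
      ≈⟨ *-assoc _ _ _ ⟨
    (Qpow (qw (-ᵛ μ)) * (Qpow (+ (2 ℕ.* qv w)) * Qpow (ℤ.- qw μ))) * (y * T uλ)
      ≈⟨ *-congʳ (ℛ.trans (Qpow-+ (qw (-ᵛ μ)) _) (*-congˡ (Qpow-+ (+ (2 ℕ.* qv w)) (ℤ.- qw μ)))) ⟨
    Qpow (qw (-ᵛ μ) ℤ.+ ((+ (2 ℕ.* qv w)) ℤ.+ ℤ.- qw μ)) * (y * T uλ)
      ≡⟨ cong (λ e → Qpow e * (y * T uλ)) exponent ⟩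
    Qpow (expo λ′ u) * (y * T uλ) ∎
    where
    w uλ : Elt
    w = finPart u
    uλ = shift λ′ u
    ν : Vec ℤ n
    ν = μ +ᵛ λ′
    y : Carrier
    y = T⁻¹ λ′
    domν : Dominant ν
    domν = Deep⇒Dominant deep
    inv : ∃[ w′ ] (InWa w′ × w · w′ ≡ idE × w′ · w ≡ idE)
    inv = inverse {w} inu
    w⁻¹ : Elt
    w⁻¹ = proj₁ inv
    inw⁻¹ : InWa w⁻¹
    inw⁻¹ = proj₁ (proj₂ inv)
    ww⁻¹ : w · w⁻¹ ≡ idE
    ww⁻¹ = proj₁ (proj₂ (proj₂ inv))
    w⁻¹w : w⁻¹ · w ≡ idE
    w⁻¹w = proj₂ (proj₂ (proj₂ inv))
    ν-λ : ν -ᵛ λ′ ≡ μ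
    ν-λ = pointwise μ λ′
      where
      ring : ∀ a b → (a ℤ.+ b) ℤ.- b ≡ a
      ring = solve-∀
      pointwise : ∀ {m} (x y : Vec ℤ m) → (x +ᵛ y) -ᵛ y ≡ x
      pointwise [] [] = refl
      pointwise (x ∷ xs) (y ∷ ys) = cong₂ _∷_ (ring x y) (pointwise xs ys)
    λ-ν : λ′ -ᵛ ν ≡ -ᵛ μ
    λ-ν = pointwise μ λ′
      where
      ring : ∀ a b → b ℤ.- (a ℤ.+ b) ≡ ℤ.- a
      ring = solve-∀
      pointwise : ∀ {m} (x y : Vec ℤ m) → y -ᵛ (x +ᵛ y) ≡ -ᵛ x
      pointwise [] [] = refl
      pointwise (x ∷ xs) (y ∷ ys) = cong₂ _∷_ (ring x y) (pointwise xs ys)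
    -- Dominant translations have commuting T's, and conjugating by T_{τ_λ′} passes this on to its
    -- inverse.
    T-y : T (τ ν) * y ≈ y * T (τ ν)
    T-y = begin
      T (τ ν) * y                     ≈⟨ *-identityˡ _ ⟨
      1# * (T (τ ν) * y)              ≈⟨ *-congʳ (proj₁ (T⁻¹-inverse λ′)) ⟨
      (y * T (τ λ′)) * (T (τ ν) * y)  ≈⟨ *-assoc y _ _ ⟩
      y * (T (τ λ′) * (T (τ ν) * y))  ≈⟨ *-congˡ (*-assoc _ _ y) ⟨
      y * ((T (τ λ′) * T (τ ν)) * y)  ≈⟨ *-congˡ (*-congʳ (T-τ-comm dom domν)) ⟩
      y * ((T (τ ν) * T (τ λ′)) * y)  ≈⟨ *-congˡ (*-assoc _ _ y) ⟩
      y * (T (τ ν) * (T (τ λ′) * y))  ≈⟨ *-congˡ (*-congˡ (proj₂ (T⁻¹-inverse λ′))) ⟩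
      y * (T (τ ν) * 1#)              ≈⟨ *-congˡ (*-identityʳ _) ⟩
      y * T (τ ν)                     ∎
    -- μ is written as the difference ν - λ′ of dominant weights.
    X≈ : X μ ≈ Qpow (ℤ.- qw μ) * (y * T (τ ν))
    X≈ = begin
      X μ  ≡⟨ cong X ν-λ ⟨
      X (ν -ᵛ λ′)  ≈⟨ X-spec ν λ′ y domν dom (proj₂ (T⁻¹-inverse λ′)) (proj₁ (T⁻¹-inverse λ′)) ⟩
      Qpow (ℤ.- qw (ν -ᵛ λ′)) * (T (τ ν) * y)  ≡⟨ cong (λ z → Qpow (ℤ.- qw z) * (T (τ ν) * y)) ν-λ ⟩
      Qpow (ℤ.- qw μ) * (T (τ ν) * y)  ≈⟨ *-congˡ T-y ⟩
      Qpow (ℤ.- qw μ) * (y * T (τ ν))  ∎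
    uλw⁻¹ : uλ · w⁻¹ ≡ τ ν
    uλw⁻¹ = trans (cong (_· w⁻¹) split) (trans (·-assoc (τ ν) w w⁻¹) (trans (cong (τ ν ·_) ww⁻¹) (·-idʳ (τ ν))))
      where
      split : uλ ≡ τ ν · w
      split = cong₂ _,_ (sym (matMul-idˡ M)) (sym (trans (cong (_+ᵛ ν) (matVec-id _)) (+ᵛ-identityˡ ν)))
    lengths : len (uλ · w⁻¹) ≡ len uλ ℕ.+ len w⁻¹
    lengths = trans (cong len uλw⁻¹) (trans (len-deep {M} {ν} inu deep) (cong (len uλ ℕ.+_) (sym (len-inverse {w} {w⁻¹} inu inw⁻¹ ww⁻¹ w⁻¹w))))
    -- T_{τ_ν} = T_{τ_λ′ u} T_{w⁻¹} by additivity of lengths, and T̄_w cancels the second factor.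
    TτTbar : T (τ ν) * Tbar w ≈ T uλ
    TτTbar = begin
      T (τ ν) * Tbar w         ≡⟨ cong (λ z → T z * Tbar w) uλw⁻¹ ⟨
      T (uλ · w⁻¹) * Tbar w    ≈⟨ *-congʳ (T-· {uλ} {w⁻¹} inu inw⁻¹ lengths) ⟨
      (T uλ * T w⁻¹) * Tbar w  ≈⟨ *-assoc _ _ _ ⟩
      T uλ * (T w⁻¹ * Tbar w)  ≈⟨ *-congˡ (proj₂ (Tbar-spec w w⁻¹ inu w⁻¹w)) ⟩
      T uλ * 1#                ≈⟨ *-identityʳ _ ⟩
      T uλ                     ∎
    qv-ν : qv (τ ν) ≡ qv uλ ℕ.+ qv w
    qv-ν = trans (cong qv (sym uλw⁻¹)) (trans (qv-· {uλ} {w⁻¹} inu inw⁻¹ lengths) (cong (qv uλ ℕ.+_) (qv-inverse {w} {w⁻¹} inu inw⁻¹ ww⁻¹ w⁻¹w)))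
    exponent : qw (-ᵛ μ) ℤ.+ ((+ (2 ℕ.* qv w)) ℤ.+ ℤ.- qw μ) ≡ expo λ′ u
    exponent = trans (cong₂ (λ a b → a ℤ.+ ((+ (2 ℕ.* qv w)) ℤ.+ ℤ.- b))
        (trans (cong qw (sym λ-ν)) (trans (qw-spec λ′ ν dom domν) (cong (λ z → (+ qv (τ λ′)) ℤ.- z) qv-ν′)))
        (trans (cong qw (sym ν-λ)) (trans (qw-spec ν λ′ domν dom) (cong (λ z → z ℤ.- (+ qv (τ λ′))) qv-ν′))))
      (trans (cong (λ z → ((+ qv (τ λ′)) ℤ.- ((+ qv uλ) ℤ.+ (+ qv w))) ℤ.+ (z ℤ.+ ℤ.- (((+ qv uλ) ℤ.+ (+ qv w)) ℤ.- (+ qv (τ λ′))))) (ℤP.pos-* 2 (qv w)))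
        (ring (+ qv (τ λ′)) (+ qv uλ) (+ qv w)))
      where
      qv-ν′ : + qv (τ ν) ≡ (+ qv uλ) ℤ.+ (+ qv w)
      qv-ν′ = cong +_ qv-ν
      ring : ∀ l u w → (l ℤ.- (u ℤ.+ w)) ℤ.+ ((+ 2) ℤ.* w ℤ.+ ℤ.- ((u ℤ.+ w) ℤ.- l)) ≡ l ℤ.+ l ℤ.- (u ℤ.+ u)
      ring = solve-∀

  -- One translation deep enough for two alcoves at once: only with the same λ′ do the factors
  -- T_{τ_λ′}⁻¹ of X_A and X_{As} agree.
  module _ (u v : Elt) where
    private
      bound : Elt → ℕ
      bound u = maxFin (λ i → ℤ.∣ dotℤ (root i) (proj₂ u) ∣)
      K : ℕ
      K = suc (bound u ℕ.+ bound v)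

    common : Vec ℤ n
    common = scaleℤ (+ K) ρ

    common-dominant : Dominant common
    common-dominant = multiple-dominant K

    common-deepˡ : Deep (proj₂ u +ᵛ common)
    common-deepˡ = multiple-deep (proj₂ u) K (ℕ.s≤s (ℕP.m≤m+n (bound u) (bound v)))

    common-deepʳ : Deep (proj₂ v +ᵛ common)
    common-deepʳ = multiple-deep (proj₂ v) K (ℕ.s≤s (ℕP.m≤n+m (bound v) (bound u)))

  -- T_{τ_λ′}⁻¹ stays on the left while T_{τ_λ′ u} absorbs T_v, and q_v is the quotient of the two
  -- normalizing powers. The cases v in S^a and v in Ω are both instances.
  XA-· : ∀ {u v} → InWa u → InWa v → ∀ {λ′} → Dominant λ′ → Deep (proj₂ u +ᵛ λ′) → Deep (proj₂ (u · v) +ᵛ λ′) →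
    len (shift λ′ u · v) ≡ len (shift λ′ u) ℕ.+ len v → XA u * T v ≈ Qpow (+ (2 ℕ.* qv v)) * XA (u · v)
  XA-· {u} {v} inu inv {λ′} dom deep deep′ lengths = begin
    XA u * T v  ≈⟨ *-congʳ (XA-deep {u} inu dom deep) ⟩
    (Qpow (expo λ′ u) * (T⁻¹ λ′ * T uλ)) * T v  ≈⟨ *-assoc _ _ _ ⟩
    Qpow (expo λ′ u) * ((T⁻¹ λ′ * T uλ) * T v)  ≈⟨ *-congˡ (*-assoc _ _ _) ⟩
    Qpow (expo λ′ u) * (T⁻¹ λ′ * (T uλ * T v))  ≈⟨ *-congˡ (*-congˡ (T-· {uλ} {v} inu inv lengths)) ⟩
    Qpow (expo λ′ u) * (T⁻¹ λ′ * T (uλ · v))  ≡⟨ cong₂ (λ e w → Qpow e * (T⁻¹ λ′ * T w)) exponent (sym (shift-· λ′ u v)) ⟩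
    Qpow ((+ (2 ℕ.* qv v)) ℤ.+ expo λ′ uv) * (T⁻¹ λ′ * T (shift λ′ uv)) ≈⟨ *-congʳ (Qpow-+ (+ (2 ℕ.* qv v)) (expo λ′ uv)) ⟩
    (Qpow (+ (2 ℕ.* qv v)) * Qpow (expo λ′ uv)) * (T⁻¹ λ′ * T (shift λ′ uv)) ≈⟨ *-assoc _ _ _ ⟩
    Qpow (+ (2 ℕ.* qv v)) * (Qpow (expo λ′ uv) * (T⁻¹ λ′ * T (shift λ′ uv))) ≈⟨ *-congˡ (XA-deep {uv} (InWa-· {u} {v} inu inv) dom deep′) ⟨
    Qpow (+ (2 ℕ.* qv v)) * XA uv  ∎
    where
    uv uλ : Elt
    uv = u · v
    uλ = shift λ′ u
    qv-uv : qv (shift λ′ uv) ≡ qv uλ ℕ.+ qv v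
    qv-uv = trans (cong qv (shift-· λ′ u v)) (qv-· {uλ} {v} inu inv lengths)
    exponent : expo λ′ u ≡ (+ (2 ℕ.* qv v)) ℤ.+ expo λ′ uv
    exponent = trans (ring (+ qv (τ λ′)) (+ qv uλ) (+ qv v)) (cong₂ (λ a b → a ℤ.+ ((+ qv (τ λ′)) ℤ.+ (+ qv (τ λ′)) ℤ.- (b ℤ.+ b)))
        (sym (ℤP.pos-* 2 (qv v))) (sym (cong +_ qv-uv)))
      where
      ring : ∀ l u s → l ℤ.+ l ℤ.- (u ℤ.+ u) ≡ (+ 2) ℤ.* s ℤ.+ (l ℤ.+ l ℤ.- ((u ℤ.+ s) ℤ.+ (u ℤ.+ s)))
      ring = solve-∀

  XA-·S : ∀ {u s} → InWa u → IsS s → ∀ {λ′} → Dominant λ′ → Deep (proj₂ u +ᵛ λ′) → Deep (proj₂ (u · s) +ᵛ λ′) →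
    len (shift λ′ u · s) ≡ suc (len (shift λ′ u)) → XA u * T s ≈ qs s * XA (u · s)
  XA-·S {u} {s} inu h {λ′} dom deep deep′ longer = subst (λ k → XA u * T s ≈ Qpow (+ (2 ℕ.* k)) * XA (u · s)) (qv-S h)
    (XA-· {u} {s} inu (IsS-InWa h) dom deep deep′ (trans longer (trans (ℕP.+-comm 1 _) (cong (len (shift λ′ u) ℕ.+_) (sym (len-S h))))))

  XA-Ω : ∀ {u g} → InWa u → IsΩ g → XA u * T g ≈ XA (u · g)
  XA-Ω {u} {g} inu Ωg = ℛ.trans (XA-· {u} {g} inu (proj₁ Ωg) (common-dominant u (u · g)) (common-deepˡ u (u · g)) (common-deepʳ u (u · g)) lengths)
    (ℛ.trans (*-congʳ (ℛ.reflexive (cong (λ k → Qpow (+ (2 ℕ.* k))) (qv-Ω {g} Ωg)))) (*-identityˡ _))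
    where
    uλ : Elt
    uλ = shift (common u (u · g)) u
    lengths : len (uλ · g) ≡ len uλ ℕ.+ len g
    lengths = trans (len-Ω {uλ} {g} inu Ωg) (trans (sym (ℕP.+-identityʳ (len uλ))) (cong (len uλ ℕ.+_) (sym (len-of-Ω {g} Ωg))))

  XA-up : ∀ {u s} → InWa u → IsS s → Prec u s → XA u * T s ≈ qs s * XA (u · s)
  XA-up {u} {s} inu h prec = XA-·S {u} {s} inu h (common-dominant u (u · s)) (common-deepˡ u (u · s)) (common-deepʳ u (u · s))
    (let (i , k , W) = wall h in len-up {u} inu W (common u (u · s)) (common-deepˡ u (u · s)) (Cross.Prec⇒Up {u} inu W prec))

  -- If A ≻ As then X_{As} T_s = q_s X_A; multiply once more by T_s and cancel q_s.
  XA-down : ∀ {u s} → InWa u → IsS s → ¬ Prec u s → XA u * T s ≈ XA (u · s) + (qs s + - 1#) * XA u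
  XA-down {u} {s} inu h ¬prec = begin
    XA u * T s  ≈⟨ cancel (XA u * T s) ⟨
    q⁻¹ * (qs s * (XA u * T s))  ≈⟨ *-congˡ (*-assoc _ _ _) ⟨
    q⁻¹ * ((qs s * XA u) * T s)  ≈⟨ *-congˡ (*-congʳ XA-us) ⟨
    q⁻¹ * ((XA us * T s) * T s)  ≈⟨ *-congˡ (*-assoc _ _ _) ⟩
    q⁻¹ * (XA us * (T s * T s))  ≈⟨ *-congˡ (*-congˡ (quadratic s h)) ⟩
    q⁻¹ * (XA us * (qs s * T idE + p * T s))  ≈⟨ *-congˡ (distribˡ _ _ _) ⟩
    q⁻¹ * (XA us * (qs s * T idE) + XA us * (p * T s))
      ≈⟨ *-congˡ (+-cong (pull (qs-central s) _ _) (pull p-central _ _)) ⟩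
    q⁻¹ * (qs s * (XA us * T idE) + p * (XA us * T s))
      ≈⟨ *-congˡ (+-cong (*-congˡ (ℛ.trans (*-congˡ T-id) (*-identityʳ _))) (ℛ.trans (*-congˡ XA-us) (pull (qs-central s) p (XA u)))) ⟩
    q⁻¹ * (qs s * XA us + qs s * (p * XA u))  ≈⟨ *-congˡ (distribˡ _ _ _) ⟨
    q⁻¹ * (qs s * (XA us + p * XA u))         ≈⟨ cancel _ ⟩
    XA us + p * XA u                          ∎
    where
    us : Elt
    us = u · s
    λ′ : Vec ℤ n
    λ′ = common u us
    p q⁻¹ : Carrier
    p = qs s + - 1#
    q⁻¹ = Qpow (ℤ.- (+ (2 ℕ.* d s)))
    cancel : ∀ x → q⁻¹ * (qs s * x) ≈ x
    cancel x = begin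
      q⁻¹ * (qs s * x)  ≈⟨ *-assoc _ _ _ ⟨
      (q⁻¹ * qs s) * x  ≈⟨ *-congʳ (Qpow-+ (ℤ.- (+ (2 ℕ.* d s))) (+ (2 ℕ.* d s))) ⟨
      Qpow (ℤ.- (+ (2 ℕ.* d s)) ℤ.+ (+ (2 ℕ.* d s))) * x  ≡⟨ cong (λ z → Qpow z * x) (ℤP.+-inverseˡ (+ (2 ℕ.* d s))) ⟩
      1# * x  ≈⟨ *-identityˡ x ⟩
      x                   ∎
    p-central : Central p
    p-central z = begin
      (qs s + - 1#) * z      ≈⟨ distribʳ z _ _ ⟩
      qs s * z + (- 1#) * z  ≈⟨ +-cong (qs-central s z) (ℛ.trans (ℛ.sym (-‿distribˡ-* 1# z)) (ℛ.trans (ℛ.-‿cong (central-1 z)) (-‿distribʳ-* z 1#))) ⟩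
      z * qs s + z * (- 1#)  ≈⟨ distribˡ z _ _ ⟨
      z * (qs s + - 1#)      ∎
      where open import Algebra.Properties.Ring R using (-‿distribˡ-*; -‿distribʳ-*)
    uss : us · s ≡ u
    uss = ·-cancel-involution u (IsS-involutive h)
    -- The descent from A to As, read from As, is the ascent back to A.
    longer : len (shift λ′ us · s) ≡ suc (len (shift λ′ us))
    longer = trans (cong len (trans (sym (shift-· λ′ us s)) (cong (shift λ′) uss)))
      (trans (let (i , k , W) = wall h in len-down {u} inu W λ′ (common-deepʳ u us) (Cross.¬Prec⇒Down {u} inu W ¬prec))
        (cong (suc ∘ len) (sym (shift-· λ′ u s))))
    XA-us : XA us * T s ≈ qs s * XA u
    XA-us = ℛ.trans (XA-·S {us} {s} (InWa-· {u} {s} inu (IsS-InWa h)) h (common-dominant u us) (common-deepʳ u us)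
        (subst (λ w → Deep (proj₂ w +ᵛ λ′)) (sym uss) (common-deepˡ u us)) longer)
      (*-congˡ (ℛ.reflexive (cong XA uss)))

  Tprod : List Letter → Carrier
  Tprod = foldr (λ l z → T (eltOf l) * z) 1#

  -- Every prefix of a minimal type multiplies with its next letter additively in length: by
  -- `minimal-len` for a reflection, trivially for an element of Ω.
  T-minimal : ∀ {t v} → MinimalType t v → T v ≈ Tprod t
  T-minimal {t} {v} M@(valid , _) = begin
    T v                     ≡⟨ cong T (trans (minimal-end M) (sym (·-idˡ (prodL t)))) ⟩
    T (prodL [] · prodL t)  ≈⟨ go [] t M [] valid ⟨
    T (prodL []) * Tprod t  ≈⟨ *-congʳ T-id ⟩
    1# * Tprod t            ≈⟨ *-identityˡ _ ⟩
    Tprod t                 ∎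
    where
    -- Minimality is carried for the whole type, since the length statement for a prefix depends on
    -- the letters that follow.
    go : ∀ pre rest → MinimalType (pre ++ rest) v → ValidType pre → ValidType rest → T (prodL pre) * Tprod rest ≈ T (prodL pre · prodL rest)
    go pre [] M vp [] = ℛ.trans (*-identityʳ _) (ℛ.reflexive (cong T (sym (·-idʳ (prodL pre)))))
    go pre (l ∷ rest) M vp (h ∷ hs) = begin
      T (prodL pre) * (T (eltOf l) * Tprod rest)  ≈⟨ *-assoc _ _ _ ⟨
      (T (prodL pre) * T (eltOf l)) * Tprod rest  ≈⟨ *-congʳ (T-· {prodL pre} {eltOf l} inp (letter-InWa {l} h) (lengths l h M)) ⟩
      T (prodL pre · eltOf l) * Tprod rest        ≡⟨ cong (λ w → T w * Tprod rest) snoc ⟨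
      T (prodL (pre L.∷ʳ l)) * Tprod rest         ≈⟨ go (pre L.∷ʳ l) rest (subst (λ t → MinimalType t v) (sym (LP.∷ʳ-++ pre l rest)) M) (AllP.++⁺ vp (h ∷ [])) hs ⟩
      T (prodL (pre L.∷ʳ l) · prodL rest)         ≡⟨ cong T (trans (cong (_· prodL rest) snoc) (·-assoc (prodL pre) (eltOf l) (prodL rest))) ⟩
      T (prodL pre · (eltOf l · prodL rest))      ∎
      where
      inp : InWa (prodL pre)
      inp = prodL-InWa vp
      snoc : prodL (pre L.∷ʳ l) ≡ prodL pre · eltOf l
      snoc = trans (prodL-++ pre (l ∷ [])) (cong (prodL pre ·_) (·-idʳ (eltOf l)))
      lengths : ∀ l → ValidLetter l → MinimalType (pre ++ l ∷ rest) v → len (prodL pre · eltOf l) ≡ len (prodL pre) ℕ.+ len (eltOf l)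
      lengths (S s) h M = trans (minimal-len pre rest M) (trans (ℕP.+-comm 1 _) (cong (len (prodL pre) ℕ.+_) (sym (len-S h))))
      lengths (O g) h M = trans (len-Ω {prodL pre} {g} inp h) (trans (sym (ℕP.+-identityʳ _)) (cong (len (prodL pre) ℕ.+_) (sym (len-of-Ω {g} h))))

-- Expansion over positively folded galleries

module Galleries {c ℓ : Level} (D : RootDatum) (d : Geometry.Elt D → ℕ) (d-conj : Geometry.ConjInvariant D d) (R : Ring c ℓ)
  (Q Qi : Ring.Carrier R) (T : Geometry.Elt D → Ring.Carrier R) (H : HeckeOver.IsHecke D d R Q Qi T)
  (BD : HeckeOver.Bernstein D d R Q Qi T) where
  open Hecke D d d-conj R Q Qi T H BD
  open HeckeOver D d R using (Carrier; _≈_; _+_; _*_; -_; 0#; 1#; sumR; module Bernstein; PosWeight; w-nil; w-Ω; w-up; w-down; w-fold)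
  open ℛ using (+-cong; +-congˡ; +-congʳ; *-cong; *-congˡ; *-congʳ; *-assoc; distribˡ; distribʳ)
  open Bernstein BD using (XA)
  open SetoidReasoning ℛ.setoid

  PosW : ∀ {u t B} → Gallery u t B → Carrier → Set _
  PosW = PosWeight Q Qi

  module _ {a} {A : Set a} where
    sumR-↭ : ∀ (f : A → Carrier) {xs ys} → xs ↭ ys → sumR (map f xs) ≈ sumR (map f ys)
    sumR-↭ f Perm.refl = ℛ.refl
    sumR-↭ f (Perm.prep x p) = +-congˡ (sumR-↭ f p)
    sumR-↭ f (Perm.swap {xs} {ys} x y p) = begin
      f x + (f y + sumR (map f xs))  ≈⟨ ℛ.+-assoc _ _ _ ⟨
      (f x + f y) + sumR (map f xs)  ≈⟨ +-cong (ℛ.+-comm (f x) (f y)) (sumR-↭ f p) ⟩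
      (f y + f x) + sumR (map f ys)  ≈⟨ ℛ.+-assoc _ _ _ ⟩
      f y + (f x + sumR (map f ys))  ∎
    sumR-↭ f (Perm.trans p q) = ℛ.trans (sumR-↭ f p) (sumR-↭ f q)

    sumR-cong : ∀ {f g : A → Carrier} → (∀ x → f x ≈ g x) → ∀ xs → sumR (map f xs) ≈ sumR (map g xs)
    sumR-cong eq [] = ℛ.refl
    sumR-cong eq (x ∷ xs) = +-cong (eq x) (sumR-cong eq xs)

    sumR-++ : ∀ (f : A → Carrier) xs ys → sumR (map f (xs ++ ys)) ≈ sumR (map f xs) + sumR (map f ys)
    sumR-++ f [] ys = ℛ.sym (ℛ.+-identityˡ _)
    sumR-++ f (x ∷ xs) ys = ℛ.trans (+-congˡ (sumR-++ f xs ys)) (ℛ.sym (ℛ.+-assoc _ _ _))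

    sumR-*ˡ : ∀ k (f : A → Carrier) xs → sumR (map (λ x → k * f x) xs) ≈ k * sumR (map f xs)
    sumR-*ˡ k f [] = ℛ.sym (ℛ.zeroʳ k)
    sumR-*ˡ k f (x ∷ xs) = ℛ.trans (+-congˡ (sumR-*ˡ k f xs)) (ℛ.sym (distribˡ k _ _))

    sumR-*ʳ : ∀ k (f : A → Carrier) xs → sumR (map (λ x → f x * k) xs) ≈ sumR (map f xs) * k
    sumR-*ʳ k f [] = ℛ.sym (ℛ.zeroˡ k)
    sumR-*ʳ k f (x ∷ xs) = ℛ.trans (+-congˡ (sumR-*ʳ k f xs)) (ℛ.sym (distribʳ k _ _))

    -- With coefficients `Lt`, a sum over endpoints is a double sum over endpoints and galleries
    -- ending there; fibres turn it into a single sum over galleries.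
    module Fibres (end : A → Elt) (f : A → Carrier) where
      fibre : List A → Elt → Carrier
      fibre xs B = sumR (map f (filter (λ x → end x ≟E B) xs))

      fibre-hit : ∀ x xs B → end x ≡ B → fibre (x ∷ xs) B ≡ f x + fibre xs B
      fibre-hit x xs B eq = cong (sumR ∘ map f) (LP.filter-accept (λ x → end x ≟E B) eq)

      fibre-miss : ∀ x xs B → end x ≢ B → fibre (x ∷ xs) B ≡ fibre xs B
      fibre-miss x xs B ne = cong (sumR ∘ map f) (LP.filter-reject (λ x → end x ≟E B) ne)

      fibres-miss : ∀ x xs {Bs} → All (end x ≢_) Bs → sumR (map (fibre (x ∷ xs)) Bs) ≈ sumR (map (fibre xs) Bs)
      fibres-miss x xs [] = ℛ.refl
      fibres-miss x xs {B ∷ Bs} (ne ∷ nes) = +-cong (ℛ.reflexive (fibre-miss x xs B ne)) (fibres-miss x xs nes)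

      fibres-hit : ∀ x xs {Bs} → Unique Bs → end x ∈ Bs → sumR (map (fibre (x ∷ xs)) Bs) ≈ f x + sumR (map (fibre xs) Bs)
      fibres-hit x xs {B ∷ Bs} (B∉ ∷ _) (here eq) = begin
        fibre (x ∷ xs) B + sumR (map (fibre (x ∷ xs)) Bs)  ≈⟨ +-cong (ℛ.reflexive (fibre-hit x xs B eq)) (fibres-miss x xs (subst (λ z → All (z ≢_) Bs) (sym eq) B∉)) ⟩
        (f x + fibre xs B) + sumR (map (fibre xs) Bs)      ≈⟨ ℛ.+-assoc _ _ _ ⟩
        f x + (fibre xs B + sumR (map (fibre xs) Bs))      ∎
      fibres-hit x xs {B ∷ Bs} (B∉ ∷ uniq) (there x∈) = begin
        fibre (x ∷ xs) B + sumR (map (fibre (x ∷ xs)) Bs)  ≈⟨ +-cong (ℛ.reflexive (fibre-miss x xs B (λ eq → All.lookup B∉ x∈ (sym eq)))) (fibres-hit x xs uniq x∈) ⟩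
        fibre xs B + (f x + sumR (map (fibre xs) Bs))      ≈⟨ ℛ.+-assoc _ _ _ ⟨
        (fibre xs B + f x) + sumR (map (fibre xs) Bs)      ≈⟨ +-congʳ (ℛ.+-comm _ _) ⟩
        (f x + fibre xs B) + sumR (map (fibre xs) Bs)      ≈⟨ ℛ.+-assoc _ _ _ ⟩
        f x + (fibre xs B + sumR (map (fibre xs) Bs))      ∎

      sum-fibres : ∀ xs {Bs} → Unique Bs → (∀ {x} → x ∈ xs → end x ∈ Bs) → sumR (map (fibre xs) Bs) ≈ sumR (map f xs)
      sum-fibres [] {Bs} uniq _ = zeros Bs
        where
        zeros : ∀ Bs → sumR (map (fibre []) Bs) ≈ 0#
        zeros [] = ℛ.refl
        zeros (B ∷ Bs) = ℛ.trans (ℛ.+-identityˡ _) (zeros Bs)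
      sum-fibres (x ∷ xs) uniq ⊆Bs = ℛ.trans (fibres-hit x xs uniq (⊆Bs (here refl))) (+-congˡ (sum-fibres xs uniq (⊆Bs ∘ there)))

  -- The gallery and the truth of `Prec` at each crossing leave one constructor of `PosWeight` at
  -- every step.
  weight-unique : ∀ {u t B} {σ : Gallery u t B} {L L′} → PosW σ L → PosW σ L′ → L ≡ L′
  weight-unique w-nil w-nil = refl
  weight-unique (w-Ω p) (w-Ω q) = weight-unique p q
  weight-unique (w-up {s = s} _ p) (w-up _ q) = cong (qs s *_) (weight-unique p q)
  weight-unique (w-up a p) (w-down b q) = ⊥-elim (b a)
  weight-unique (w-down a p) (w-up b q) = ⊥-elim (a b)
  weight-unique (w-down _ p) (w-down _ q) = weight-unique p q
  weight-unique (w-fold {s = s} _ p) (w-fold _ q) = cong ((qs s + - 1#) *_) (weight-unique p q)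

  -- Dropping the `PosWeight` proof leaves an entry determined by its gallery, so that lists can be
  -- compared without comparing proofs of `Prec`.
  Weighted : Elt → List Letter → Set c
  Weighted u t = Σ Elt λ B → Gallery u t B × Carrier

  keyOf : ∀ {u t} → Weighted u t → Σ Elt (Gallery u t)
  keyOf (B , σ , _) = B , σ

  term : ∀ {u t} → Weighted u t → Carrier
  term (B , _ , L) = L * XA B

  -- The product formula together with the evidence that its terms are all positively folded
  -- galleries, each once; the induction on the type builds both at the same time.
  record Expansion (u : Elt) (t : List Letter) : Set (c ⊔ ℓ) where
    field
      list     : List (Weighted u t)
      unique   : Unique (map keyOf list)
      sound    : All (λ x → PosW (proj₁ (proj₂ x)) (proj₂ (proj₂ x))) list
      complete : ∀ {B} {σ : Gallery u t B} {L} → PosW σ L → (B , σ , L) ∈ list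
      expands  : XA u * Tprod t ≈ sumR (map term list)

  crossK : ∀ {u ts} l → Σ Elt (Gallery (u · eltOf l) ts) → Σ Elt (Gallery u (l ∷ ts))
  crossK l (B , σ) = B , cross l σ

  foldK : ∀ {u ts} s → Σ Elt (Gallery u ts) → Σ Elt (Gallery u (S s ∷ ts))
  foldK s (B , σ) = B , fold s σ

  crossK-injective : ∀ {u ts} l {x y : Σ Elt (Gallery (u · eltOf l) ts)} → crossK {u} l x ≡ crossK l y → x ≡ y
  crossK-injective l refl = refl

  foldK-injective : ∀ {u ts} s {x y : Σ Elt (Gallery u ts)} → foldK s x ≡ foldK s y → x ≡ y
  foldK-injective s refl = refl

  crossK≢foldK : ∀ {u ts} s (x : Σ Elt (Gallery (u · s) ts)) (y : Σ Elt (Gallery u ts)) → crossK {u} (S s) x ≢ foldK s y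
  crossK≢foldK s x y ()

  crossW : ∀ {u ts} l → (Carrier → Carrier) → Weighted (u · eltOf l) ts → Weighted u (l ∷ ts)
  crossW l f (B , σ , L) = B , cross l σ , f L

  foldW : ∀ {u ts} s → Weighted u ts → Weighted u (S s ∷ ts)
  foldW s (B , σ , L) = B , fold s σ , (qs s + - 1#) * L

  map-keyOf-cross : ∀ {u ts} l f (xs : List (Weighted (u · eltOf l) ts)) → map keyOf (map (crossW {u} l f) xs) ≡ map (crossK l) (map keyOf xs)
  map-keyOf-cross l f xs = trans (sym (LP.map-∘ xs)) (LP.map-∘ xs)

  map-keyOf-fold : ∀ {u ts} s (xs : List (Weighted u ts)) → map keyOf (map (foldW s) xs) ≡ map (foldK s) (map keyOf xs)
  map-keyOf-fold s xs = trans (sym (LP.map-∘ xs)) (LP.map-∘ xs)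

  unique-cross : ∀ {u ts} l f {xs : List (Weighted (u · eltOf l) ts)} → Unique (map keyOf xs) → Unique (map keyOf (map (crossW {u} l f) xs))
  unique-cross {u} l f {xs} h = subst Unique (sym (map-keyOf-cross {u} l f xs)) (UniqueP.map⁺ (crossK-injective {u} l) h)

  unique-fold : ∀ {u ts} s {xs : List (Weighted u ts)} → Unique (map keyOf xs) → Unique (map keyOf (map (foldW s) xs))
  unique-fold s {xs} h = subst Unique (sym (map-keyOf-fold s xs)) (UniqueP.map⁺ (foldK-injective s) h)

  expand-nil : ∀ u → Expansion u []
  expand-nil u = record
    { list = (u , nil , 1#) ∷ []
    ; unique = [] ∷ []
    ; sound = w-nil ∷ []
    ; complete = λ { w-nil → here refl }
    ; expands = ℛ.trans (ℛ.*-identityʳ _) (ℛ.sym (ℛ.trans (ℛ.+-identityʳ _) (ℛ.*-identityˡ _)))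
    }

  expand-Ω : ∀ {u g ts} → InWa u → IsΩ g → Expansion (u · g) ts → Expansion u (O g ∷ ts)
  expand-Ω {u} {g} {ts} inu h E = record
    { list = map (crossW (O g) (λ L → L)) list
    ; unique = unique-cross {u} (O g) (λ L → L) unique
    ; sound = AllP.map⁺ (All.map w-Ω sound)
    ; complete = λ { (w-Ω p) → ∈-map⁺ (crossW (O g) (λ L → L)) (complete p) }
    ; expands = begin
        XA u * (T g * Tprod ts)  ≈⟨ *-assoc _ _ _ ⟨
        (XA u * T g) * Tprod ts  ≈⟨ *-congʳ (XA-Ω {u} {g} inu h) ⟩
        XA (u · g) * Tprod ts    ≈⟨ expands ⟩
        sumR (map term list)     ≡⟨ cong sumR (LP.map-∘ list) ⟩
        sumR (map term (map (crossW (O g) (λ L → L)) list)) ∎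
    }
    where open Expansion E

  expand-up : ∀ {u s ts} → InWa u → IsS s → Prec u s → Expansion (u · s) ts → Expansion u (S s ∷ ts)
  expand-up {u} {s} {ts} inu h prec E = record
    { list = map up list
    ; unique = unique-cross {u} (S s) (qs s *_) unique
    ; sound = AllP.map⁺ (All.map (w-up prec) sound)
    ; complete = λ where
        (w-up _ p) → ∈-map⁺ up (complete p)
        (w-down ¬prec _) → ⊥-elim (¬prec prec)
        (w-fold ¬prec _) → ⊥-elim (¬prec prec)
    ; expands = begin
        XA u * (T s * Tprod ts)                ≈⟨ *-assoc _ _ _ ⟨
        (XA u * T s) * Tprod ts                ≈⟨ *-congʳ (XA-up {u} {s} inu h prec) ⟩
        (qs s * XA (u · s)) * Tprod ts         ≈⟨ *-assoc _ _ _ ⟩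
        qs s * (XA (u · s) * Tprod ts)         ≈⟨ *-congˡ expands ⟩
        qs s * sumR (map term list)            ≈⟨ sumR-*ˡ (qs s) term list ⟨
        sumR (map (λ x → qs s * term x) list)  ≈⟨ sumR-cong (λ x → *-assoc _ _ _) list ⟨
        sumR (map (term ∘ up) list)            ≡⟨ cong sumR (LP.map-∘ list) ⟩
        sumR (map term (map up list))          ∎
    }
    where
    open Expansion E
    up : Weighted (u · s) ts → Weighted u (S s ∷ ts)
    up = crossW (S s) (qs s *_)

  -- The two terms of the product are the two admissible steps: crossing downwards with weight 1,
  -- and a positive fold with weight q_s - 1.
  expand-down : ∀ {u s ts} → InWa u → IsS s → ¬ Prec u s → Expansion (u · s) ts → Expansion u ts → Expansion u (S s ∷ ts)
  expand-down {u} {s} {ts} inu h ¬prec E F = record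
    { list = map down E.list ++ map (foldW s) F.list
    ; unique = subst Unique (sym (LP.map-++ keyOf (map down E.list) (map (foldW s) F.list)))
        (UniqueP.++⁺ (unique-cross {u} (S s) (λ L → L) E.unique) (unique-fold s F.unique) disjoint)
    ; sound = AllP.++⁺ (AllP.map⁺ (All.map (w-down ¬prec) E.sound)) (AllP.map⁺ (All.map (w-fold ¬prec) F.sound))
    ; complete = λ where
        (w-up prec _) → ⊥-elim (¬prec prec)
        (w-down _ p) → ∈-++⁺ˡ (∈-map⁺ down (E.complete p))
        (w-fold _ p) → ∈-++⁺ʳ (map down E.list) (∈-map⁺ (foldW s) (F.complete p))
    ; expands = begin
        XA u * (T s * Tprod ts)                         ≈⟨ *-assoc _ _ _ ⟨
        (XA u * T s) * Tprod ts                         ≈⟨ *-congʳ (XA-down {u} {s} inu h ¬prec) ⟩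
        (XA (u · s) + (qs s + - 1#) * XA u) * Tprod ts  ≈⟨ distribʳ _ _ _ ⟩
        XA (u · s) * Tprod ts + ((qs s + - 1#) * XA u) * Tprod ts
          ≈⟨ +-cong E.expands (ℛ.trans (*-assoc _ _ _) (*-congˡ F.expands)) ⟩
        sumR (map term E.list) + (qs s + - 1#) * sumR (map term F.list)
          ≈⟨ +-congˡ (ℛ.trans (sumR-cong (λ x → *-assoc _ _ _) F.list) (sumR-*ˡ (qs s + - 1#) term F.list)) ⟨
        sumR (map (term ∘ down) E.list) + sumR (map (term ∘ foldW s) F.list)
          ≡⟨ cong₂ (λ xs ys → sumR xs + sumR ys) (LP.map-∘ E.list) (LP.map-∘ F.list) ⟩
        sumR (map term (map down E.list)) + sumR (map term (map (foldW s) F.list))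
          ≈⟨ sumR-++ term (map down E.list) (map (foldW s) F.list) ⟨
        sumR (map term (map down E.list ++ map (foldW s) F.list)) ∎
    }
    where
    module E = Expansion E
    module F = Expansion F
    down : Weighted (u · s) ts → Weighted u (S s ∷ ts)
    down = crossW (S s) (λ L → L)
    disjoint : ∀ {k} → ¬ (k ∈ map keyOf (map down E.list) × k ∈ map keyOf (map (foldW s) F.list))
    disjoint {k} (k∈ , k∈′) =
      let (x , _ , eq) = ∈-map⁻ (crossK {u} (S s)) (subst (k ∈_) (map-keyOf-cross {u} (S s) (λ L → L) E.list) k∈)
          (y , _ , eq′) = ∈-map⁻ (foldK s) (subst (k ∈_) (map-keyOf-fold s F.list) k∈′)
      in crossK≢foldK s x y (trans (sym eq) eq′)

  expansion : ∀ {t} → ValidType t → ∀ {u} → InWa u → Expansion u t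
  expansion [] {u} inu = expand-nil u
  expansion {O g ∷ ts} (h ∷ hs) {u} inu = expand-Ω inu h (expansion hs {u · g} (InWa-· {u} {g} inu (proj₁ h)))
  expansion {S s ∷ ts} (h ∷ hs) {u} inu = choose (let (i , k , W) = wall h in Cross.Prec? {u} inu W)
    where
    next : Expansion (u · s) ts
    next = expansion hs {u · s} (InWa-· {u} {s} inu (IsS-InWa h))
    choose : Dec (Prec u s) → Expansion u (S s ∷ ts)
    choose (yes prec) = expand-up inu h prec next
    choose (no ¬prec) = expand-down inu h ¬prec next (expansion hs {u} inu)

  PFG : Elt → List Letter → Set _
  PFG = HeckeOver.PFG D d R Q Qi

  ends : ∀ {u t} → List (PFG u t) → List Elt
  ends = HeckeOver.ends D d R Q Qi

  forget : ∀ {u t} → PFG u t → Weighted u t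
  forget (B , σ , L , _) = B , σ , L

  module _ {u t} (E : Expansion u t) (Gs : List (PFG u t)) (enum : HeckeOver.Enumerates D d R Q Qi Gs) where
    open Expansion E

    forget-unique : Unique (map forget Gs)
    forget-unique = UniqueP.map⁻ (subst Unique (LP.map-∘ Gs) (proj₁ enum))

    -- Both lists are free of repetitions and have the same members, hence are permutations of each
    -- other. The enumeration controls only the galleries; `weight-unique` makes the weights agree.
    same-members : map forget Gs ↭ list
    same-members = ∼bag⇒↭ (unique∧set⇒bag forget-unique (UniqueP.map⁻ unique) (mk⇔ to from))
      where
      to : ∀ {x} → x ∈ map forget Gs → x ∈ list
      to x∈ = let ((B , σ , L , p) , _ , eq) = ∈-map⁻ forget x∈ in subst (_∈ list) (sym eq) (complete p)
      retrieve : ∀ {B} {σ : Gallery u t B} {L} → PosW σ L → Σ (PFG u t) (λ G → G ∈ Gs × (B , σ) ≡ HeckeOver.key D d R Q Qi G) → (B , σ , L) ∈ map forget Gs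
      retrieve p (G@(_ , _ , _ , q) , G∈ , refl) = subst (λ L → (_ , _ , L) ∈ map forget Gs) (weight-unique q p) (∈-map⁺ forget G∈)
      from : ∀ {x} → x ∈ list → x ∈ map forget Gs
      from {B , σ , L} x∈ = let p = All.lookup sound x∈ in retrieve p (∈-map⁻ (HeckeOver.key D d R Q Qi) (proj₂ enum B σ L p))

    Lt : Elt → Carrier
    Lt = HeckeOver.Lt D d R Q Qi Gs

    -- `ends` lists every endpoint exactly once, so the galleries are partitioned by it, and X_B is
    -- a common factor within each class.
    regroup : sumR (map (λ B → Lt B * XA B) (ends Gs)) ≈ sumR (map (term ∘ forget) Gs)
    regroup = begin
      sumR (map (λ B → Lt B * XA B) (ends Gs))  ≈⟨ sumR-cong (λ B → Lt-XA B Gs) (ends Gs) ⟩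
      sumR (map (fibre Gs) (ends Gs))           ≈⟨ sum-fibres Gs (deduplicate-! _≟E_ (map proj₁ Gs)) (λ x∈ → ∈-deduplicate⁺ _≟E_ (∈-map⁺ proj₁ x∈)) ⟩
      sumR (map (term ∘ forget) Gs)             ∎
      where
      open Fibres {A = PFG u t} proj₁ (term ∘ forget)
      Lt-XA : ∀ B Gs → HeckeOver.Lt D d R Q Qi Gs B * XA B ≈ fibre Gs B
      Lt-XA B Gs = ℛ.trans (ℛ.sym (sumR-*ʳ (XA B) (λ x → proj₁ (proj₂ (proj₂ x))) Gs′)) (rename Gs′ (AllP.all-filter (λ x → proj₁ x ≟E B) Gs))
        where
        Gs′ : List (PFG u t)
        Gs′ = filter (λ x → proj₁ x ≟E B) Gs
        rename : ∀ xs → All (λ x → proj₁ x ≡ B) xs → sumR (map (λ x → proj₁ (proj₂ (proj₂ x)) * XA B) xs) ≈ sumR (map (term ∘ forget) xs)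
        rename [] [] = ℛ.refl
        rename (x ∷ xs) (eq ∷ eqs) = +-cong (ℛ.reflexive (cong (λ B → proj₁ (proj₂ (proj₂ x)) * XA B) (sym eq))) (rename xs eqs)

    enumerated : XA u * Tprod t ≈ sumR (map (λ B → Lt B * XA B) (ends Gs))
    enumerated = begin
      XA u * Tprod t                            ≈⟨ expands ⟩
      sumR (map term list)                      ≈⟨ sumR-↭ term same-members ⟨
      sumR (map term (map forget Gs))           ≡⟨ cong sumR (LP.map-∘ Gs) ⟨
      sumR (map (term ∘ forget) Gs)             ≈⟨ regroup ⟨
      sumR (map (λ B → Lt B * XA B) (ends Gs))  ∎

theorem5p5 : ∀ {c ℓ : Level} (D : RootDatum) → let open Geometry D in
    (d : Elt → ℕ) → ConjInvariant d →
    (R : Ring c ℓ) → let open HeckeOver D d R in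
    (Q Qi : Carrier) (T : Elt → Carrier) → IsHecke Q Qi T →
    (BD : Bernstein Q Qi T) → let open Bernstein BD in
    (v : Elt) → InWa v → (t : List Letter) → MinimalType t v →
    (u : Elt) → InWa u →
    (Gs : List (PFG Q Qi u t)) → Enumerates Q Qi Gs →
    XA u * T v ≈ sumR (map (λ B → Lt Q Qi Gs B * XA B) (ends Q Qi Gs))
theorem5p5 D d d-conj R Q Qi T H BD v _ t M u inu Gs enum =
  Ring.trans R (Ring.*-congˡ R (T-minimal M)) (enumerated (expansion (proj₁ M) {u} inu) Gs enum)
  where
  open Galleries D d d-conj R Q Qi T H BD
  open Hecke D d d-conj R Q Qi T H BD using (T-minimal)
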